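{- Let $s,t\geq 1$ be integers and let $p,q,l$ be three distinct primes with $p,q$ odd, $p\equiv 3 \pmod 4$, $\mathrm{ord}_{p^s}(l)=\phi(p^s)/2$, $\mathrm{ord}_{q^t}(l)=\phi(q^t)$ and $\gcd(\phi(p^s),\phi(q^t))=2$. Let $0\leq i<i'\leq s-1$ and $0\leq j\leq t-1$. Then in the ring $\mathbb{F}_l[x]/\langle x^{p^sq^t}-1\rangle$: (i) If $q$ is a quadratic residue modulo $p$, then \[\chi_{ij}\chi_{i'j}^*=\frac{\phi(p^{s-i'})}{2}(q-2)q^{t-j-1}\chi_{ij}+\frac{\phi(p^{s-i'})}{2}\phi(q^{t-j})\sum_{j<m\leq t}\chi_{im}.\] (ii) If $q$ is a quadratic nonresidue modulo $p$, then \[ \chi_{ij}\chi_{i'j}^*=\frac{\phi(p^{s-i'})}{2}(q-2)q^{t-j-1}\chi_{ij}+\frac{\phi(p^{s-i'})}{2}\phi(q^{t-j})\Big(\sum_{\substack{j<m\leq t\\2\nmid m-j}}\chi_{im}^*+\sum_{\substack{j<m\leq t\\2\mid m-j}}\chi_{im}\Big). \]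
   Context: Here $\phi$ is Euler's phi function (with $\phi(1)=1$) and $\mathrm{ord}_m(k)$ is the multiplicative order of $k$ modulo $m$. Put $n=p^sq^t$. Fix an integer $g$ that is a primitive root both modulo $p^s$ and modulo $q^t$. For an integer $\gamma$, $C_\gamma=\{\gamma l^r \bmod n: r\geq 0\}\subseteq \mathbb{Z}_n$ is the $l$-cyclotomic coset modulo $n$ containing $\gamma$. For $0\leq i\leq s$, $0\leq j\leq t$ set $C_{ij}=C_{p^iq^j}$ and $C_{ij}^*=C_{p^iq^jg}$. Define elements of $\mathbb{F}_l[x]/\langle x^{n}-1\rangle$ by $\chi_{ij}=\sum_{\alpha\in C_{ij}}x^\alpha$ and $\chi_{ij}^*=\sum_{\alpha\in C_{ij}^*}x^\alpha$. Integer coefficients are read in $\mathbb{F}_l$, and empty sums are $0$. -}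

module Defs where

open import Level using (Level; 0ℓ; _⊔_)
open import Algebra.Bundles using (CommutativeRing; CommutativeSemigroup)
open import Data.Nat.Base as ℕ using (ℕ; zero; suc)
import Data.Nat.Properties as ℕ
open import Data.Nat.Coprimality using (coprime?)
open import Data.Nat.Induction using (<-rec)
open import Data.Integer.Base as ℤ using (ℤ; +_)
import Data.Integer.Properties as ℤ
import Data.Integer.DivMod as ℤ
import Data.Integer.Divisibility.Signed as ℤ
open import Data.Fin.Base as Fin using (Fin; toℕ; fromℕ<)
import Data.Fin.Properties as Fin
open import Data.List.Base using (List; []; _∷_; map; foldr; filter; length; upTo; allFin)
open import Data.Product.Base using (∃; _×_; _,_)
open import Relation.Binary.Bundles using (Setoid)
open import Relation.Binary.Structures using (IsEquivalence)
open import Data.Integer.Solver using (module +-*-Solver)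
open import Relation.Binary.PropositionalEquality
  using (_≡_; refl; sym; trans; cong; cong₂; subst; module ≡-Reasoning)
open import Relation.Nullary.Decidable.Core using (yes; no; map′)
open import Relation.Nullary.Negation.Core using (¬_)
open import Relation.Unary using (Decidable)
import Algebra.Definitions.RawMagma as RawMagmaDefinitions
import Algebra.Properties.CommutativeSemigroup as CommutativeSemigroupProperties
import Algebra.Properties.Ring as RingProperties
import Algebra.Properties.Semiring.Exp as Exp
import Relation.Binary.Reasoning.Setoid as SetoidReasoning

private
  variable
    c ℓ : Level

-- The quotient R/⟨m⟩ by a principal ideal: the carrier of R, with
-- x and y identified when m divides x - y.

module Quotient (R : CommutativeRing c ℓ) (m : CommutativeRing.Carrier R) where

  open CommutativeRing R renaming (refl to ≈-refl; sym to ≈-sym; trans to ≈-trans)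
  open RawMagmaDefinitions *-rawMagma using (_∣_; _,_)
  open RingProperties ring
  open CommutativeSemigroupProperties +-commutativeSemigroup using (interchange)
  open SetoidReasoning setoid

  infix 4 _∼_

  record _∼_ (x y : Carrier) : Set (c ⊔ ℓ) where
    constructor mod
    field divides : m ∣ x - y

  private
    ∣-resp : ∀ {x y} → x ≈ y → m ∣ x → m ∣ y
    ∣-resp x≈y (k , km≈x) = k , ≈-trans km≈x x≈y

    ∣-+ : ∀ {x y} → m ∣ x → m ∣ y → m ∣ x + y
    ∣-+ (j , jm≈x) (k , km≈y) = j + k , ≈-trans (distribʳ m j k) (+-cong jm≈x km≈y)

    ∣-neg : ∀ {x} → m ∣ x → m ∣ - x
    ∣-neg (k , km≈x) = - k , ≈-trans (≈-sym (-‿distribˡ-* k m)) (-‿cong km≈x)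

    ∣-*ˡ : ∀ {x} y → m ∣ x → m ∣ y * x
    ∣-*ˡ y (k , km≈x) = y * k , ≈-trans (*-assoc y k m) (*-congˡ km≈x)

    ∣-*ʳ : ∀ {x} y → m ∣ x → m ∣ x * y
    ∣-*ʳ y m∣x = ∣-resp (*-comm y _) (∣-*ˡ y m∣x)

    telescope : ∀ x y z → (x - y) + (y - z) ≈ x - z
    telescope x y z = begin
      (x - y) + (y - z)      ≈⟨ +-assoc x (- y) (y - z) ⟩
      x + (- y + (y - z))    ≈⟨ +-congˡ (+-assoc (- y) y (- z)) ⟨
      x + ((- y + y) - z)    ≈⟨ +-congˡ (+-congʳ (-‿inverseˡ y)) ⟩
      x + (0# - z)           ≈⟨ +-congˡ (+-identityˡ (- z)) ⟩
      x - z                  ∎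

    neg-minus : ∀ x y → - x - - y ≈ - (x - y)
    neg-minus x y = -‿+-comm x (- y)

    flip-minus : ∀ x y → - (x - y) ≈ y - x
    flip-minus x y = begin
      - (x - y)    ≈⟨ -‿+-comm x (- y) ⟨
      - x - - y    ≈⟨ +-congˡ (-‿involutive y) ⟩
      - x + y      ≈⟨ +-comm (- x) y ⟩
      y - x        ∎

    minus-+ : ∀ x y u v → (x - y) + (u - v) ≈ (x + u) - (y + v)
    minus-+ x y u v = ≈-trans (interchange x (- y) u (- v)) (+-congˡ (-‿+-comm y v))

    minus-* : ∀ x y u v → (x - y) * u + y * (u - v) ≈ x * u - y * v
    minus-* x y u v = begin
      (x - y) * u + y * (u - v)                ≈⟨ +-cong (distribʳ u x (- y)) (distribˡ y u (- v)) ⟩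
      (x * u + - y * u) + (y * u + y * - v)    ≈⟨ +-cong (+-congˡ (-‿distribˡ-* y u)) (+-congˡ (-‿distribʳ-* y v)) ⟨
      (x * u - y * u) + (y * u - y * v)        ≈⟨ telescope (x * u) (y * u) (y * v) ⟩
      x * u - y * v                            ∎

  ∼-of-≈ : ∀ {x y} → x ≈ y → x ∼ y
  ∼-of-≈ {x} {y} x≈y = mod (0# , (begin
    0# * m    ≈⟨ zeroˡ m ⟩
    0#        ≈⟨ -‿inverseʳ y ⟨
    y - y     ≈⟨ +-congʳ x≈y ⟨
    x - y     ∎))

  ∼-isEquivalence : IsEquivalence _∼_
  ∼-isEquivalence = record
    { refl  = ∼-of-≈ ≈-refl
    ; sym   = λ { (mod d) → mod (∣-resp (flip-minus _ _) (∣-neg d)) }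
    ; trans = λ { (mod d) (mod e) → mod (∣-resp (telescope _ _ _) (∣-+ d e)) }
    }

  quotientRing : CommutativeRing c (c ⊔ ℓ)
  quotientRing = record
    { Carrier = Carrier
    ; _≈_ = _∼_
    ; _+_ = _+_
    ; _*_ = _*_
    ; -_  = -_
    ; 0#  = 0#
    ; 1#  = 1#
    ; isCommutativeRing = record
      { isRing = record
        { +-isAbelianGroup = record
          { isGroup = record
            { isMonoid = record
              { isSemigroup = record
                { isMagma = record
                  { isEquivalence = ∼-isEquivalence
                  ; ∙-cong = λ { (mod d) (mod e) → mod (∣-resp (minus-+ _ _ _ _) (∣-+ d e)) }
                  }
                ; assoc = λ x y z → ∼-of-≈ (+-assoc x y z)
                }
              ; identity = (λ x → ∼-of-≈ (+-identityˡ x)) , (λ x → ∼-of-≈ (+-identityʳ x))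
              }
            ; inverse = (λ x → ∼-of-≈ (-‿inverseˡ x)) , (λ x → ∼-of-≈ (-‿inverseʳ x))
            ; ⁻¹-cong = λ { (mod d) → mod (∣-resp (≈-sym (neg-minus _ _)) (∣-neg d)) }
            }
          ; comm = λ x y → ∼-of-≈ (+-comm x y)
          }
        ; *-cong = λ { (mod d) (mod e) → mod (∣-resp (minus-* _ _ _ _) (∣-+ (∣-*ʳ _ d) (∣-*ˡ _ e))) }
        ; *-assoc = λ x y z → ∼-of-≈ (*-assoc x y z)
        ; *-identity = (λ x → ∼-of-≈ (*-identityˡ x)) , (λ x → ∼-of-≈ (*-identityʳ x))
        ; distrib = (λ x y z → ∼-of-≈ (distribˡ x y z)) , (λ x y z → ∼-of-≈ (distribʳ x y z))
        }
      ; *-comm = λ x y → ∼-of-≈ (*-comm x y)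
      }
    }

-- The polynomial ring R[x]. A polynomial is a list of coefficients, the
-- constant one first; trailing zeros are allowed, so that polynomials
-- are equal when all their coefficients are.

module Polynomial (R : CommutativeRing c ℓ) where

  open CommutativeRing R
    renaming (refl to ≈-refl; sym to ≈-sym; trans to ≈-trans)
  open RingProperties ring using (-0#≈0#)

  Poly : Set c
  Poly = List Carrier

  coeff : Poly → ℕ → Carrier
  coeff []      _       = 0#
  coeff (a ∷ f) zero    = a
  coeff (a ∷ f) (suc k) = coeff f k

  infix 4 _≋_

  record _≋_ (f g : Poly) : Set ℓ where
    constructor coeffwise
    field at : ∀ k → coeff f k ≈ coeff g k
  open _≋_ public

  infixl 6 _⊞_
  infixl 7 _⊠_
  infix  8 ⊟_

  _⊞_ : Poly → Poly → Poly
  []      ⊞ g       = g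
  (a ∷ f) ⊞ []      = a ∷ f
  (a ∷ f) ⊞ (b ∷ g) = a + b ∷ f ⊞ g

  ⊟_ : Poly → Poly
  ⊟ f = map (-_) f

  scale : Carrier → Poly → Poly
  scale a f = map (a *_) f

  _⊠_ : Poly → Poly → Poly
  []      ⊠ g = []
  (a ∷ f) ⊠ g = scale a g ⊞ (0# ∷ f ⊠ g)

  const : Carrier → Poly
  const a = a ∷ []

  X : Poly
  X = 0# ∷ 1# ∷ []

  ≋-isEquivalence : IsEquivalence _≋_
  ≋-isEquivalence = record
    { refl  = coeffwise λ k → ≈-refl
    ; sym   = λ p → coeffwise λ k → ≈-sym (at p k)
    ; trans = λ p q → coeffwise λ k → ≈-trans (at p k) (at q k)
    }

  ≋-setoid : Setoid c ℓ
  ≋-setoid = record { isEquivalence = ≋-isEquivalence }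

  open IsEquivalence ≋-isEquivalence using ()
    renaming (refl to ≋-refl; sym to ≋-sym; trans to ≋-trans)

  coeff-⊞ : ∀ f g k → coeff (f ⊞ g) k ≈ coeff f k + coeff g k
  coeff-⊞ []      g       k       = ≈-sym (+-identityˡ _)
  coeff-⊞ (a ∷ f) []      k       = ≈-sym (+-identityʳ _)
  coeff-⊞ (a ∷ f) (b ∷ g) zero    = ≈-refl
  coeff-⊞ (a ∷ f) (b ∷ g) (suc k) = coeff-⊞ f g k

  coeff-⊟ : ∀ f k → coeff (⊟ f) k ≈ - coeff f k
  coeff-⊟ []      k       = ≈-sym -0#≈0#
  coeff-⊟ (a ∷ f) zero    = ≈-refl
  coeff-⊟ (a ∷ f) (suc k) = coeff-⊟ f k

  coeff-scale : ∀ a f k → coeff (scale a f) k ≈ a * coeff f k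
  coeff-scale a []      k       = ≈-sym (zeroʳ a)
  coeff-scale a (b ∷ f) zero    = ≈-refl
  coeff-scale a (b ∷ f) (suc k) = coeff-scale a f k

  private
    via-⊞ : ∀ f g {h} → (∀ k → coeff f k + coeff g k ≈ coeff h k) → f ⊞ g ≋ h
    via-⊞ f g p = coeffwise λ k → ≈-trans (coeff-⊞ f g k) (p k)

    ∷-cong : ∀ {a b f g} → a ≈ b → f ≋ g → a ∷ f ≋ b ∷ g
    ∷-cong a≈b f≋g = coeffwise λ { zero → a≈b ; (suc k) → at f≋g k }

    tail-cong : ∀ {a b f g} → a ∷ f ≋ b ∷ g → f ≋ g
    tail-cong p = coeffwise λ k → at p (suc k)

    tail-zero : ∀ {a f} → a ∷ f ≋ [] → f ≋ []
    tail-zero p = coeffwise λ k → at p (suc k)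

    0∷-zero : ∀ {a f} → a ≈ 0# → f ≋ [] → a ∷ f ≋ []
    0∷-zero a≈0 f≋0 = coeffwise λ { zero → a≈0 ; (suc k) → at f≋0 k }

  ⊞-cong : ∀ {f f′ g g′} → f ≋ f′ → g ≋ g′ → f ⊞ g ≋ f′ ⊞ g′
  ⊞-cong {f} {f′} {g} {g′} p q = via-⊞ f g λ k →
    ≈-trans (+-cong (at p k) (at q k)) (≈-sym (coeff-⊞ f′ g′ k))

  ⊞-assoc : ∀ f g h → (f ⊞ g) ⊞ h ≋ f ⊞ (g ⊞ h)
  ⊞-assoc f g h = via-⊞ (f ⊞ g) h λ k →
    ≈-trans (+-congʳ (coeff-⊞ f g k)) (≈-trans (+-assoc _ _ _)
      (≈-trans (+-congˡ (≈-sym (coeff-⊞ g h k))) (≈-sym (coeff-⊞ f (g ⊞ h) k))))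

  ⊞-comm : ∀ f g → f ⊞ g ≋ g ⊞ f
  ⊞-comm f g = via-⊞ f g λ k → ≈-trans (+-comm _ _) (≈-sym (coeff-⊞ g f k))

  ⊞-commutativeSemigroup : CommutativeSemigroup c ℓ
  ⊞-commutativeSemigroup = record
    { isCommutativeSemigroup = record
      { isSemigroup = record
        { isMagma = record { isEquivalence = ≋-isEquivalence ; ∙-cong = ⊞-cong }
        ; assoc = ⊞-assoc
        }
      ; comm = ⊞-comm
      }
    }

  ⊞-identityʳ : ∀ f → f ⊞ [] ≋ f
  ⊞-identityʳ f = via-⊞ f [] λ k → +-identityʳ _

  ⊟-cong : ∀ {f g} → f ≋ g → ⊟ f ≋ ⊟ g
  ⊟-cong {f} {g} p = coeffwise λ k →
    ≈-trans (coeff-⊟ f k) (≈-trans (-‿cong (at p k)) (≈-sym (coeff-⊟ g k)))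

  ⊟-inverseʳ : ∀ f → f ⊞ ⊟ f ≋ []
  ⊟-inverseʳ f = via-⊞ f (⊟ f) λ k → ≈-trans (+-congˡ (coeff-⊟ f k)) (-‿inverseʳ _)

  private
    via-scale : ∀ a f {h} → (∀ k → a * coeff f k ≈ coeff h k) → scale a f ≋ h
    via-scale a f p = coeffwise λ k → ≈-trans (coeff-scale a f k) (p k)

    scale-cong : ∀ {a b f g} → a ≈ b → f ≋ g → scale a f ≋ scale b g
    scale-cong {a} {b} {f} {g} a≈b p = via-scale a f λ k →
      ≈-trans (*-cong a≈b (at p k)) (≈-sym (coeff-scale b g k))

    scale-zero : ∀ {a} f → a ≈ 0# → scale a f ≋ []
    scale-zero f a≈0 = via-scale _ f λ k → ≈-trans (*-congʳ a≈0) (zeroˡ _)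

    scale-⊞ : ∀ a f g → scale a (f ⊞ g) ≋ scale a f ⊞ scale a g
    scale-⊞ a f g = via-scale a (f ⊞ g) λ k →
      ≈-trans (*-congˡ (coeff-⊞ f g k)) (≈-trans (distribˡ _ _ _)
        (≈-trans (+-cong (≈-sym (coeff-scale a f k)) (≈-sym (coeff-scale a g k)))
          (≈-sym (coeff-⊞ (scale a f) (scale a g) k))))

    scale-+ : ∀ a b f → scale (a + b) f ≋ scale a f ⊞ scale b f
    scale-+ a b f = via-scale (a + b) f λ k →
      ≈-trans (distribʳ _ _ _)
        (≈-trans (+-cong (≈-sym (coeff-scale a f k)) (≈-sym (coeff-scale b f k)))
          (≈-sym (coeff-⊞ (scale a f) (scale b f) k)))

    scale-* : ∀ a b f → scale (a * b) f ≋ scale a (scale b f)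
    scale-* a b f = via-scale (a * b) f λ k →
      ≈-trans (*-assoc _ _ _) (≈-trans (*-congˡ (≈-sym (coeff-scale b f k)))
        (≈-sym (coeff-scale a (scale b f) k)))

    open CommutativeSemigroupProperties ⊞-commutativeSemigroup using (interchange; x∙yz≈y∙xz)
    open SetoidReasoning ≋-setoid

    zero-⊠ : ∀ f g → f ≋ [] → f ⊠ g ≋ []
    zero-⊠ []      g p = ≋-refl
    zero-⊠ (a ∷ f) g p = ⊞-cong (scale-zero g (at p 0)) (0∷-zero ≈-refl (zero-⊠ f g (tail-zero p)))

    ⊠-congʳ : ∀ f f′ g → f ≋ f′ → f ⊠ g ≋ f′ ⊠ g
    ⊠-congʳ []      f′       g p = ≋-sym (zero-⊠ f′ g (≋-sym p))
    ⊠-congʳ (a ∷ f) []       g p = zero-⊠ (a ∷ f) g p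
    ⊠-congʳ (a ∷ f) (b ∷ f′) g p =
      ⊞-cong (scale-cong {f = g} (at p 0) ≋-refl) (∷-cong ≈-refl (⊠-congʳ f f′ g (tail-cong p)))

    ⊠-congˡ : ∀ f {g g′} → g ≋ g′ → f ⊠ g ≋ f ⊠ g′
    ⊠-congˡ []      p = ≋-refl
    ⊠-congˡ (a ∷ f) p = ⊞-cong (scale-cong ≈-refl p) (∷-cong ≈-refl (⊠-congˡ f p))

    0∷-⊞ : ∀ f g → 0# ∷ f ⊞ g ≋ (0# ∷ f) ⊞ (0# ∷ g)
    0∷-⊞ f g = ∷-cong (≈-sym (+-identityˡ 0#)) ≋-refl

    shift-⊠ : ∀ f g → (0# ∷ f) ⊠ g ≋ 0# ∷ f ⊠ g
    shift-⊠ f g = ⊞-cong (scale-zero g ≈-refl) ≋-refl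

    scale-⊠ : ∀ a f g → scale a f ⊠ g ≋ scale a (f ⊠ g)
    scale-⊠ a []      g = ≋-refl
    scale-⊠ a (b ∷ f) g = begin
      scale (a * b) g ⊞ (0# ∷ scale a f ⊠ g)         ≈⟨ ⊞-cong (scale-* a b g) (∷-cong (≈-sym (zeroʳ a)) (scale-⊠ a f g)) ⟩
      scale a (scale b g) ⊞ scale a (0# ∷ f ⊠ g)     ≈⟨ scale-⊞ a (scale b g) (0# ∷ f ⊠ g) ⟨
      scale a (scale b g ⊞ (0# ∷ f ⊠ g))             ∎

    ⊠-distribʳ : ∀ h f g → (f ⊞ g) ⊠ h ≋ f ⊠ h ⊞ g ⊠ h
    ⊠-distribʳ h []      g       = ≋-refl
    ⊠-distribʳ h (a ∷ f) []      = ≋-sym (⊞-identityʳ _)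
    ⊠-distribʳ h (a ∷ f) (b ∷ g) = begin
      scale (a + b) h ⊞ (0# ∷ (f ⊞ g) ⊠ h)
        ≈⟨ ⊞-cong (scale-+ a b h) (≋-trans (∷-cong ≈-refl (⊠-distribʳ h f g)) (0∷-⊞ (f ⊠ h) (g ⊠ h))) ⟩
      (scale a h ⊞ scale b h) ⊞ ((0# ∷ f ⊠ h) ⊞ (0# ∷ g ⊠ h))
        ≈⟨ interchange (scale a h) (scale b h) (0# ∷ f ⊠ h) (0# ∷ g ⊠ h) ⟩
      (scale a h ⊞ (0# ∷ f ⊠ h)) ⊞ (scale b h ⊞ (0# ∷ g ⊠ h)) ∎

    ⊠-zeroʳ : ∀ f → f ⊠ [] ≋ []
    ⊠-zeroʳ []      = ≋-refl
    ⊠-zeroʳ (a ∷ f) = 0∷-zero ≈-refl (⊠-zeroʳ f)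

    ⊠-∷ : ∀ f b g → f ⊠ (b ∷ g) ≋ scale b f ⊞ (0# ∷ f ⊠ g)
    ⊠-∷ []      b g = ≋-sym (0∷-zero ≈-refl ≋-refl)
    ⊠-∷ (a ∷ f) b g = ∷-cong (+-congʳ (*-comm a b)) (begin
      scale a g ⊞ f ⊠ (b ∷ g)                    ≈⟨ ⊞-cong (≋-refl {scale a g}) (⊠-∷ f b g) ⟩
      scale a g ⊞ (scale b f ⊞ (0# ∷ f ⊠ g))     ≈⟨ x∙yz≈y∙xz (scale a g) (scale b f) (0# ∷ f ⊠ g) ⟩
      scale b f ⊞ (scale a g ⊞ (0# ∷ f ⊠ g))     ∎)

  ⊠-comm : ∀ f g → f ⊠ g ≋ g ⊠ f
  ⊠-comm []      g = ≋-sym (⊠-zeroʳ g)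
  ⊠-comm (a ∷ f) g =
    ≋-trans (⊞-cong (≋-refl {scale a g}) (∷-cong ≈-refl (⊠-comm f g))) (≋-sym (⊠-∷ g a f))

  ⊠-cong : ∀ {f f′ g g′} → f ≋ f′ → g ≋ g′ → f ⊠ g ≋ f′ ⊠ g′
  ⊠-cong {f} {f′} {g} p q = ≋-trans (⊠-congʳ f f′ g p) (⊠-congˡ f′ q)

  ⊠-assoc : ∀ f g h → (f ⊠ g) ⊠ h ≋ f ⊠ (g ⊠ h)
  ⊠-assoc []      g h = ≋-refl
  ⊠-assoc (a ∷ f) g h = begin
    (scale a g ⊞ (0# ∷ f ⊠ g)) ⊠ h           ≈⟨ ⊠-distribʳ h (scale a g) (0# ∷ f ⊠ g) ⟩
    scale a g ⊠ h ⊞ (0# ∷ f ⊠ g) ⊠ h         ≈⟨ ⊞-cong (scale-⊠ a g h) (≋-trans (shift-⊠ (f ⊠ g) h) (∷-cong ≈-refl (⊠-assoc f g h))) ⟩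
    scale a (g ⊠ h) ⊞ (0# ∷ f ⊠ (g ⊠ h))     ∎

  ⊠-identityˡ : ∀ f → const 1# ⊠ f ≋ f
  ⊠-identityˡ f = ≋-trans
    (⊞-cong (via-scale 1# f (λ k → *-identityˡ (coeff f k))) (0∷-zero ≈-refl ≋-refl))
    (⊞-identityʳ f)

  polynomialRing : CommutativeRing c ℓ
  polynomialRing = record
    { Carrier = Poly
    ; _≈_ = _≋_
    ; _+_ = _⊞_
    ; _*_ = _⊠_
    ; -_  = ⊟_
    ; 0#  = []
    ; 1#  = const 1#
    ; isCommutativeRing = record
      { isRing = record
        { +-isAbelianGroup = record
          { isGroup = record
            { isMonoid = record
              { isSemigroup = record
                { isMagma = record { isEquivalence = ≋-isEquivalence ; ∙-cong = ⊞-cong }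
                ; assoc = ⊞-assoc
                }
              ; identity = (λ f → ≋-refl) , ⊞-identityʳ
              }
            ; inverse = (λ f → ≋-trans (⊞-comm (⊟ f) f) (⊟-inverseʳ f)) , ⊟-inverseʳ
            ; ⁻¹-cong = ⊟-cong
            }
          ; comm = ⊞-comm
          }
        ; *-cong = ⊠-cong
        ; *-assoc = ⊠-assoc
        ; *-identity = ⊠-identityˡ , (λ f → ≋-trans (⊠-comm f (const 1#)) (⊠-identityˡ f))
        ; distrib =
            (λ h f g → ≋-trans (⊠-comm h (f ⊞ g)) (≋-trans (⊠-distribʳ h f g)
                         (⊞-cong (⊠-comm f h) (⊠-comm g h))))
          , ⊠-distribʳ
        }
      ; *-comm = ⊠-comm
      }
    }

-- For a prime l, 𝔽 l is the field with l elements.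
𝔽 : ℕ → CommutativeRing 0ℓ 0ℓ
𝔽 l = Quotient.quotientRing ℤ.+-*-commutativeRing (+ l)

infix 4 _≡_[mod_]

_≡_[mod_] : ℤ → ℤ → ℕ → Set
a ≡ b [mod m ] = + m ℤ.∣ a ℤ.- b

φ : ℕ → ℕ
φ m = length (filter (λ k → coprime? k m) (map suc (upTo m)))

-- HasOrder m k d means ord_m(k) = d.
record HasOrder (m : ℕ) (k : ℤ) (d : ℕ) : Set where
  field
    positive : 0 ℕ.< d
    power    : k ℤ.^ d ≡ + 1 [mod m ]
    least    : ∀ e → 0 ℕ.< e → k ℤ.^ e ≡ + 1 [mod m ] → d ℕ.≤ e

PrimitiveRoot : ℕ → ℤ → Set
PrimitiveRoot m g = HasOrder m g (φ m)

-- Residues and nonresidues modulo a prime p; multiples of p are neither.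
QuadraticResidue : ℕ → ℤ → Set
QuadraticResidue p a = ¬ (+ p ℤ.∣ a) × ∃ λ x → x ℤ.^ 2 ≡ a [mod p ]

QuadraticNonresidue : ℕ → ℤ → Set
QuadraticNonresidue p a = ¬ (+ p ℤ.∣ a) × ¬ ∃ λ x → x ℤ.^ 2 ≡ a [mod p ]

-- The class α ∈ ℤ_n lies in the l-cyclotomic coset of γ.
InCoset : (n l : ℕ) (γ : ℤ) → Fin n → Set
InCoset n l γ α = ∃ λ r → + toℕ α ≡ γ ℤ.* (+ l) ℤ.^ r [mod n ]

-- The residues γ l^r repeat among r = 0, …, n, so r < n suffices.
private
  module Decide (n l : ℕ) .{{_ : ℕ.NonZero n}} (γ : ℤ) (α : Fin n) where

    v : ℕ → ℤ
    v r = γ ℤ.* (+ l) ℤ.^ r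

    residue : ℤ → Fin n
    residue a = fromℕ< (ℤ.n%ℕd<d a n)

    residue-≡ : ∀ a b → residue a ≡ residue b → a ≡ b [mod n ]
    residue-≡ a b eq = ℤ.divides (x ℤ.- y) (begin
      a ℤ.- b
        ≡⟨ cong₂ ℤ._-_ (ℤ.a≡a%ℕn+[a/ℕn]*n a n) (ℤ.a≡a%ℕn+[a/ℕn]*n b n) ⟩
      (+ (a ℤ.%ℕ n) ℤ.+ x ℤ.* + n) ℤ.- (+ (b ℤ.%ℕ n) ℤ.+ y ℤ.* + n)
        ≡⟨ cong (λ e → (+ e ℤ.+ x ℤ.* + n) ℤ.- (+ (b ℤ.%ℕ n) ℤ.+ y ℤ.* + n)) same ⟩
      (+ (b ℤ.%ℕ n) ℤ.+ x ℤ.* + n) ℤ.- (+ (b ℤ.%ℕ n) ℤ.+ y ℤ.* + n)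
        ≡⟨ solve 4 (λ e x y n → (e :+ x :* n) :- (e :+ y :* n) := (x :- y) :* n) refl (+ (b ℤ.%ℕ n)) x y (+ n) ⟩
      (x ℤ.- y) ℤ.* + n ∎)
      where
      open ≡-Reasoning
      open +-*-Solver
      x = a ℤ./ℕ n
      y = b ℤ./ℕ n
      same : a ℤ.%ℕ n ≡ b ℤ.%ℕ n
      same = trans (sym (Fin.toℕ-fromℕ< (ℤ.n%ℕd<d a n)))
               (trans (cong toℕ eq) (Fin.toℕ-fromℕ< (ℤ.n%ℕd<d b n)))

    ≡-trans : ∀ a b c → a ≡ b [mod n ] → b ≡ c [mod n ] → a ≡ c [mod n ]
    ≡-trans a b c p q =
      subst (+ n ℤ.∣_) (solve 3 (λ a b c → (a :- b) :+ (b :- c) := a :- c) refl a b c)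
        (ℤ.∣m∣n⇒∣m+n p q)
      where
      open +-*-Solver

    shift : ∀ a b k → v a ≡ v b [mod n ] → v (b ℕ.+ k) ≡ v (a ℕ.+ k) [mod n ]
    shift a b k p = subst (+ n ℤ.∣_) (begin
      (γ ℤ.* (+ l) ℤ.^ a ℤ.- γ ℤ.* (+ l) ℤ.^ b) ℤ.* (ℤ.- ((+ l) ℤ.^ k))
        ≡⟨ solve 4 (λ g x y z → (g :* x :- g :* y) :* (:- z) := g :* (y :* z) :- g :* (x :* z))
             refl γ ((+ l) ℤ.^ a) ((+ l) ℤ.^ b) ((+ l) ℤ.^ k) ⟩
      γ ℤ.* ((+ l) ℤ.^ b ℤ.* (+ l) ℤ.^ k) ℤ.- γ ℤ.* ((+ l) ℤ.^ a ℤ.* (+ l) ℤ.^ k)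
        ≡⟨ cong₂ (λ x y → γ ℤ.* x ℤ.- γ ℤ.* y) (ℤ.^-distribˡ-+-* (+ l) b k) (ℤ.^-distribˡ-+-* (+ l) a k) ⟨
      v (b ℕ.+ k) ℤ.- v (a ℕ.+ k) ∎)
      (ℤ.∣m⇒∣m*n (ℤ.- ((+ l) ℤ.^ k)) p)
      where
      open ≡-Reasoning
      open +-*-Solver

    Bounded : Set
    Bounded = ∃ λ (r : Fin n) → + toℕ α ≡ v (toℕ r) [mod n ]

    bound : ∀ r → + toℕ α ≡ v r [mod n ] → Bounded
    bound = <-rec _ step
      where
      step : ∀ r → (∀ {r′} → r′ ℕ.< r → + toℕ α ≡ v r′ [mod n ] → Bounded) →
             + toℕ α ≡ v r [mod n ] → Bounded
      step r rec p with r ℕ.<? n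
      ... | yes r<n = fromℕ< r<n , subst (λ k → + toℕ α ≡ v k [mod n ]) (sym (Fin.toℕ-fromℕ< r<n)) p
      ... | no  r≮n with Fin.pigeonhole (ℕ.n<1+n n) (λ k → residue (v (toℕ k)))
      ...   | a , b , a<b , eq = rec smaller
                (≡-trans (+ toℕ α) (v (toℕ b ℕ.+ k)) (v (toℕ a ℕ.+ k))
                  (subst (λ k → + toℕ α ≡ v k [mod n ]) (sym b+k≡r) p)
                  (shift (toℕ a) (toℕ b) k (residue-≡ (v (toℕ a)) (v (toℕ b)) eq)))
        where
        k = r ℕ.∸ toℕ b
        b+k≡r : toℕ b ℕ.+ k ≡ r
        b+k≡r = ℕ.m+[n∸m]≡n (ℕ.≤-trans (ℕ.s≤s⁻¹ (Fin.toℕ<n b)) (ℕ.≮⇒≥ r≮n))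
        smaller : toℕ a ℕ.+ k ℕ.< r
        smaller = subst (toℕ a ℕ.+ k ℕ.<_) b+k≡r (ℕ.+-monoˡ-< k a<b)

inCoset? : (n l : ℕ) (γ : ℤ) → Decidable (InCoset n l γ)
inCoset? n@(suc _) l γ α =
  map′ (λ { (r , p) → toℕ r , p }) (λ { (r , p) → Decide.bound n l γ α r p })
    (Fin.any? λ r → + n ℤ.∣? (+ toℕ α ℤ.- γ ℤ.* (+ l) ℤ.^ toℕ r))

module CosetSums (s t p q l : ℕ) (g : ℤ) where

  n : ℕ
  n = p ℕ.^ s ℕ.* q ℕ.^ t

  open Polynomial (𝔽 l) using (X; const)

  𝔽[x] : CommutativeRing 0ℓ 0ℓ
  𝔽[x] = Polynomial.polynomialRing (𝔽 l)

  module 𝔽[x] where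
    open CommutativeRing 𝔽[x] public
    open Exp semiring public using (_^_)

  ring : CommutativeRing 0ℓ 0ℓ
  ring = Quotient.quotientRing 𝔽[x] (X 𝔽[x].^ n 𝔽[x].- 𝔽[x].1#)

  open CommutativeRing ring public using (Carrier; _≈_)
    renaming (_+_ to _⊕_; _*_ to _⊗_; 0# to 𝟘)

  ∑ : ∀ {A : Set} → List A → (A → Carrier) → Carrier
  ∑ xs f = foldr (λ a y → f a ⊕ y) 𝟘 xs

  ⟦_⟧ : ℕ → Carrier
  ⟦ k ⟧ = const (+ k)

  cosetSum : ℤ → Carrier
  cosetSum γ = ∑ (filter (inCoset? n l γ) (allFin n)) (λ α → X 𝔽[x].^ toℕ α)

  χ : ℕ → ℕ → Carrier
  χ i j = cosetSum (+ (p ℕ.^ i ℕ.* q ℕ.^ j))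

  χ* : ℕ → ℕ → Carrier
  χ* i j = cosetSum (+ (p ℕ.^ i ℕ.* q ℕ.^ j) ℤ.* g)

-- The integers m with j < m ≤ t.
⦅_,_⦆ : ℕ → ℕ → List ℕ
⦅ j , t ⦆ = filter (j ℕ.<?_) (upTo (suc t))

-- Since ord(l) is φ(pˢ)/2 modulo pˢ and φ(qᵗ) modulo qᵗ, and these numbers are coprime, Cᵢₘ consists of the α
-- with qᵐ exactly dividing α and α / (pⁱqᵐ) a square unit at p; C*ᵢₘ is the same with nonsquares, as g is a
-- nonsquare. Fix j, let A be the condition that α lies in the class of pⁱqʲ at p and B that it lies in the
-- class of pⁱ′qʲg, and let T k, T′ k be the sums of xᵅ over the multiples of qᵏ in A and in B. As i < i′,
-- adding an element of B preserves A, so T k T′ m = Nₘ T k for k ≤ m, where Nₘ is the number of terms of T′ m.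
-- Splitting level j into q translates of level j+1 gives T (j+1) T′ j = T j T′ (j+1) and Nⱼ = q Nⱼ₊₁. Hence
-- (T j - T (j+1)) (T′ j - T′ (j+1)) = Nⱼ₊₁ ((q - 2) (T j - T (j+1)) + (q - 1) T (j+1)), which is the claim:
-- T (j+1) is the sum over m > j of χᵢₘ or χ*ᵢₘ, whichever matches the quadratic character of qᵐ⁻ʲ.
-- Finally α ↦ - α exchanges squares and nonsquares, so Nₜ = φ(pˢ⁻ⁱ′)/2.
module Submission where

open import Algebra.Bundles using (CommutativeRing; CommutativeSemiring)
import Algebra.Definitions.RawMagma as RawMagmaDefinitions
import Algebra.Properties.CommutativeSemigroup as CommutativeSemigroupProperties
import Algebra.Properties.Group as GroupProperties
import Algebra.Properties.Semiring.Exp as SemiringExp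
import Algebra.Properties.Semiring.Mult as SemiringMult
import Algebra.Properties.Semiring.Sum as SemiringSum
import Algebra.Solver.Ring.NaturalCoefficients.Default as NaturalCoefficients
open import Data.Empty using (⊥-elim)
open import Data.Fin.Base as Fin using (Fin; zero; suc; toℕ; fromℕ<)
import Data.Fin.Properties as Fin
open import Data.Integer.Base as ℤ using (ℤ; +_)
open import Data.Integer.Coprimality as ℤ using (Coprime)
open import Data.Integer.Divisibility.Signed as ℤ using (divides) renaming (_∣_ to _∣ᶻ_)
import Data.Integer.DivMod as ℤ
import Data.Integer.Properties as ℤ
import Data.Integer.Solver as ℤSolver
open import Data.List.Base using (List; []; _∷_; _++_; _∷ʳ_; allFin; applyUpTo; filter; foldr; length; lookup; map; tabulate; upTo)
open import Data.List.Membership.Propositional using (_∈_)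
open import Data.List.Membership.Propositional.Properties using (∈-map⁺; ∈-filter⁺; ∈-upTo⁺)
import Data.List.Properties as List
open import Data.List.Relation.Unary.All as All using (All; []; _∷_)
import Data.List.Relation.Unary.All.Properties as All
open import Data.List.Relation.Unary.Any using (index)
open import Data.List.Relation.Unary.Any.Properties using (lookup-index)
open import Data.Nat.Base as ℕ using (ℕ; zero; suc; NonZero; _^_; s≤s)
open import Data.Nat.Coprimality as ℕ using (coprime?)
open import Data.Nat.DivMod as ℕ using (_/_; _%_)
open import Data.Nat.Divisibility as ℕ using (_∣_; _∣?_)
open import Data.Nat.GCD as ℕ using (module Bézout)
open import Data.Nat.Primality as Prime using (Prime; prime[2]; prime⇒irreducible; prime⇒nonZero; prime⇒nonTrivial; euclidsLemma)
import Data.Nat.Properties as ℕ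
import Data.Nat.Solver as ℕSolver
open import Data.Product.Base using (∃; ∃₂; _×_; _,_; proj₁; proj₂)
open import Data.Sum.Base using (_⊎_; inj₁; inj₂; [_,_]′)
open import Function.Base using (_∘_; id)
open import Function.Bundles using (_⇔_; mk⇔; Equivalence)
import Function.Properties.Equivalence as ⇔
open import Level using (Level; 0ℓ)
open import Relation.Binary.Bundles using (Setoid)
open import Relation.Binary.PropositionalEquality as ≡ using (_≡_; _≢_; cong; cong₂; subst; subst₂; module ≡-Reasoning)
import Relation.Binary.Reasoning.Setoid as SetoidReasoning
open import Relation.Nullary using (Dec; yes; no; ¬_; contradiction)
open import Relation.Nullary.Decidable using (_×-dec_; _→-dec_; ¬?; map′)
open import Relation.Unary using (Pred; Decidable)
open import Defs
open Equivalence using (to; from)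

-- The hypothesis p ≡ 3 (mod 4) makes d = φ(pˢ)/2 odd. This turns the gcd 2 of the totients into
-- coprimality of the orders d and φ(qᵗ), and it keeps - 1 out of ⟨l⟩ modulo p. Squares at p are
-- therefore handled as powers of l and nonsquares as negatives of such powers: the quadratic
-- character of a unit is a sign. The obstacle is that exact layers do not absorb each other: the
-- sum of two exponents with exact q-level j may have any level from j on. The nested sums T do
-- absorb, with one exception, T (j+1) T′ j, where the second factor has the coarser level.
-- Translations by multiples of pˢqʲ settle it: they leave both A and B unchanged and permute the
-- residues of qʲ-multiples modulo qʲ⁺¹, so a monomial can be handed from one factor to the other.
-- The counts Nₘ are found in ℕ and only then sent to the ring: Nₜ comes from halving, which is
-- meaningless over a field of characteristic 2, and l = 2 is allowed. The same sums over ℕ with xᵅ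
-- replaced by 1 give these counts.

-- Sums over initial segments of ℕ, with indicators of decidable conditions.

module RangeSums {c ℓ : Level} (R : CommutativeSemiring c ℓ) where

  private variable
    a b : Level
    P : Set a
    Q : Set b

  open CommutativeSemiring R
  open SemiringSum semiring public
    using (sum; sum-cong-≋; ∑-distrib-+; ∑-comm; *-distribˡ-sum; *-distribʳ-sum; sum-init-last;
        sum-replicate-zero)
  open SetoidReasoning setoid

  [_] : Dec P → Carrier
  [ yes _ ] = 1#
  [ no _ ]  = 0#

  []-yes : (P? : Dec P) → P → [ P? ] ≈ 1#
  []-yes (yes _) p = refl
  []-yes (no ¬p) p = ⊥-elim (¬p p)

  []-no : (P? : Dec P) → ¬ P → [ P? ] ≈ 0#
  []-no (yes p) ¬p = ⊥-elim (¬p p)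
  []-no (no _)  ¬p = refl

  []-cong : (P? : Dec P) (Q? : Dec Q) → P ⇔ Q → [ P? ] ≈ [ Q? ]
  []-cong (yes p) Q? P⇔Q = sym ([]-yes Q? (to P⇔Q p))
  []-cong (no ¬p) Q? P⇔Q = sym ([]-no Q? (¬p ∘ from P⇔Q))

  []-× : (P? : Dec P) (Q? : Dec Q) → [ P? ×-dec Q? ] ≈ [ P? ] * [ Q? ]
  []-× (yes _) (yes _) = sym (*-identityˡ 1#)
  []-× (yes _) (no _)  = sym (*-identityˡ 0#)
  []-× (no _)  _       = sym (zeroˡ _)

  -- A summand may be rewritten with the help of the very condition that its indicator tests.
  []-guard : (P? : Dec P) {x y : Carrier} → (P → x ≈ y) → [ P? ] * x ≈ [ P? ] * y
  []-guard (yes p) f = *-congˡ (f p)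
  []-guard (no _)  f = trans (zeroˡ _) (sym (zeroˡ _))

  ∑< : ℕ → (ℕ → Carrier) → Carrier
  ∑< n F = sum {n} (F ∘ toℕ)

  ∑<-cong : ∀ n {F G : ℕ → Carrier} → (∀ k → F k ≈ G k) → ∑< n F ≈ ∑< n G
  ∑<-cong n F≈G = sum-cong-≋ {n} (λ i → F≈G (toℕ i))

  ∑<-cong< : ∀ n {F G : ℕ → Carrier} → (∀ k → k ℕ.< n → F k ≈ G k) → ∑< n F ≈ ∑< n G
  ∑<-cong< n F≈G = sum-cong-≋ {n} (λ i → F≈G (toℕ i) (Fin.toℕ<n i))

  ∑<-zero : ∀ n {F : ℕ → Carrier} → (∀ k → k ℕ.< n → F k ≈ 0#) → ∑< n F ≈ 0#
  ∑<-zero n F≈0 = trans (sum-cong-≋ {n} (λ i → F≈0 (toℕ i) (Fin.toℕ<n i))) (sum-replicate-zero n)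

  ∑<-last : ∀ n (F : ℕ → Carrier) → ∑< (suc n) F ≈ ∑< n F + F n
  ∑<-last n F = trans (sum-init-last (F ∘ toℕ)) (+-cong
    (sum-cong-≋ {n} (λ i → reflexive (cong F (Fin.toℕ-inject₁ i))))
    (reflexive (cong F (Fin.toℕ-fromℕ n))))

  ∑<-+ : ∀ m n (F : ℕ → Carrier) → ∑< (m ℕ.+ n) F ≈ ∑< m F + ∑< n (F ∘ (m ℕ.+_))
  ∑<-+ zero    n F = sym (+-identityˡ _)
  ∑<-+ (suc m) n F = trans (+-congˡ (∑<-+ m n (F ∘ suc))) (sym (+-assoc _ _ _))

  -- Moving the window of summation by one step drops F δ and gains F (n + δ), which periodicity
  -- makes equal.
  ∑<-shift : ∀ n (F : ℕ → Carrier) → (∀ k → F (k ℕ.+ n) ≈ F k) →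
             ∀ δ → ∑< n (λ k → F (k ℕ.+ δ)) ≈ ∑< n F
  ∑<-shift n F per zero    = ∑<-cong n (λ k → reflexive (cong F (ℕ.+-identityʳ k)))
  ∑<-shift zero F per (suc δ) = refl
  ∑<-shift n@(suc m) F per (suc δ) = begin
    ∑< n (λ k → F (k ℕ.+ suc δ))                 ≈⟨ ∑<-cong n (λ k → reflexive (cong F (ℕ.+-suc k δ))) ⟩
    ∑< n (λ k → F (suc k ℕ.+ δ))                 ≈⟨ ∑<-last m (λ k → F (suc k ℕ.+ δ)) ⟩
    ∑< m (λ k → F (suc k ℕ.+ δ)) + F (n ℕ.+ δ)
      ≈⟨ +-congˡ (trans (reflexive (cong F (ℕ.+-comm n δ))) (per δ)) ⟩
    ∑< m (λ k → F (suc k ℕ.+ δ)) + F δ           ≈⟨ +-comm _ _ ⟩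
    ∑< n (λ k → F (k ℕ.+ δ))                     ≈⟨ ∑<-shift n F per δ ⟩
    ∑< n F                                       ∎

  ∑<-reverse : ∀ n (F : ℕ → Carrier) → ∑< n (λ k → F (n ℕ.∸ suc k)) ≈ ∑< n F
  ∑<-reverse zero    F = refl
  ∑<-reverse (suc n) F = begin
    F n + ∑< n (λ k → F (n ℕ.∸ suc k))  ≈⟨ +-congˡ (∑<-reverse n F) ⟩
    F n + ∑< n F                        ≈⟨ +-comm _ _ ⟩
    ∑< n F + F n                        ≈⟨ ∑<-last n F ⟨
    ∑< (suc n) F                        ∎

  -- n - k runs through n, ..., 1 instead of n - 1, ..., 0. Periodicity replaces F n by F 0, and the
  -- rest is a reversal.
  ∑<-negate : ∀ n (F : ℕ → Carrier) → (∀ k → F (k ℕ.+ n) ≈ F k) →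
              ∑< n (λ k → F (n ℕ.∸ k)) ≈ ∑< n F
  ∑<-negate zero    F per = refl
  ∑<-negate n@(suc m) F per = begin
    F n + ∑< m (λ k → F (m ℕ.∸ k))   ≈⟨ +-comm _ _ ⟩
    ∑< m (λ k → F (m ℕ.∸ k)) + F n
      ≈⟨ +-cong (sum-cong-≋ {m} (λ i → reflexive (cong F (≡.sym (suc-pred-∸ (Fin.toℕ<n i)))))) (per 0) ⟩
    ∑< m (λ k → F (suc (m ℕ.∸ suc k))) + F 0 ≈⟨ +-congʳ (∑<-reverse m (F ∘ suc)) ⟩
    ∑< m (F ∘ suc) + F 0             ≈⟨ +-comm _ _ ⟩
    ∑< n F                           ∎
    where
    suc-pred-∸ : ∀ {k m} → k ℕ.< m → suc (m ℕ.∸ suc k) ≡ m ℕ.∸ k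
    suc-pred-∸ {k} {m} k<m = ≡.sym (ℕ.+-∸-assoc 1 k<m)

  -- In each block of d consecutive terms only the first one survives.
  ∑<-multiples : ∀ d .{{_ : NonZero d}} M (F : ℕ → Carrier) →
                 ∑< (M ℕ.* d) (λ k → [ d ∣? k ] * F k) ≈ ∑< M (λ u → F (u ℕ.* d))
  ∑<-multiples d@(suc _) zero    F = refl
  ∑<-multiples d@(suc e) (suc M) F = begin
    ∑< (d ℕ.+ M ℕ.* d) G
      ≈⟨ ∑<-+ d (M ℕ.* d) G ⟩
    (G 0 + ∑< e (G ∘ suc)) + ∑< (M ℕ.* d) (G ∘ (d ℕ.+_))
      ≈⟨ +-cong (trans (+-cong (trans (*-congʳ ([]-yes (d ∣? 0) (d ℕ.∣0))) (*-identityˡ _)) (∑<-zero e small))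
          (+-identityʳ _))
                (∑<-cong (M ℕ.* d) (λ k → *-congʳ {F (d ℕ.+ k)}
                    ([]-cong (d ∣? (d ℕ.+ k)) (d ∣? k)
                    (mk⇔ (λ d∣d+k → ℕ.∣m+n∣m⇒∣n d∣d+k ℕ.∣-refl) (ℕ.∣m∣n⇒∣m+n ℕ.∣-refl))))) ⟩
    F 0 + ∑< (M ℕ.* d) (λ k → [ d ∣? k ] * F (d ℕ.+ k))
      ≈⟨ +-congˡ (∑<-multiples d M (F ∘ (d ℕ.+_))) ⟩
    ∑< (suc M) (λ u → F (u ℕ.* d)) ∎
    where
    G = λ k → [ d ∣? k ] * F k
    small : ∀ k → k ℕ.< e → G (suc k) ≈ 0#
    small k k<e = trans (*-congʳ ([]-no (d ∣? suc k) (λ d∣ → ℕ.<⇒≱ (ℕ.s≤s k<e) (ℕ.∣⇒≤ d∣)))) (zeroˡ _)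

-- Exact divisibility, periodic predicates and residues modulo q.

≡⇒⇔ : ∀ {a} {A B : Set a} → A ≡ B → A ⇔ B
≡⇒⇔ ≡.refl = mk⇔ id id

^-monoʳ-∣ : ∀ b {m n} → m ℕ.≤ n → b ^ m ∣ b ^ n
^-monoʳ-∣ b {m} {n} m≤n = ℕ.divides (b ^ (n ℕ.∸ m))
  (≡.trans (cong (b ^_) (≡.sym (ℕ.m∸n+n≡m m≤n))) (ℕ.^-distribˡ-+-* b (n ℕ.∸ m) m))

×-⇔ : ∀ {a b c d} {A : Set a} {B : Set b} {C : Set c} {D : Set d} → A ⇔ B → C ⇔ D → (A × C) ⇔ (B × D)
×-⇔ f g = mk⇔ (λ (a , c) → to f a , to g c) (λ (b , d) → from f b , from g d)

-- At m = t the second condition is void: modulo pˢqᵗ, the power qᵗ is the last one that a residue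
-- class can detect.
Exactly : ℕ → ℕ → ℕ → Pred ℕ _
Exactly q t m α = q ^ m ∣ α × (m ℕ.< t → ¬ q ^ suc m ∣ α)

exactDivision? : ∀ q t m → Decidable (Exactly q t m)
exactDivision? q t m α = q ^ m ∣? α ×-dec (m ℕ.<? t →-dec ¬? (q ^ suc m ∣? α))

Periodic : ∀ {ℓ} → ℕ → Pred ℕ ℓ → Set ℓ
Periodic m P = ∀ k → P (k ℕ.+ m) ⇔ P k

periodic-* : ∀ {ℓ m} {P : Pred ℕ ℓ} → Periodic m P → ∀ c → Periodic (c ℕ.* m) P
periodic-* {P = P} per zero k = ≡⇒⇔ (cong P (ℕ.+-identityʳ k))
periodic-* {m = m} {P} per (suc c) k =
  ⇔.trans (≡⇒⇔ (cong P (≡.sym (ℕ.+-assoc k m (c ℕ.* m)))))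
    (⇔.trans (periodic-* per c (k ℕ.+ m)) (per k))

periodic-∣ : ∀ {ℓ m n} {P : Pred ℕ ℓ} → Periodic m P → m ∣ n → Periodic n P
periodic-∣ per (ℕ.divides c ≡.refl) = periodic-* per c

∣-+-⇔ : ∀ {d m} → d ∣ m → ∀ k → (d ∣ k ℕ.+ m) ⇔ (d ∣ k)
∣-+-⇔ {d} {m} d∣m k = mk⇔ (λ d∣k+m → ℕ.∣m+n∣m⇒∣n (subst (d ∣_) (ℕ.+-comm k m) d∣k+m) d∣m)
    (λ d∣k → ℕ.∣m∣n⇒∣m+n d∣k d∣m)

-- Here y is an inverse of - P modulo q. The second Bézout case yields an inverse of P itself, and
-- the factor r = q - 1 supplies the sign without leaving ℕ.
coprime⇒minus-one : ∀ {q P} .{{_ : NonZero q}} → ℕ.Coprime q P → ∃ λ y → q ∣ 1 ℕ.+ y ℕ.* P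
coprime⇒minus-one {q@(suc r)} {P} c with ℕ.coprime-Bézout c
... | Bézout.+- x y eq = y , ℕ.divides x eq
... | Bézout.-+ x y eq = r ℕ.* y , ℕ.divides (1 ℕ.+ r ℕ.* x) (begin
  1 ℕ.+ r ℕ.* y ℕ.* P            ≡⟨ cong suc (≡.trans (ℕ.*-assoc r y P) (cong (r ℕ.*_) (≡.sym eq))) ⟩
  1 ℕ.+ r ℕ.* (1 ℕ.+ x ℕ.* q)
    ≡⟨ solve 2 (λ r x → con 1 :+ r :* (con 1 :+ x :* (con 1 :+ r)) := (con 1 :+ r :* x)
       :* (con 1 :+ r)) ≡.refl r x ⟩
  (1 ℕ.+ r ℕ.* x) ℕ.* q          ∎)
  where
  open ≡-Reasoning
  open ℕSolver.+-*-Solver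

module Residues {c ℓ : Level} (R : CommutativeSemiring c ℓ) where

  open CommutativeSemiring R
  open RangeSums R
  open SetoidReasoning setoid

  -- If y P ≡ - 1 modulo q, shifting c by a y turns the condition into q ∣ c P, hence q ∣ c, which
  -- has the single solution 0 below q.
  unique-residue : ∀ {q P} .{{_ : NonZero q}} → ℕ.Coprime q P → ∀ a →
                   ∑< q (λ c → [ q ∣? (a ℕ.+ c ℕ.* P) ]) ≈ 1#
  unique-residue {q@(suc r)} {P} cop a with coprime⇒minus-one cop
  ... | y , q∣1+yP = begin
    ∑< q (λ c → [ q ∣? (a ℕ.+ c ℕ.* P) ])
      ≈⟨ ∑<-shift q (λ c → [ q ∣? (a ℕ.+ c ℕ.* P) ])
           (λ c → []-cong (q ∣? (a ℕ.+ (c ℕ.+ q) ℕ.* P)) (q ∣? (a ℕ.+ c ℕ.* P))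
             (⇔.trans (≡⇒⇔ (cong (q ∣_) (solve 4
                 (λ a c q p → a :+ (c :+ q) :* p := (a :+ c :* p) :+ q :* p) ≡.refl a c q P)))
               (∣-+-⇔ (ℕ.m∣m*n P) (a ℕ.+ c ℕ.* P)))) (a ℕ.* y) ⟨
    ∑< q (λ c → [ q ∣? (a ℕ.+ (c ℕ.+ a ℕ.* y) ℕ.* P) ])
      ≈⟨ ∑<-cong q (λ c → []-cong (q ∣? (a ℕ.+ (c ℕ.+ a ℕ.* y) ℕ.* P)) (q ∣? c) (divides-at c)) ⟩
    ∑< q (λ c → [ q ∣? c ])
      ≈⟨ +-cong ([]-yes (q ∣? 0) (q ℕ.∣0)) (∑<-zero r
          (λ c c<r → []-no (q ∣? suc c) (λ d → ℕ.<⇒≱ (ℕ.s≤s c<r) (ℕ.∣⇒≤ d)))) ⟩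
    1# + 0#
      ≈⟨ +-identityʳ 1# ⟩
    1# ∎
    where
    open ℕSolver.+-*-Solver
    divides-at : ∀ c → (q ∣ a ℕ.+ (c ℕ.+ a ℕ.* y) ℕ.* P) ⇔ (q ∣ c)
    divides-at c =
      ⇔.trans (≡⇒⇔ (cong (q ∣_) (solve 4 (λ a c y p →
          a :+ (c :+ a :* y) :* p := c :* p :+ a :* (con 1 :+ y :* p)) ≡.refl a c y P)))
        (⇔.trans (∣-+-⇔ (ℕ.∣n⇒∣m*n a q∣1+yP) (c ℕ.* P))
          (mk⇔ (λ q∣cP → ℕ.coprime-divisor cop (subst (q ∣_) (ℕ.*-comm c P) q∣cP)) (ℕ.∣m⇒∣m*n P)))

-- Sums of monomials over sets of exponents, layered by powers of q.

module CharacterSums {c ℓ : Level} (R : CommutativeSemiring c ℓ)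
  (n : ℕ) (e : ℕ → CommutativeSemiring.Carrier R)
  (e-+ : ∀ α β → CommutativeSemiring._≈_ R (e (α ℕ.+ β)) (CommutativeSemiring._*_ R (e α) (e β)))
  (e-n : CommutativeSemiring._≈_ R (e n) (CommutativeSemiring.1# R))
  where

  open CommutativeSemiring R
  open RangeSums R
  open Residues R
  open SetoidReasoning setoid
  open CommutativeSemigroupProperties *-commutativeSemigroup using (x∙yz≈y∙xz; xy∙z≈xz∙y)

  private variable
    a b : Level
    P A : Pred ℕ a
    Q B : Pred ℕ b

  -- e α stands for xᵅ; over ℕ with e = 1 the sum S is a cardinality.
  S : Decidable P → Carrier
  S P? = ∑< n (λ α → [ P? α ] * e α)

  # : Decidable P → Carrier
  # P? = ∑< n (λ α → [ P? α ])

  e-periodic : ∀ α → e (α ℕ.+ n) ≈ e α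
  e-periodic α = trans (e-+ α n) (trans (*-congˡ e-n) (*-identityʳ (e α)))

  S-shift : ∀ (P? : Decidable P) (Q? : Decidable Q) δ → Periodic n Q → (∀ α → P α ⇔ Q (α ℕ.+ δ)) →
      S P? * e δ ≈ S Q?
  S-shift P? Q? δ per P⇔Q = begin
    S P? * e δ                                          ≈⟨ *-distribʳ-sum {n} (e δ) _ ⟩
    ∑< n (λ α → ([ P? α ] * e α) * e δ)
      ≈⟨ ∑<-cong n (λ α → trans (*-assoc _ _ _)
         (*-cong ([]-cong (P? α) (Q? (α ℕ.+ δ)) (P⇔Q α)) (sym (e-+ α δ)))) ⟩
    ∑< n (λ α → [ Q? (α ℕ.+ δ) ] * e (α ℕ.+ δ))
      ≈⟨ ∑<-shift n (λ α → [ Q? α ] * e α) (λ α → *-cong ([]-cong (Q? (α ℕ.+ n)) (Q? α) (per α))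
         (e-periodic α)) δ ⟩
    S Q?                                                ∎

  -- For β in Q, multiplication by e β translates P onto itself, so every term of S Q contributes
  -- one copy of S P.
  S-absorb : (P? : Decidable P) (Q? : Decidable Q) → Periodic n P → (∀ α β → Q β → P (α ℕ.+ β) ⇔ P α) →
             S P? * S Q? ≈ S P? * # Q?
  S-absorb P? Q? per inv = begin
    S P? * S Q?                             ≈⟨ *-distribˡ-sum {n} (S P?) _ ⟩
    ∑< n (λ β → S P? * ([ Q? β ] * e β))
      ≈⟨ ∑<-cong n (λ β → trans (x∙yz≈y∙xz _ _ _)
         (trans ([]-guard (Q? β) (λ Qβ → S-shift P? P? β per (λ α → ⇔.sym (inv α β Qβ)))) (*-comm _ _))) ⟩
    ∑< n (λ β → S P? * [ Q? β ])            ≈⟨ *-distribˡ-sum {n} (S P?) _ ⟨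
    S P? * # Q?                             ∎

  module Layers (M q t : ℕ) .{{_ : NonZero q}} (n≡Mqᵗ : n ≡ M ℕ.* q ^ t) (cop : ℕ.Coprime q M) where

    level? : Decidable A → ∀ k → Decidable (λ α → A α × q ^ k ∣ α)
    level? A? k α = A? α ×-dec q ^ k ∣? α

    T : Decidable A → ℕ → Carrier
    T A? k = S (level? A? k)

    M∣n : M ∣ n
    M∣n = subst (M ∣_) (≡.sym n≡Mqᵗ) (ℕ.m∣m*n (q ^ t))

    q^∣n : ∀ {k} → k ℕ.≤ t → q ^ k ∣ n
    q^∣n {k} k≤t = subst (q ^ k ∣_) (≡.sym n≡Mqᵗ) (ℕ.∣n⇒∣m*n M (^-monoʳ-∣ q k≤t))

    level-periodic : ∀ {k} → k ℕ.≤ t → Periodic M A → Periodic n (λ α → A α × q ^ k ∣ α)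
    level-periodic k≤t per α = ×-⇔ (periodic-∣ per M∣n α) (∣-+-⇔ (q^∣n k≤t) α)

    T-absorb : (A? : Decidable A) (B? : Decidable B) → Periodic M A → (∀ α β → B β → A (α ℕ.+ β) ⇔ A α) →
               ∀ {j k} → j ℕ.≤ k → k ℕ.≤ t → T A? j * T B? k ≈ T A? j * # (level? B? k)
    T-absorb A? B? per inv {j} {k} j≤k k≤t = S-absorb (level? A? j) (level? B? k)
        (level-periodic (ℕ.≤-trans j≤k k≤t) per)
      (λ α β (Bβ , qᵏ∣β) → ×-⇔ (inv α β Bβ) (∣-+-⇔ (ℕ.∣-trans (^-monoʳ-∣ q j≤k) qᵏ∣β) α))

    -- The translate by - c M qʲ of the multiples of qʲ⁺¹. The translation is by a multiple of M, so
    -- a condition A of period M does not notice it.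
    slice? : Decidable A → ∀ j c → Decidable (λ α → A α × q ^ suc j ∣ α ℕ.+ c ℕ.* (M ℕ.* q ^ j))
    slice? A? j c α = A? α ×-dec q ^ suc j ∣? (α ℕ.+ c ℕ.* (M ℕ.* q ^ j))

    slice-shift : (A? : Decidable A) → Periodic M A → ∀ {j} → suc j ℕ.≤ t → ∀ c →
                  S (slice? A? j c) * e (c ℕ.* (M ℕ.* q ^ j)) ≈ T A? (suc j)
    slice-shift A? per {j} j<t c = S-shift (slice? A? j c) (level? A? (suc j)) _ (level-periodic j<t per)
      (λ α → ×-⇔ (⇔.sym (periodic-∣ per (ℕ.∣n⇒∣m*n c (ℕ.m∣m*n (q ^ j))) α)) ⇔.refl)

    -- For α = a qʲ the condition on c reads q ∣ a + c M, which has one solution since q and M are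
    -- coprime. An α outside the multiples of qʲ lies in no slice, as the translations are multiples
    -- of qʲ.
    ∣-slices : ∀ j α → [ q ^ j ∣? α ] ≈ ∑< q (λ c → [ q ^ suc j ∣? (α ℕ.+ c ℕ.* (M ℕ.* q ^ j)) ])
    ∣-slices j α with q ^ j ∣? α
    ... | no qʲ∤α = sym (∑<-zero q (λ c _ → []-no (q ^ suc j ∣? (α ℕ.+ c ℕ.* (M ℕ.* q ^ j))) λ d →
          qʲ∤α (to (∣-+-⇔ (ℕ.∣n⇒∣m*n c (ℕ.n∣m*n M)) α) (ℕ.∣-trans (ℕ.n∣m*n q) d))))
    ... | yes (ℕ.divides a ≡.refl) = sym (trans
          (∑<-cong q (λ c → []-cong (q ^ suc j ∣? (a ℕ.* q ^ j ℕ.+ c ℕ.* (M ℕ.* q ^ j)))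
              (q ∣? (a ℕ.+ c ℕ.* M))
            (⇔.trans (≡⇒⇔ (cong (q ^ suc j ∣_)
                (solve 4 (λ a c M x → a :* x :+ c :* (M :* x) := (a :+ c :* M) :* x) ≡.refl a c M (q ^ j))))
              (mk⇔ (ℕ.*-cancelʳ-∣ (q ^ j) {{ℕ.m^n≢0 q j}}) (ℕ.*-monoˡ-∣ (q ^ j))))))
          (unique-residue cop a))
      where open ℕSolver.+-*-Solver

    level-slices : (A? : Decidable A) → ∀ j α → [ level? A? j α ] ≈ ∑< q (λ c → [ slice? A? j c α ])
    level-slices A? j α = begin
      [ level? A? j α ]
        ≈⟨ []-× (A? α) (q ^ j ∣? α) ⟩
      [ A? α ] * [ q ^ j ∣? α ]
        ≈⟨ *-congˡ (∣-slices j α) ⟩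
      [ A? α ] * ∑< q (λ c → [ q ^ suc j ∣? (α ℕ.+ c ℕ.* (M ℕ.* q ^ j)) ])
        ≈⟨ *-distribˡ-sum {q} [ A? α ] _ ⟩
      ∑< q (λ c → [ A? α ] * [ q ^ suc j ∣? (α ℕ.+ c ℕ.* (M ℕ.* q ^ j)) ])
        ≈⟨ ∑<-cong q (λ c → []-× (A? α) (q ^ suc j ∣? (α ℕ.+ c ℕ.* (M ℕ.* q ^ j)))) ⟨
      ∑< q (λ c → [ slice? A? j c α ])                                                 ∎

    T-slices : (A? : Decidable A) → ∀ j → T A? j ≈ ∑< q (λ c → S (slice? A? j c))
    T-slices A? j = begin
      ∑< n (λ α → [ level? A? j α ] * e α)
        ≈⟨ ∑<-cong n (λ α → trans (*-congʳ (level-slices A? j α)) (*-distribʳ-sum {q} (e α) _)) ⟩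
      ∑< n (λ α → ∑< q (λ c → [ slice? A? j c α ] * e α))          ≈⟨ ∑-comm {n} {q} _ ⟩
      ∑< q (λ c → S (slice? A? j c))                               ∎

    -- A and B split along the same translations by multiples of M qʲ.
    T-exchange : (A? : Decidable A) (B? : Decidable B) → Periodic M A → Periodic M B → ∀ {j} → suc j ℕ.≤ t →
                 T A? (suc j) * T B? j ≈ T A? j * T B? (suc j)
    T-exchange A? B? perA perB {j} j<t = begin
      T A? (suc j) * T B? j                                    ≈⟨ *-congˡ (T-slices B? j) ⟩
      T A? (suc j) * ∑< q (λ c → S (slice? B? j c))            ≈⟨ *-distribˡ-sum {q} _ _ ⟩
      ∑< q (λ c → T A? (suc j) * S (slice? B? j c))            ≈⟨ ∑<-cong q (λ c → begin
        T A? (suc j) * S (slice? B? j c)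
          ≈⟨ *-congʳ (slice-shift A? perA j<t c) ⟨
        S (slice? A? j c) * e (c ℕ.* (M ℕ.* q ^ j)) * S (slice? B? j c)
          ≈⟨ trans (xy∙z≈xz∙y _ _ _) (*-assoc _ _ _) ⟩
        S (slice? A? j c) * (S (slice? B? j c) * e (c ℕ.* (M ℕ.* q ^ j)))
          ≈⟨ *-congˡ (slice-shift B? perB j<t c) ⟩
        S (slice? A? j c) * T B? (suc j)                                                  ∎) ⟩
      ∑< q (λ c → S (slice? A? j c) * T B? (suc j))            ≈⟨ *-distribʳ-sum {q} _ _ ⟨
      ∑< q (λ c → S (slice? A? j c)) * T B? (suc j)            ≈⟨ *-congʳ (T-slices A? j) ⟨
      T A? j * T B? (suc j)                                    ∎

-- Sums over lists, and over the levels j < m ≤ t.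

module ListSums {c ℓ : Level} (R : CommutativeSemiring c ℓ) where

  open CommutativeSemiring R
  open RangeSums R
  open SetoidReasoning setoid
  open CommutativeSemigroupProperties +-commutativeSemigroup using (x∙yz≈y∙xz)

  private variable
    X : Set

  ∑ᴸ : List X → (X → Carrier) → Carrier
  ∑ᴸ xs f = foldr (λ a y → f a + y) 0# xs

  ∑ᴸ-filter : ∀ {p} {P : Pred X p} (P? : Decidable P) xs (f : X → Carrier) →
              ∑ᴸ (filter P? xs) f ≈ ∑ᴸ xs (λ x → [ P? x ] * f x)
  ∑ᴸ-filter P? []       f = refl
  ∑ᴸ-filter P? (x ∷ xs) f with P? x
  ... | yes _ = +-cong (sym (*-identityˡ (f x))) (∑ᴸ-filter P? xs f)
  ... | no _  = trans (∑ᴸ-filter P? xs f) (sym (trans (+-congʳ (zeroˡ _)) (+-identityˡ _)))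

  ∑ᴸ-cong-All : ∀ {xs : List X} {f g : X → Carrier} → All (λ x → f x ≈ g x) xs → ∑ᴸ xs f ≈ ∑ᴸ xs g
  ∑ᴸ-cong-All []             = refl
  ∑ᴸ-cong-All (f≈g ∷ f≈g-xs) = +-cong f≈g (∑ᴸ-cong-All f≈g-xs)

  ∑ᴸ-split : ∀ {p} {P : Pred X p} (P? : Decidable P) xs (f : X → Carrier) →
             ∑ᴸ (filter (¬? ∘ P?) xs) f + ∑ᴸ (filter P? xs) f ≈ ∑ᴸ xs f
  ∑ᴸ-split P? []       f = +-identityˡ 0#
  ∑ᴸ-split P? (x ∷ xs) f with P? x
  ... | yes _ = trans (x∙yz≈y∙xz _ _ _) (+-congˡ (∑ᴸ-split P? xs f))
  ... | no _  = trans (+-assoc _ _ _) (+-congˡ (∑ᴸ-split P? xs f))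

  ∑ᴸ-tabulate : ∀ {n} (g : Fin n → X) (f : X → Carrier) → ∑ᴸ (tabulate g) f ≈ sum (f ∘ g)
  ∑ᴸ-tabulate {n = zero}  g f = refl
  ∑ᴸ-tabulate {n = suc n} g f = +-congˡ (∑ᴸ-tabulate (g ∘ suc) f)

  ∑ᴸ-∷ʳ : ∀ (xs : List X) x (f : X → Carrier) → ∑ᴸ (xs ∷ʳ x) f ≈ ∑ᴸ xs f + f x
  ∑ᴸ-∷ʳ []       x f = +-comm (f x) 0#
  ∑ᴸ-∷ʳ (y ∷ xs) x f = trans (+-congˡ (∑ᴸ-∷ʳ xs x f)) (sym (+-assoc _ _ _))

  ⦅⦆-bounds : ∀ j t → All (λ m → j ℕ.< m × m ℕ.≤ t) ⦅ j , t ⦆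
  ⦅⦆-bounds j t = All.zip (All.all-filter (j ℕ.<?_) (upTo (suc t)) ,
    All.filter⁺ (j ℕ.<?_) (All.applyUpTo⁺₁ id (suc t) ℕ.s≤s⁻¹))

  ⦅⦆-empty : ∀ j → ⦅ j , j ⦆ ≡ []
  ⦅⦆-empty j = List.filter-none (j ℕ.<?_) (All.applyUpTo⁺₁ id (suc j) (λ k<1+j j<k → ℕ.<⇒≱ k<1+j j<k))

  ⦅⦆-∷ʳ : ∀ {j t} → j ℕ.≤ t → ⦅ j , suc t ⦆ ≡ ⦅ j , t ⦆ ∷ʳ suc t
  ⦅⦆-∷ʳ {j} {t} j≤t =
    ≡.trans (cong (filter (j ℕ.<?_)) (≡.sym (List.upTo-∷ʳ (suc t))))
      (≡.trans (List.filter-++ (j ℕ.<?_) (upTo (suc t)) (suc t ∷ []))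
        (cong (⦅ j , t ⦆ ++_) (List.filter-accept (j ℕ.<?_) (ℕ.s≤s j≤t))))

  -- U m plays the tail sum from level m on; the recursion removes the top level t.
  ∑ᴸ-telescope : ∀ {j t} → j ℕ.≤ t → (F U : ℕ → Carrier) →
                 (∀ m → j ℕ.< m → m ℕ.≤ t → F m + U (suc m) ≈ U m) →
                 ∑ᴸ ⦅ j , t ⦆ F + U (suc t) ≈ U (suc j)
  ∑ᴸ-telescope {j} {t} j≤t F U step with ℕ.m≤n⇒m<n∨m≡n j≤t
  ... | inj₂ ≡.refl = trans (+-congʳ (reflexive (cong (λ xs → ∑ᴸ xs F) (⦅⦆-empty j)))) (+-identityˡ _)
  ∑ᴸ-telescope {j} {suc t} j≤t F U step | inj₁ (ℕ.s≤s j≤t′) = begin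
    ∑ᴸ ⦅ j , suc t ⦆ F + U (2 ℕ.+ t)
      ≈⟨ +-congʳ (trans (reflexive (cong (λ xs → ∑ᴸ xs F) (⦅⦆-∷ʳ j≤t′))) (∑ᴸ-∷ʳ ⦅ j , t ⦆ (suc t) F)) ⟩
    ∑ᴸ ⦅ j , t ⦆ F + F (suc t) + U (2 ℕ.+ t)
      ≈⟨ trans (+-assoc _ _ _) (+-congˡ (step (suc t) (ℕ.s≤s j≤t′) ℕ.≤-refl)) ⟩
    ∑ᴸ ⦅ j , t ⦆ F + U (suc t)
      ≈⟨ ∑ᴸ-telescope j≤t′ F U (λ m j<m m≤t → step m j<m (ℕ.m≤n⇒m≤1+n m≤t)) ⟩
    U (suc j)                                      ∎

-- Cardinalities of the layers.

module CountsIn {c ℓ : Level} (R : CommutativeSemiring c ℓ) where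

  open CommutativeSemiring R
  open SemiringMult semiring using (×-homo-+; ×-homo-1) renaming (_×_ to _·_)
  private
    module Sᴿ = RangeSums R
    module Sᴺ = RangeSums ℕ.+-*-commutativeSemiring

  -- Carries a cardinality computed in ℕ to the ring.
  ∑<-· : ∀ n {p} {P : Pred ℕ p} (P? : Decidable P) →
      Sᴿ.∑< n (λ α → Sᴿ.[ P? α ]) ≈ Sᴺ.∑< n (λ α → Sᴺ.[ P? α ]) · 1#
  ∑<-· zero    P? = refl
  ∑<-· (suc n) P? = trans (+-cong ([]-· (P? 0)) (∑<-· n (P? ∘ suc))) (sym (×-homo-+ 1# Sᴺ.[ P? 0 ] _))
    where
    []-· : ∀ {p} {P : Set p} (P? : Dec P) → Sᴿ.[ P? ] ≈ Sᴺ.[ P? ] · 1#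
    []-· (yes _) = sym (×-homo-1 1#)
    []-· (no _)  = refl

module LayerCounts (n M q t : ℕ) .{{_ : NonZero q}} (n≡Mqᵗ : n ≡ M ℕ.* q ^ t) (cop : ℕ.Coprime q M) where

  open RangeSums ℕ.+-*-commutativeSemiring
  open CharacterSums ℕ.+-*-commutativeSemiring n (λ _ → 1) (λ _ _ → ≡.refl) ≡.refl public
  open Layers M q t n≡Mqᵗ cop public
  open ≡-Reasoning

  S≡# : ∀ {p} {P : Pred ℕ p} (P? : Decidable P) → S P? ≡ # P?
  S≡# P? = ∑<-cong n (λ α → ℕ.*-identityʳ [ P? α ])

  ∑<-const : ∀ m k → ∑< m (λ _ → k) ≡ m ℕ.* k
  ∑<-const zero    k = ≡.refl
  ∑<-const (suc m) k = cong (k ℕ.+_) (∑<-const m k)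

  -- With e = 1, translation preserves cardinality, so each of the q slices of level j is as large
  -- as level j + 1.
  #-step : ∀ {a} {A : Pred ℕ a} (A? : Decidable A) → Periodic M A → ∀ {j} → suc j ℕ.≤ t →
           # (level? A? j) ≡ q ℕ.* # (level? A? (suc j))
  #-step A? per {j} j<t = begin
    # (level? A? j)                        ≡⟨ S≡# (level? A? j) ⟨
    T A? j                                 ≡⟨ T-slices A? j ⟩
    ∑< q (λ c → S (slice? A? j c))
      ≡⟨ ∑<-cong q (λ c → ≡.trans (≡.sym (ℕ.*-identityʳ (S (slice? A? j c)))) (slice-shift A? per j<t c)) ⟩
    ∑< q (λ _ → T A? (suc j))              ≡⟨ ∑<-const q (T A? (suc j)) ⟩
    q ℕ.* T A? (suc j)                     ≡⟨ cong (q ℕ.*_) (S≡# (level? A? (suc j))) ⟩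
    q ℕ.* # (level? A? (suc j))            ∎

  #-level : ∀ {a} {A : Pred ℕ a} (A? : Decidable A) → Periodic M A → ∀ k m → k ℕ.+ m ≡ t →
            # (level? A? m) ≡ q ^ k ℕ.* # (level? A? t)
  #-level A? per zero    m ≡.refl = ≡.sym (ℕ.+-identityʳ _)
  #-level A? per (suc k) m ≡.refl = begin
    # (level? A? m)                        ≡⟨ #-step A? per (ℕ.s≤s (ℕ.m≤n+m m k)) ⟩
    q ℕ.* # (level? A? (suc m))            ≡⟨ cong (q ℕ.*_) (#-level A? per k (suc m) (ℕ.+-suc k m)) ⟩
    q ℕ.* (q ^ k ℕ.* # (level? A? t))      ≡⟨ ℕ.*-assoc q (q ^ k) _ ⟨
    q ^ suc k ℕ.* # (level? A? t)          ∎

-- The product of two exact layers.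

module LayerProducts {c ℓ : Level} (R : CommutativeRing c ℓ)
  (n : ℕ) (e : ℕ → CommutativeRing.Carrier R)
  (e-+ : ∀ α β → CommutativeRing._≈_ R (e (α ℕ.+ β)) (CommutativeRing._*_ R (e α) (e β)))
  (e-n : CommutativeRing._≈_ R (e n) (CommutativeRing.1# R))
  (M q t : ℕ) .{{_ : NonZero q}} (n≡Mqᵗ : n ≡ M ℕ.* q ^ t) (cop : ℕ.Coprime q M)
  where

  open CommutativeRing R
  open RangeSums commutativeSemiring
  open ListSums commutativeSemiring
  open CharacterSums commutativeSemiring n e e-+ e-n public
  open Layers M q t n≡Mqᵗ cop public
  open SetoidReasoning setoid
  open SemiringMult semiring using (×-homo-+; ×1-homo-*; ×-assoc-*; ×-congˡ) renaming (_×_ to _·_)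
  open GroupProperties +-group using () renaming (∙-cancelʳ to +-cancelʳ)
  open NaturalCoefficients commutativeSemiring using (solve; _:=_; _:+_; _:*_; con)
  private module # = LayerCounts n M q t n≡Mqᵗ cop

  private variable
    a b : Level
    A : Pred ℕ a
    B : Pred ℕ b

  exactly? : Decidable A → ∀ m → Decidable (λ α → A α × Exactly q t m α)
  exactly? A? m α = A? α ×-dec exactDivision? q t m α

  cosetSum≈S : ∀ {p r} {C : Pred (Fin n) p} (C? : Decidable C) {P : Pred ℕ r} (P? : Decidable P) →
      (∀ i → C i ⇔ P (toℕ i)) →
               ∑ᴸ (filter C? (allFin n)) (λ i → e (toℕ i)) ≈ S P?
  cosetSum≈S C? P? C⇔P = trans (∑ᴸ-filter C? (allFin n) (λ i → e (toℕ i)))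
    (trans (∑ᴸ-tabulate {n = n} id (λ i → [ C? i ] * e (toℕ i)))
      (sum-cong-≋ {n} (λ i → *-congʳ {e (toℕ i)} ([]-cong (C? i) (P? (toℕ i)) (C⇔P i)))))

  T-layer : (A? : Decidable A) → ∀ {m} → m ℕ.< t → S (exactly? A? m) + T A? (suc m) ≈ T A? m
  T-layer A? {m} m<t = trans (sym (∑-distrib-+ {n} _ _)) (∑<-cong n λ α →
    trans (sym (distribʳ (e α) _ _)) (*-congʳ (split α)))
    where
    split : ∀ α → [ exactly? A? m α ] + [ level? A? (suc m) α ] ≈ [ level? A? m α ]
    split α with q ^ suc m ∣? α
    ... | yes d = trans (+-cong ([]-no (A? α ×-dec (q ^ m ∣? α ×-dec (m ℕ.<? t →-dec no (λ z → z d))))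
        (λ (_ , _ , f) → f m<t d))
                           ([]-cong (A? α ×-dec yes d) (level? A? m α)
                               (mk⇔ (λ (Aα , _) → Aα , ℕ.∣-trans (ℕ.n∣m*n q) d) (λ (Aα , _) → Aα , d))))
                         (+-identityˡ _)
    ... | no ¬d = trans (+-cong ([]-cong (A? α ×-dec (q ^ m ∣? α ×-dec (m ℕ.<? t →-dec yes ¬d)))
        (level? A? m α)
                             (mk⇔ (λ (Aα , d , _) → Aα , d) (λ (Aα , d) → Aα , d , λ _ → ¬d)))
                           ([]-no (A? α ×-dec no ¬d) (¬d ∘ proj₂)))
                         (+-identityʳ _)

  T-last : (A? : Decidable A) → S (exactly? A? t) ≈ T A? t
  T-last A? = ∑<-cong n λ α → *-congʳ {e α} ([]-cong (exactly? A? t α) (level? A? t α)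
    (mk⇔ (λ (Aα , d , _) → Aα , d) (λ (Aα , d) → Aα , d , λ t<t _ → ℕ.<-irrefl ≡.refl t<t)))

  ∑-layers : (A? : Decidable A) → ∀ {j} → j ℕ.< t → ∑ᴸ ⦅ j , t ⦆ (λ m → S (exactly? A? m)) ≈ T A? (suc j)
  ∑-layers A? {j} j<t = begin
    ∑ᴸ ⦅ j , t ⦆ F               ≈⟨ +-identityʳ _ ⟨
    ∑ᴸ ⦅ j , t ⦆ F + 0#          ≈⟨ +-congˡ (U-no (ℕ.<-irrefl ≡.refl)) ⟨
    ∑ᴸ ⦅ j , t ⦆ F + U (suc t)   ≈⟨ ∑ᴸ-telescope (ℕ.<⇒≤ j<t) F U step ⟩
    U (suc j)                    ≈⟨ U-yes j<t ⟩
    T A? (suc j)                 ∎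
    where
    F U : ℕ → Carrier
    F m = S (exactly? A? m)
    -- The cut-off matters: multiples of qᵗ⁺¹ may occur below n, so `T A? (suc t)` need not vanish.
    U m = [ m ℕ.≤? t ] * T A? m
    U-yes : ∀ {m} → m ℕ.≤ t → U m ≈ T A? m
    U-yes {m} m≤t = trans (*-congʳ ([]-yes (m ℕ.≤? t) m≤t)) (*-identityˡ _)
    U-no : ∀ {m} → ¬ m ℕ.≤ t → U m ≈ 0#
    U-no {m} m≰t = trans (*-congʳ ([]-no (m ℕ.≤? t) m≰t)) (zeroˡ _)
    step : ∀ m → j ℕ.< m → m ℕ.≤ t → F m + U (suc m) ≈ U m
    step m _ m≤t with ℕ.m≤n⇒m<n∨m≡n m≤t
    ... | inj₁ m<t    = trans (+-congˡ (U-yes m<t)) (trans (T-layer A? m<t) (sym (U-yes m≤t)))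
    ... | inj₂ ≡.refl = trans (+-congˡ (U-no (ℕ.<-irrefl ≡.refl)))
        (trans (+-identityʳ _) (trans (T-last A?) (sym (U-yes m≤t))))

  -- `r` is q - 2 and `N` counts the terms of B at level j + 1. Adding C ν on both sides replaces
  -- every subtraction by a cancellation and leaves an identity of semirings.
  product : (A? : Decidable A) (B? : Decidable B) → Periodic M A → Periodic M B →
            (∀ α β → B β → A (α ℕ.+ β) ⇔ A α) →
            ∀ {j} → j ℕ.< t → ∀ r → q ≡ 2 ℕ.+ r → ∀ N → #.# (#.level? B? (suc j)) ≡ N →
            S (exactly? A? j) * S (exactly? B? j) ≈
              (N ℕ.* r) · S (exactly? A? j) + (N ℕ.* suc r) · T A? (suc j)
  product A? B? perA perB inv {j} j<t r q≡2+r N refl-N = begin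
    C * C′ ≈⟨ +-cancelʳ (C * ν) (C * C′) (ν * ρ * C + ν * (1# + ρ) * T₁) (begin
      C * C′ + C * ν                                        ≈⟨ +-congˡ C*T₁′ ⟨
      C * C′ + C * T₁′                                      ≈⟨ distribˡ C C′ T₁′ ⟨
      C * (C′ + T₁′)                                        ≈⟨ *-congˡ (T-layer B? j<t) ⟩
      C * T₀′                                               ≈⟨ C*T₀′ ⟩
      T₀ * ((1# + ρ) * ν)                                   ≈⟨ *-congʳ (T-layer A? j<t) ⟨
      (C + T₁) * ((1# + ρ) * ν)
        ≈⟨ solve 4 (λ C T ρ ν → (C :+ T) :* ((con 1 :+ ρ) :* ν) := ν :* ρ :* C :+ ν :* (con 1 :+ ρ) :* T :+ C
           :* ν) refl C T₁ ρ ν ⟩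
      ν * ρ * C + ν * (1# + ρ) * T₁ + C * ν                 ∎) ⟩
    ν * ρ * C + ν * (1# + ρ) * T₁         ≈⟨ +-cong (scalar r C) (scalar (suc r) T₁) ⟨
    (N ℕ.* r) · C + (N ℕ.* suc r) · T₁    ∎
    where
    C  = S (exactly? A? j)
    C′ = S (exactly? B? j)
    T₀ = T A? j
    T₁ = T A? (suc j)
    T₀′ = T B? j
    T₁′ = T B? (suc j)
    ν = N · 1#
    ρ = r · 1#

    scalar : ∀ k x → (N ℕ.* k) · x ≈ ν * (k · 1#) * x
    scalar k x = begin
      (N ℕ.* k) · x              ≈⟨ SemiringMult.×-congʳ semiring (N ℕ.* k) (*-identityˡ x) ⟨
      (N ℕ.* k) · (1# * x)       ≈⟨ ×-assoc-* (N ℕ.* k) 1# x ⟨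
      (N ℕ.* k) · 1# * x         ≈⟨ *-congʳ (×1-homo-* N k) ⟩
      ν * (k · 1#) * x           ∎

    #₁ : # (level? B? (suc j)) ≈ ν
    #₁ = trans (CountsIn.∑<-· commutativeSemiring n (level? B? (suc j))) (×-congˡ refl-N)

    #₀ : # (level? B? j) ≈ (1# + (1# + ρ)) * ν
    #₀ = trans (CountsIn.∑<-· commutativeSemiring n (level? B? j))
      (trans (×-congˡ (≡.trans (#.#-step B? perB j<t) (cong₂ ℕ._*_ q≡2+r refl-N))) (×1-homo-* (2 ℕ.+ r) N))

    T₀*T₁′ : T₀ * T₁′ ≈ T₀ * ν
    T₀*T₁′ = trans (T-absorb A? B? perA inv (ℕ.n≤1+n j) j<t) (*-congˡ #₁)

    C*T₁′ : C * T₁′ ≈ C * ν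
    -- C is T₀ without T₁, and both T₀ and T₁ absorb T₁′.
    C*T₁′ = +-cancelʳ (T₁ * ν) _ _ (begin
      C * T₁′ + T₁ * ν     ≈⟨ +-congˡ (trans (T-absorb A? B? perA inv ℕ.≤-refl j<t) (*-congˡ #₁)) ⟨
      C * T₁′ + T₁ * T₁′   ≈⟨ distribʳ T₁′ C T₁ ⟨
      (C + T₁) * T₁′       ≈⟨ *-congʳ (T-layer A? j<t) ⟩
      T₀ * T₁′             ≈⟨ T₀*T₁′ ⟩
      T₀ * ν               ≈⟨ *-congʳ (T-layer A? j<t) ⟨
      (C + T₁) * ν         ≈⟨ distribʳ ν C T₁ ⟩
      C * ν + T₁ * ν       ∎)

    C*T₀′ : C * T₀′ ≈ T₀ * ((1# + ρ) * ν)
    -- Absorption does not reach T₁ T₀′, as terms of T₀′ need not be multiples of qʲ⁺¹; the exchange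
    -- turns it into T₀ T₁′.
    C*T₀′ = +-cancelʳ (T₀ * ν) _ _ (begin
      C * T₀′ + T₀ * ν                  ≈⟨ +-congˡ (trans (T-exchange A? B? perA perB j<t) T₀*T₁′) ⟨
      C * T₀′ + T₁ * T₀′                ≈⟨ distribʳ T₀′ C T₁ ⟨
      (C + T₁) * T₀′                    ≈⟨ *-congʳ (T-layer A? j<t) ⟩
      T₀ * T₀′                          ≈⟨ trans (T-absorb A? B? perA inv ℕ.≤-refl (ℕ.<⇒≤ j<t)) (*-congˡ #₀) ⟩
      T₀ * ((1# + (1# + ρ)) * ν)
        ≈⟨ solve 3 (λ T ρ ν → T :* ((con 1 :+ (con 1 :+ ρ)) :* ν) := T :* ((con 1 :+ ρ) :* ν) :+ T :* ν) refl
           T₀ ρ ν ⟩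
      T₀ * ((1# + ρ) * ν) + T₀ * ν      ∎)

-- Congruences, multiplicative orders and primitive roots.

-- The wrapper keeps a and b inferable, whereas the bare congruence unfolds to a divisibility of
-- their difference.
record Congruent (m : ℕ) (a b : ℤ) : Set where
  constructor mod
  field divisible : a ≡ b [mod m ]
open Congruent public

module Mod (m : ℕ) where

  infix 4 _≈_
  _≈_ : ℤ → ℤ → Set
  _≈_ = Congruent m

  private
    via : ∀ {x y} → x ≡ y → + m ∣ᶻ x → + m ∣ᶻ y
    via = subst (+ m ∣ᶻ_)
    open ℤSolver.+-*-Solver

  ≈-refl : ∀ {a} → a ≈ a
  ≈-refl {a} = mod (divides (+ 0) (ℤ.+-inverseʳ a))

  ≈-sym : ∀ {a b} → a ≈ b → b ≈ a
  ≈-sym {a} {b} (mod p) = mod (via (solve 2 (λ a b → :- (a :- b) := b :- a) ≡.refl a b) (ℤ.∣m⇒∣-m p))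

  ≈-trans : ∀ {a b c} → a ≈ b → b ≈ c → a ≈ c
  ≈-trans {a} {b} {c} (mod p) (mod q) = mod (via
      (solve 3 (λ a b c → (a :- b) :+ (b :- c) := a :- c) ≡.refl a b c) (ℤ.∣m∣n⇒∣m+n p q))

  setoid : Setoid 0ℓ 0ℓ
  setoid = record
    { Carrier = ℤ
    ; _≈_ = _≈_
    ; isEquivalence = record { refl = ≈-refl ; sym = ≈-sym ; trans = ≈-trans }
    }

  module Reasoning = SetoidReasoning setoid

  *-cong : ∀ {a b c d} → a ≈ b → c ≈ d → a ℤ.* c ≈ b ℤ.* d
  *-cong {a} {b} {c} {d} (mod p) (mod q) = mod
      (via (solve 4 (λ a b c d → (a :- b) :* c :+ b :* (c :- d) := a :* c :- b :* d) ≡.refl a b c d)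
    (ℤ.∣m∣n⇒∣m+n (ℤ.∣m⇒∣m*n {m = a ℤ.- b} c p) (ℤ.∣n⇒∣m*n b {c ℤ.- d} q)))

  *-congˡ : ∀ c {a b} → a ≈ b → c ℤ.* a ≈ c ℤ.* b
  *-congˡ c = *-cong (≈-refl {c})

  *-congʳ : ∀ c {a b} → a ≈ b → a ℤ.* c ≈ b ℤ.* c
  *-congʳ c p = *-cong p (≈-refl {c})

  neg-cong : ∀ {a b} → a ≈ b → ℤ.- a ≈ ℤ.- b
  neg-cong {a} {b} (mod p) = mod (via (solve 2 (λ a b → :- (a :- b) := (:- a) :- (:- b)) ≡.refl a b)
      (ℤ.∣m⇒∣-m p))

  ^-cong : ∀ {a b} → a ≈ b → ∀ k → a ℤ.^ k ≈ b ℤ.^ k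
  ^-cong p zero    = ≈-refl
  ^-cong p (suc k) = *-cong p (^-cong p k)

  ^≈1 : ∀ {a} → a ≈ + 1 → ∀ k → a ℤ.^ k ≈ + 1
  ^≈1 {a} p k = subst (a ℤ.^ k ≈_) (ℤ.^-zeroˡ k) (^-cong p k)

  weaken : ∀ {d a b} → d ∣ m → a ≈ b → Congruent d a b
  weaken d∣m (mod p) = mod (ℤ.∣-trans (ℤ.∣ᵤ⇒∣ d∣m) p)

  scale : ∀ k {a b} → a ≈ b → Congruent (k ℕ.* m) (+ k ℤ.* a) (+ k ℤ.* b)
  scale k {a} {b} (mod p) = mod (subst₂ _∣ᶻ_ (≡.sym (ℤ.pos-* k m))
      (solve 3 (λ k a b → k :* (a :- b) := k :* a :- k :* b) ≡.refl (+ k) a b) (ℤ.*-monoʳ-∣ (+ k) p))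

  unscale : ∀ k .{{_ : NonZero k}} {a b} → Congruent (k ℕ.* m) (+ k ℤ.* a) (+ k ℤ.* b) → a ≈ b
  unscale k@(suc _) {a} {b} (mod p) = mod (ℤ.*-cancelˡ-∣ (+ k) {+ m} {a ℤ.- b}
    (subst₂ _∣ᶻ_ (ℤ.pos-* k m) (solve 3 (λ k a b → k :* a :- k :* b := k :* (a :- b)) ≡.refl (+ k) a b) p))

  cancelˡ : ∀ {c a b} → Coprime (+ m) c → c ℤ.* a ≈ c ℤ.* b → a ≈ b
  cancelˡ {c} {a} {b} cop (mod p) = mod (ℤ.∣ᵤ⇒∣ {+ m} {a ℤ.- b} (ℤ.coprime-divisor (+ m) c (a ℤ.- b) cop
    (ℤ.∣⇒∣ᵤ (via (solve 3 (λ c a b → c :* a :- c :* b := c :* (a :- b)) ≡.refl c a b) p))))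

crt : ∀ {m n a b} → ℕ.Coprime m n → Congruent m a b → Congruent n a b → Congruent (m ℕ.* n) a b
crt {m} {n} {a} {b} cop (mod p) (mod q) with ℤ.∣⇒∣ᵤ p
... | ℕ.divides k eq = mod (ℤ.∣ᵤ⇒∣ {+ (m ℕ.* n)} {a ℤ.- b} (subst₂ _∣_ (ℕ.*-comm n m) (≡.sym eq)
        (ℕ.*-monoˡ-∣ m (ℕ.coprime-divisor (ℕ.sym cop)
            (subst (n ∣_) (≡.trans eq (ℕ.*-comm k m)) (ℤ.∣⇒∣ᵤ q))))))

coprime-* : ∀ {m a b} → ℕ.Coprime m a → ℕ.Coprime m b → ℕ.Coprime m (a ℕ.* b)
coprime-* {m} {a} {b} ca cb {d} (d∣m , d∣ab) = cb (d∣m , ℕ.coprime-divisor d⊥a d∣ab)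
  where
  d⊥a : ℕ.Coprime d a
  d⊥a (e∣d , e∣a) = ca (ℕ.∣-trans e∣d d∣m , e∣a)

coprime-ℤ* : ∀ {m} a b → Coprime (+ m) a → Coprime (+ m) b → Coprime (+ m) (a ℤ.* b)
coprime-ℤ* {m} a b ca cb = subst (ℕ.Coprime m) (≡.sym (ℤ.abs-* a b)) (coprime-* {m} ca cb)

coprime-^ : ∀ {m} a → Coprime (+ m) a → ∀ k → Coprime (+ m) (a ℤ.^ k)
coprime-^ a ca zero    = ℕ.sym (ℕ.1-coprimeTo _)
coprime-^ a ca (suc k) = coprime-ℤ* a (a ℤ.^ k) ca (coprime-^ a ca k)

module Order {m d : ℕ} {ρ : ℤ} (ord : HasOrder m ρ d) where

  open HasOrder ord
  open Mod m

  d≢0 : NonZero d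
  d≢0 = ℕ.>-nonZero positive

  -- A common divisor of m and ρ divides ρᵈ - 1 and, since d is positive, also ρᵈ; so it divides 1.
  coprime : Coprime (+ m) ρ
  coprime {e} (e∣m , e∣ρ) = ℕ.∣1⇒≡1 (ℤ.∣⇒∣ᵤ {+ e} {+ 1} (ℤ.∣m+n∣m⇒∣n {+ e} {ρ ℤ.^ d ℤ.- + 1} {+ 1}
      (subst (+ e ∣ᶻ_) (≡.sym (cancel (ρ ℤ.^ d))) (e∣ρ^ d {{d≢0}}))
      (ℤ.∣-trans (ℤ.∣ᵤ⇒∣ {+ e} {+ m} e∣m) power)))
    where
    open ℤSolver.+-*-Solver
    cancel : ∀ x → x ℤ.- + 1 ℤ.+ + 1 ≡ x
    cancel = solve 1 (λ x → x :- con (+ 1) :+ con (+ 1) := x) ≡.refl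
    e∣ρ^ : ∀ k .{{_ : NonZero k}} → + e ∣ᶻ ρ ℤ.^ k
    e∣ρ^ (suc k) = ℤ.∣m⇒∣m*n {+ e} {ρ} (ρ ℤ.^ k) (ℤ.∣ᵤ⇒∣ {+ e} {ρ} e∣ρ)

  ^-multiple : ∀ k → ρ ℤ.^ (d ℕ.* k) ≈ + 1
  ^-multiple k = subst (_≈ + 1) (ℤ.^-*-assoc ρ d k) (^≈1 (mod power) k)

  ^-mod : ∀ a b k → a ≡ b ℕ.+ d ℕ.* k → ρ ℤ.^ a ≈ ρ ℤ.^ b
  ^-mod a b k ≡.refl = begin
    ρ ℤ.^ (b ℕ.+ d ℕ.* k)          ≡⟨ ℤ.^-distribˡ-+-* ρ b (d ℕ.* k) ⟩
    ρ ℤ.^ b ℤ.* ρ ℤ.^ (d ℕ.* k)    ≈⟨ *-congˡ (ρ ℤ.^ b) (^-multiple k) ⟩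
    ρ ℤ.^ b ℤ.* + 1                ≡⟨ ℤ.*-identityʳ (ρ ℤ.^ b) ⟩
    ρ ℤ.^ b                        ∎
    where open Reasoning

  -- A nonzero remainder of k modulo d would be a positive exponent below d with power 1.
  order-∣ : ∀ k → ρ ℤ.^ k ≈ + 1 → d ∣ k
  order-∣ k p with k % d in eq
    where instance _ = d≢0
  ... | zero  = ℕ.m%n≡0⇒n∣m k d {{d≢0}} eq
  ... | suc r = ⊥-elim (ℕ.<⇒≱ (subst (ℕ._< d) eq (ℕ.m%n<n k d {{d≢0}}))
                  (least (suc r) ℕ.z<s (divisible (≈-trans (≈-sym (^-mod k (suc r) q k≡)) p))))
    where
    q = _/_ k d {{d≢0}}
    k≡ : k ≡ suc r ℕ.+ d ℕ.* q
    k≡ = ≡.trans (ℕ.m≡m%n+[m/n]*n k d {{d≢0}}) (cong₂ ℕ._+_ eq (ℕ.*-comm q d))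

  -- Cancelling w ρᵃ would leave ρ^(b - a) ≡ 1 with 0 < b - a < d.
  distinct-powers : ∀ {w a b} → Coprime (+ m) w → a ℕ.< b → b ℕ.< d → ¬ w ℤ.* ρ ℤ.^ a ≈ w ℤ.* ρ ℤ.^ b
  distinct-powers {w} {a} {b} cw a<b b<d p = ℕ.<⇒≱ (ℕ.≤-<-trans (ℕ.m∸n≤m b a) b<d)
    (least (b ℕ.∸ a) (ℕ.m<n⇒0<n∸m a<b)
      (divisible (≈-sym (cancelˡ {w ℤ.* ρ ℤ.^ a} {+ 1} {ρ ℤ.^ (b ℕ.∸ a)}
          (coprime-ℤ* w (ρ ℤ.^ a) cw (coprime-^ ρ coprime a)) (begin
        w ℤ.* ρ ℤ.^ a ℤ.* + 1                      ≡⟨ ℤ.*-identityʳ _ ⟩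
        w ℤ.* ρ ℤ.^ a                              ≈⟨ p ⟩
        w ℤ.* ρ ℤ.^ b                              ≡⟨ cong (λ k → w ℤ.* ρ ℤ.^ k) (ℕ.m+[n∸m]≡n (ℕ.<⇒≤ a<b)) ⟨
        w ℤ.* ρ ℤ.^ (a ℕ.+ (b ℕ.∸ a))              ≡⟨ cong (w ℤ.*_) (ℤ.^-distribˡ-+-* ρ a (b ℕ.∸ a)) ⟩
        w ℤ.* (ρ ℤ.^ a ℤ.* ρ ℤ.^ (b ℕ.∸ a))        ≡⟨ ℤ.*-assoc w _ _ ⟨
        w ℤ.* ρ ℤ.^ a ℤ.* ρ ℤ.^ (b ℕ.∸ a)          ∎)))))
    where open Reasoning

module _ (m : ℕ) .{{_ : NonZero m}} where

  open Mod m

  private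
    units : List ℕ
    units = filter (λ k → coprime? k m) (map suc (upTo m))

    -- φ counts in 1, …, m, so residues are represented there.
    rep : ℤ → ℕ
    rep u = suc ((u ℤ.- + 1) ℤ.%ℕ m)

    u≡rep+ : ∀ u → u ≡ + rep u ℤ.+ (u ℤ.- + 1) ℤ./ℕ m ℤ.* + m
    u≡rep+ u = begin
      u                                                            ≡⟨ solve 1
          (λ u → u := con (+ 1) :+ (u :- con (+ 1))) ≡.refl u ⟩
      + 1 ℤ.+ (u ℤ.- + 1)
        ≡⟨ cong (λ v → + 1 ℤ.+ v) (ℤ.a≡a%ℕn+[a/ℕn]*n (u ℤ.- + 1) m) ⟩
      + 1 ℤ.+ (+ ((u ℤ.- + 1) ℤ.%ℕ m) ℤ.+ (u ℤ.- + 1) ℤ./ℕ m ℤ.* + m)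
        ≡⟨ ℤ.+-assoc (+ 1) (+ ((u ℤ.- + 1) ℤ.%ℕ m)) ((u ℤ.- + 1) ℤ./ℕ m ℤ.* + m) ⟨
      + rep u ℤ.+ (u ℤ.- + 1) ℤ./ℕ m ℤ.* + m                       ∎
      where
      open ≡-Reasoning
      open ℤSolver.+-*-Solver

    u≈rep : ∀ u → u ≈ + rep u
    u≈rep u = mod (divides q (≡.trans (cong (ℤ._- + rep u) (u≡rep+ u))
      (solve 2 (λ r x → r :+ x :- r := x) ≡.refl (+ rep u) (q ℤ.* + m))))
      where
      q = (u ℤ.- + 1) ℤ./ℕ m
      open ℤSolver.+-*-Solver

    rep-∈ : ∀ u → Coprime (+ m) u → rep u ∈ units
    rep-∈ u cu = ∈-filter⁺ (λ k → coprime? k m) (∈-map⁺ suc (∈-upTo⁺ (ℤ.n%ℕd<d (u ℤ.- + 1) m)))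
      λ {d} (d∣rep , d∣m) → cu (d∣m , ℤ.∣⇒∣ᵤ {+ d} (subst (+ d ∣ᶻ_) (≡.sym (u≡rep+ u))
        (ℤ.∣m∣n⇒∣m+n {+ d} {+ rep u} (ℤ.∣ᵤ⇒∣ {+ d} {+ rep u} d∣rep)
            (ℤ.∣n⇒∣m*n ((u ℤ.- + 1) ℤ./ℕ m) {+ m} (ℤ.∣ᵤ⇒∣ {+ d} {+ m} d∣m)))))

  -- `φ m` is by definition the length of `units`, so the positions in that list serve as
  -- pigeonholes.
  collision : ∀ {k} (h : Fin k → ℤ) (idx : ∀ i → ∃ λ a → rep (h i) ≡ lookup units a) → φ m ℕ.< k →
              ∃₂ λ i j → i Fin.< j × h i ≈ h j
  collision h idx φ<k with Fin.pigeonhole φ<k (λ i → proj₁ (idx i))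
  ... | i , j , i<j , eq = i , j , i<j , ≈-trans (u≈rep (h i))
      (subst (λ k → + k ≈ h j) (≡.sym same) (≈-sym (u≈rep (h j))))
    where
    same : rep (h i) ≡ rep (h j)
    same = ≡.trans (proj₂ (idx i)) (≡.trans (cong (lookup units) eq) (≡.sym (proj₂ (idx j))))

  units-pigeonhole : (h : Fin (suc (φ m)) → ℤ) → (∀ i → Coprime (+ m) (h i)) → ∃₂ λ i j →
      i Fin.< j × h i ≈ h j
  units-pigeonhole h ch = collision h (λ i → index (rep-∈ (h i) (ch i)) , lookup-index (rep-∈ (h i) (ch i)))
      (ℕ.n<1+n (φ m))

  -- The unit u and the products w ρᵏ with k < φ m are one unit too many. The products are distinct,
  -- so the coincidence involves u.
  primitiveRoot-transitive : ∀ {ρ} → PrimitiveRoot m ρ → ∀ {u w} → Coprime (+ m) u → Coprime (+ m) w → ∃ λ k →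
      u ≈ w ℤ.* ρ ℤ.^ k
  primitiveRoot-transitive {ρ} prim {u} {w} cu cw = find (units-pigeonhole h coprime-h)
    where
    open Order prim
    h : Fin (suc (φ m)) → ℤ
    h zero    = u
    h (suc k) = w ℤ.* ρ ℤ.^ toℕ k
    coprime-h : ∀ i → Coprime (+ m) (h i)
    coprime-h zero    = cu
    coprime-h (suc k) = coprime-ℤ* w (ρ ℤ.^ toℕ k) cw (coprime-^ ρ coprime (toℕ k))
    find : (∃₂ λ i j → i Fin.< j × h i ≈ h j) → ∃ λ k → u ≈ w ℤ.* ρ ℤ.^ k
    find (zero  , suc k , _   , p) = toℕ k , p
    find (suc a , suc b , a<b , p) = ⊥-elim (distinct-powers {w} cw (ℕ.s<s⁻¹ a<b) (Fin.toℕ<n b) p)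

-- Prime powers and Euler's function.

prime⇒coprime-^ : ∀ {p u} → Prime p → ¬ p ∣ u → ∀ e → ℕ.Coprime (p ^ e) u
prime⇒coprime-^ {p} {u} pp p∤u e = ℕ.sym (powers e)
  where
  coprime : ℕ.Coprime u p
  coprime (d∣u , d∣p) with prime⇒irreducible pp d∣p
  ... | inj₁ d≡1 = d≡1
  ... | inj₂ ≡.refl = ⊥-elim (p∤u d∣u)
  powers : ∀ e → ℕ.Coprime u (p ^ e)
  powers zero    = ℕ.sym (ℕ.1-coprimeTo u)
  powers (suc e) = coprime-* coprime (powers e)

prime∤1 : ∀ {p} → Prime p → ¬ p ∣ 1
prime∤1 pp p∣1 = Prime.¬prime[1] (subst Prime (ℕ.∣1⇒≡1 p∣1) pp)

coprime⇒∤ : ∀ {p u} e → Prime p → ℕ.Coprime (p ^ suc e) u → ¬ p ∣ u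
coprime⇒∤ {p} e pp c p∣u = prime∤1 pp (subst (p ∣_) (c (ℕ.m∣m*n (p ^ e) , p∣u)) ℕ.∣-refl)

module Totient where

  open RangeSums ℕ.+-*-commutativeSemiring
  open ListSums ℕ.+-*-commutativeSemiring

  length-filter : ∀ {A : Set} {p} {P : Pred A p} (P? : Decidable P) xs →
      length (filter P? xs) ≡ ∑ᴸ xs (λ x → [ P? x ])
  length-filter P? []       = ≡.refl
  length-filter P? (x ∷ xs) with P? x
  ... | yes _ = cong suc (length-filter P? xs)
  ... | no _  = length-filter P? xs

  ∑ᴸ-applyUpTo : ∀ {A : Set} (f : ℕ → A) F n → ∑ᴸ (applyUpTo f n) F ≡ ∑< n (F ∘ f)
  ∑ᴸ-applyUpTo f F zero    = ≡.refl
  ∑ᴸ-applyUpTo f F (suc n) = cong (F (f 0) ℕ.+_) (∑ᴸ-applyUpTo (f ∘ suc) F n)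

  -- The definition of φ runs over 1, ..., m. Coprimality to m has period m, so the range may start
  -- at 0.
  φ≡∑ : ∀ m → φ m ≡ ∑< m (λ k → [ coprime? k m ])
  φ≡∑ m = begin
    φ m
      ≡⟨ length-filter (λ k → coprime? k m) (map suc (upTo m)) ⟩
    ∑ᴸ (map suc (upTo m)) (λ k → [ coprime? k m ])
      ≡⟨ cong (λ xs → ∑ᴸ xs (λ k → [ coprime? k m ])) (List.map-upTo suc m) ⟩
    ∑ᴸ (applyUpTo suc m) (λ k → [ coprime? k m ])    ≡⟨ ∑ᴸ-applyUpTo suc (λ k → [ coprime? k m ]) m ⟩
    ∑< m (λ k → [ coprime? (suc k) m ])
      ≡⟨ ∑<-cong m (λ k → cong (λ x → [ coprime? x m ]) (ℕ.+-comm 1 k)) ⟩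
    ∑< m (λ k → [ coprime? (k ℕ.+ 1) m ])            ≡⟨ ∑<-shift m (λ k → [ coprime? k m ]) periodic 1 ⟩
    ∑< m (λ k → [ coprime? k m ])                    ∎
    where
    open ≡-Reasoning
    periodic : ∀ k → [ coprime? (k ℕ.+ m) m ] ≡ [ coprime? k m ]
    periodic k = []-cong (coprime? (k ℕ.+ m) m) (coprime? k m) (mk⇔
      (λ c {d} (d∣k , d∣m) → c {d} (ℕ.∣m∣n⇒∣m+n d∣k d∣m , d∣m))
      (λ c {d} (d∣k+m , d∣m) → c {d} (ℕ.∣m+n∣m⇒∣n (subst (d ∣_) (ℕ.+-comm k m) d∣k+m) d∣m , d∣m)))

  φ-prime-power : ∀ {p} → Prime p → ∀ e → φ (p ^ suc e) ≡ ∑< (p ^ suc e) (λ k → [ ¬? (p ∣? k) ])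
  φ-prime-power {p} pp e = ≡.trans (φ≡∑ N) (∑<-cong N λ k → []-cong (coprime? k N) (¬? (p ∣? k))
      (mk⇔ (avoids k) (unit k)))
    where
    N = p ^ suc e
    avoids : ∀ k → ℕ.Coprime k N → ¬ p ∣ k
    avoids k c = coprime⇒∤ e pp (ℕ.sym {k} {N} c)
    unit : ∀ k → ¬ p ∣ k → ℕ.Coprime k N
    unit k p∤k = ℕ.sym {N} {k} (prime⇒coprime-^ pp p∤k (suc e))

  -- The residues modulo pᵉ⁺¹ that are not units are the pᵉ multiples of p.
  φ[p^1+e] : ∀ {p} → Prime p → ∀ e → φ (p ^ suc e) ≡ p ^ e ℕ.* (p ℕ.∸ 1)
  φ[p^1+e] {p} pp e = begin
    φ N                            ≡⟨ ℕ.m+n∸n≡m (φ N) (p ^ e) ⟨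
    φ N ℕ.+ p ^ e ℕ.∸ p ^ e        ≡⟨ cong (ℕ._∸ p ^ e) total ⟩
    N ℕ.∸ p ^ e                    ≡⟨ cong₂ ℕ._∸_ (ℕ.*-comm p (p ^ e)) (≡.sym (ℕ.*-identityʳ (p ^ e))) ⟩
    p ^ e ℕ.* p ℕ.∸ p ^ e ℕ.* 1    ≡⟨ ℕ.*-distribˡ-∸ (p ^ e) p 1 ⟨
    p ^ e ℕ.* (p ℕ.∸ 1)            ∎
    where
    open ≡-Reasoning
    instance _ = prime⇒nonZero pp
    N = p ^ suc e
    ∑<-1 : ∀ m → ∑< m (λ _ → 1) ≡ m
    ∑<-1 zero    = ≡.refl
    ∑<-1 (suc m) = cong suc (∑<-1 m)
    multiples : ∑< N (λ k → [ p ∣? k ]) ≡ p ^ e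
    multiples = begin
      ∑< N (λ k → [ p ∣? k ])                       ≡⟨ ∑<-cong N (λ k → ≡.sym (ℕ.*-identityʳ [ p ∣? k ])) ⟩
      ∑< N (λ k → [ p ∣? k ] ℕ.* 1)
        ≡⟨ cong (λ m → ∑< m (λ k → [ p ∣? k ] ℕ.* 1)) (ℕ.*-comm p (p ^ e)) ⟩
      ∑< (p ^ e ℕ.* p) (λ k → [ p ∣? k ] ℕ.* 1)     ≡⟨ ∑<-multiples p (p ^ e) (λ _ → 1) ⟩
      ∑< (p ^ e) (λ _ → 1)                          ≡⟨ ∑<-1 (p ^ e) ⟩
      p ^ e                                         ∎
    complement : ∀ k → [ ¬? (p ∣? k) ] ℕ.+ [ p ∣? k ] ≡ 1
    complement k with p ∣? k
    ... | yes _ = ≡.refl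
    ... | no _  = ≡.refl
    total : φ N ℕ.+ p ^ e ≡ N
    total = begin
      φ N ℕ.+ p ^ e
        ≡⟨ cong₂ ℕ._+_ (φ-prime-power pp e) (≡.sym multiples) ⟩
      ∑< N (λ k → [ ¬? (p ∣? k) ]) ℕ.+ ∑< N (λ k → [ p ∣? k ])       ≡⟨ ∑-distrib-+ {N} _ _ ⟨
      ∑< N (λ k → [ ¬? (p ∣? k) ] ℕ.+ [ p ∣? k ])                    ≡⟨ ∑<-cong N complement ⟩
      ∑< N (λ _ → 1)                                                 ≡⟨ ∑<-1 N ⟩
      N                                                              ∎

open Totient using (φ-prime-power; φ[p^1+e])

-- Signs of powers, the odd half totient, and the powers of l modulo p.

parity : ∀ k → (∃ λ m → k ≡ m ℕ.* 2) ⊎ (∃ λ m → k ≡ suc (m ℕ.* 2))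
parity zero    = inj₁ (0 , ≡.refl)
parity (suc k) with parity k
... | inj₁ (m , ≡.refl) = inj₂ (m , ≡.refl)
... | inj₂ (m , ≡.refl) = inj₁ (suc m , ≡.refl)

^-even : ∀ x m → (ℤ.- x) ℤ.^ (m ℕ.* 2) ≡ x ℤ.^ (m ℕ.* 2)
^-even x zero    = ≡.refl
^-even x (suc m) = ≡.trans (cong (λ y → ℤ.- x ℤ.* (ℤ.- x ℤ.* y)) (^-even x m))
  (solve 2 (λ x y → :- x :* (:- x :* y) := x :* (x :* y)) ≡.refl x (x ℤ.^ (m ℕ.* 2)))
  where open ℤSolver.+-*-Solver

^-odd : ∀ x m → (ℤ.- x) ℤ.^ suc (m ℕ.* 2) ≡ ℤ.- (x ℤ.^ suc (m ℕ.* 2))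
^-odd x m = ≡.trans (cong (ℤ.- x ℤ.*_) (^-even x m)) (≡.sym (ℤ.neg-distribˡ-* x _))

odd⇒ : ∀ {d} → ¬ 2 ∣ d → ∃ λ m → d ≡ suc (m ℕ.* 2)
odd⇒ {d} odd with parity d
... | inj₁ (m , ≡.refl) = ⊥-elim (odd (ℕ.n∣m*n m))
... | inj₂ result     = result

neg-^ : ∀ x {d} → ¬ 2 ∣ d → (ℤ.- x) ℤ.^ d ≡ ℤ.- (x ℤ.^ d)
neg-^ x odd with odd⇒ odd
... | m , ≡.refl = ^-odd x m

2∤odd : ∀ m → ¬ 2 ∣ suc (m ℕ.* 2)
2∤odd m 2∣ with ℕ.∣1⇒≡1 (to (∣-+-⇔ (ℕ.n∣m*n m) 1) 2∣)
... | ()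

module HalfTotient {p : ℕ} (pp : Prime p) (p%4≡3 : p % 4 ≡ 3) where

  private k₄ = p / 4

  p≡3+4k : p ≡ 3 ℕ.+ k₄ ℕ.* 4
  p≡3+4k = ≡.trans (ℕ.m≡m%n+[m/n]*n p 4) (cong (ℕ._+ k₄ ℕ.* 4) p%4≡3)

  2<p : 2 ℕ.< p
  2<p = subst (2 ℕ.<_) (≡.sym p≡3+4k) (ℕ.s≤s (ℕ.s≤s (ℕ.s≤s ℕ.z≤n)))

  2∤p : ¬ 2 ∣ p
  2∤p = subst (λ x → ¬ 2 ∣ x) (≡.sym (≡.trans p≡3+4k
      (solve 1 (λ k → con 3 :+ k :* con 4 := con 1 :+ (con 1 :+ k :* con 2) :* con 2) ≡.refl k₄)))
      (2∤odd (1 ℕ.+ k₄ ℕ.* 2))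
    where open ℕSolver.+-*-Solver

  2∤p^ : ∀ s → ¬ 2 ∣ p ^ s
  2∤p^ zero    = prime∤1 Prime.prime[2]
  2∤p^ (suc s) = [ 2∤p , 2∤p^ s ]′ ∘ euclidsLemma p (p ^ s) Prime.prime[2]

  -- With p = 4 k₄ + 3 the second factor is (p - 1)/2, so this is φ(pˢ⁺¹)/2 written as a product of
  -- odd numbers.
  half : ℕ → ℕ
  half s = p ^ s ℕ.* suc (k₄ ℕ.* 2)

  φ≡half*2 : ∀ s → φ (p ^ suc s) ≡ half s ℕ.* 2
  φ≡half*2 s = begin
    φ (p ^ suc s)                       ≡⟨ φ[p^1+e] pp s ⟩
    p ^ s ℕ.* (p ℕ.∸ 1)                 ≡⟨ cong (λ x → p ^ s ℕ.* (x ℕ.∸ 1)) p≡3+4k ⟩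
    p ^ s ℕ.* (2 ℕ.+ k₄ ℕ.* 4)
      ≡⟨ solve 2 (λ x k → x :* (con 2 :+ k :* con 4) := (x :* (con 1 :+ k :* con 2)) :* con 2) ≡.refl (p ^ s) k₄ ⟩
    half s ℕ.* 2                        ∎
    where
    open ≡-Reasoning
    open ℕSolver.+-*-Solver

  φ/2≡half : ∀ s → φ (p ^ suc s) / 2 ≡ half s
  φ/2≡half s = ≡.trans (cong (_/ 2) (φ≡half*2 s)) (ℕ.m*n/n≡m (half s) 2)

  φ≡φ/2*2 : ∀ s → φ (p ^ suc s) ≡ φ (p ^ suc s) / 2 ℕ.* 2
  φ≡φ/2*2 s = ≡.trans (φ≡half*2 s) (cong (ℕ._* 2) (≡.sym (φ/2≡half s)))

  φ/2-odd : ∀ s → ¬ 2 ∣ φ (p ^ suc s) / 2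
  φ/2-odd s = subst (λ x → ¬ 2 ∣ x) (≡.sym (φ/2≡half s))
    ([ 2∤p^ s , 2∤odd k₄ ]′ ∘ euclidsLemma (p ^ s) (suc (k₄ ℕ.* 2)) Prime.prime[2])

-- As l has odd order φ(pˢ)/2, - l is a primitive root, so every unit modulo pˢ is plus or minus a
-- power of l, and the sign is already visible modulo p.
module HalfOrder {p l d : ℕ} (s : ℕ) (pp : Prime p) (2<p : 2 ℕ.< p)
  (ord : HasOrder (p ^ suc s) (+ l) d) (φ≡d*2 : φ (p ^ suc s) ≡ d ℕ.* 2) (d-odd : ¬ 2 ∣ d) where

  private
    L = + l
    instance
      p≢0 : NonZero p
      p≢0 = prime⇒nonZero pp

  open Order ord public renaming (coprime to l-coprime)
  module ℙ = Mod p
  module ℙˢ = Mod (p ^ suc s)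

  p∣pˢ : p ∣ p ^ suc s
  p∣pˢ = ℕ.m∣m*n (p ^ s)

  l^dk≈1 : ∀ k → L ℤ.^ (d ℕ.* k) ℙ.≈ + 1
  l^dk≈1 k = ℙˢ.weaken p∣pˢ (^-multiple k)

  l^kd≈1 : ∀ k → (L ℤ.^ k) ℤ.^ d ℙ.≈ + 1
  l^kd≈1 k = subst (ℙ._≈ + 1) (≡.trans (cong (L ℤ.^_) (ℕ.*-comm d k)) (≡.sym (ℤ.^-*-assoc L k d))) (l^dk≈1 k)

  -- Raised to the odd exponent d, such a congruence would become 1 ≡ - 1 modulo p, against p > 2.
  l^a≉-l^b : ∀ a b → ¬ L ℤ.^ a ℙ.≈ ℤ.- (L ℤ.^ b)
  l^a≉-l^b a b eq = ℕ.<⇒≱ 2<p (ℕ.∣⇒≤ (ℤ.∣⇒∣ᵤ (divisible 1≈-1)))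
    where
    open ℙ.Reasoning
    1≈-1 : + 1 ℙ.≈ ℤ.- (+ 1)
    1≈-1 = begin
      + 1                            ≈⟨ l^kd≈1 a ⟨
      (L ℤ.^ a) ℤ.^ d                ≈⟨ ℙ.^-cong eq d ⟩
      (ℤ.- (L ℤ.^ b)) ℤ.^ d          ≡⟨ neg-^ (L ℤ.^ b) d-odd ⟩
      ℤ.- ((L ℤ.^ b) ℤ.^ d)          ≈⟨ ℙ.neg-cong (l^kd≈1 b) ⟩
      ℤ.- (+ 1)                      ∎

  -- If (- l)ᵉ ≡ 1 with e odd, then 1 would be the negative of a power of l. If e = 2m, then d
  -- divides 2m and, being odd, divides m, so e is at least 2d.
  -l-primitiveRoot : PrimitiveRoot (p ^ suc s) (ℤ.- L)
  -l-primitiveRoot = subst (HasOrder (p ^ suc s) (ℤ.- L)) (≡.sym φ≡d*2) (record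
    { positive = ℕ.*-monoˡ-< 2 (HasOrder.positive ord)
    ; power    = divisible (subst (ℙˢ._≈ + 1) (≡.sym (^-even L d)) (^-multiple 2))
    ; least    = λ e 0<e p → least e 0<e (mod p)
    })
    where
    least : ∀ e → 0 ℕ.< e → (ℤ.- L) ℤ.^ e ℙˢ.≈ + 1 → d ℕ.* 2 ℕ.≤ e
    least e 0<e eq with parity e
    least _ ()  _  | inj₁ (zero , ≡.refl)
    ... | inj₁ (suc m , ≡.refl) = ℕ.*-monoˡ-≤ 2
        (ℕ.∣⇒≤ (ℕ.coprime-divisor {d} {2} {suc m} (ℕ.sym (prime⇒coprime-^ Prime.prime[2] d-odd 1))
            (subst (d ∣_) (ℕ.*-comm (suc m) 2) (order-∣ _ (subst (ℙˢ._≈ + 1) (^-even L (suc m)) eq)))))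
    ... | inj₂ (m , ≡.refl) = ⊥-elim (l^a≉-l^b 0 (suc (m ℕ.* 2))
        (ℙ.≈-sym (ℙˢ.weaken p∣pˢ (subst (ℙˢ._≈ + 1) (^-odd L m) eq))))

  Unit : ℤ → Set
  Unit = Coprime (+ (p ^ suc s))

  ∤⇒unit : ∀ {u} → ¬ p ∣ ℤ.∣ u ∣ → Unit u
  ∤⇒unit p∤u = prime⇒coprime-^ pp p∤u (suc s)

  unit-ratio : ∀ {u w} → Unit u → Unit w → ∃ λ k → u ℙˢ.≈ w ℤ.* L ℤ.^ k ⊎ u ℙˢ.≈ w ℤ.* (ℤ.- (L ℤ.^ k))
  unit-ratio {u} {w} cu cw = signed (primitiveRoot-transitive (p ^ suc s) {{ℕ.m^n≢0 p (suc s)}}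
      -l-primitiveRoot {u} {w} cu cw)
    where
    signed : (∃ λ k → u ℙˢ.≈ w ℤ.* (ℤ.- L) ℤ.^ k) → ∃ λ k →
        u ℙˢ.≈ w ℤ.* L ℤ.^ k ⊎ u ℙˢ.≈ w ℤ.* (ℤ.- (L ℤ.^ k))
    signed (k , eq) with parity k
    ... | inj₁ (m , ≡.refl) = m ℕ.* 2 , inj₁ (subst (λ x → u ℙˢ.≈ w ℤ.* x) (^-even L m) eq)
    ... | inj₂ (m , ≡.refl) = suc (m ℕ.* 2) , inj₂ (subst (λ x → u ℙˢ.≈ w ℤ.* x) (^-odd L m) eq)

  ℙ-unit : ∀ {u} → Unit u → Coprime (+ p) u
  ℙ-unit cu (e∣p , e∣u) = cu (ℕ.∣-trans e∣p p∣pˢ , e∣u)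

  -- Modulo pˢ⁺¹ the ratio of two units is plus or minus a power of l, and the congruence modulo p
  -- rules out the minus sign. The exponent may change.
  lift-ratio : ∀ {u w r} → Unit u → Unit w → u ℙ.≈ w ℤ.* L ℤ.^ r → ∃ λ k → u ℙˢ.≈ w ℤ.* L ℤ.^ k
  lift-ratio {u} {w} {r} cu cw eq = positive (unit-ratio {u} {w} cu cw)
    where
    positive : (∃ λ k → u ℙˢ.≈ w ℤ.* L ℤ.^ k ⊎ u ℙˢ.≈ w ℤ.* (ℤ.- (L ℤ.^ k))) → ∃ λ k → u ℙˢ.≈ w ℤ.* L ℤ.^ k
    positive (k , inj₁ eq′) = k , eq′
    positive (k , inj₂ eq′) = ⊥-elim (l^a≉-l^b r k
        (ℙ.cancelˡ {w} (ℙ-unit {w} cw) (ℙ.≈-trans (ℙ.≈-sym eq) (ℙˢ.weaken p∣pˢ eq′))))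

  ratio-sym : ∀ {u w} r → u ℙ.≈ w ℤ.* L ℤ.^ r → ∃ λ k → w ℙ.≈ u ℤ.* L ℤ.^ k
  -- This exponent gives the inverse of lʳ, because r + r (d - 1) = d r.
  ratio-sym {u} {w} r eq = r ℕ.* (d ℕ.∸ 1) , ℙ.≈-sym (begin
    u ℤ.* L ℤ.^ (r ℕ.* (d ℕ.∸ 1))                        ≈⟨ ℙ.*-congʳ _ eq ⟩
    w ℤ.* L ℤ.^ r ℤ.* L ℤ.^ (r ℕ.* (d ℕ.∸ 1))            ≡⟨ ℤ.*-assoc w _ _ ⟩
    w ℤ.* (L ℤ.^ r ℤ.* L ℤ.^ (r ℕ.* (d ℕ.∸ 1)))          ≡⟨ cong (w ℤ.*_) (ℤ.^-distribˡ-+-* L r _) ⟨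
    w ℤ.* L ℤ.^ (r ℕ.+ r ℕ.* (d ℕ.∸ 1))                  ≡⟨ cong (λ x → w ℤ.* L ℤ.^ x) exponent ⟩
    w ℤ.* L ℤ.^ (d ℕ.* r)                                ≈⟨ ℙ.*-congˡ w (l^dk≈1 r) ⟩
    w ℤ.* + 1                                            ≡⟨ ℤ.*-identityʳ w ⟩
    w                                                    ∎)
    where
    open ℙ.Reasoning
    exponent : r ℕ.+ r ℕ.* (d ℕ.∸ 1) ≡ d ℕ.* r
    exponent = ≡.trans (≡.sym (ℕ.*-suc r (d ℕ.∸ 1)))
        (≡.trans (cong (r ℕ.*_) (ℕ.suc-pred d {{d≢0}})) (ℕ.*-comm r d))

  -- For d = 2m + 1 the square of l^(r (m + 1)) is l^(r + d r), hence lʳ.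
  square-of-power : ∀ r → ∃ λ x → x ℤ.^ 2 ℙ.≈ L ℤ.^ r
  square-of-power r = root (odd⇒ d-odd)
    where
    open ℕSolver.+-*-Solver
    root : (∃ λ m → d ≡ suc (m ℕ.* 2)) → ∃ λ x → x ℤ.^ 2 ℙ.≈ L ℤ.^ r
    root (m , eq) = L ℤ.^ (r ℕ.* suc m) , subst (ℙ._≈ L ℤ.^ r) (≡.sym (ℤ.^-*-assoc L (r ℕ.* suc m) 2))
      (ℙˢ.weaken p∣pˢ (^-mod (r ℕ.* suc m ℕ.* 2) r r (≡.trans
        (solve 2 (λ r m → r :* (con 1 :+ m) :* con 2 := r :+ (con 1 :+ m :* con 2) :* r) ≡.refl r m)
            (cong (λ x → r ℕ.+ x ℕ.* r) (≡.sym eq)))))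

  unit-power : ∀ {u} → Unit u → ∃ λ k → u ℙ.≈ L ℤ.^ k ⊎ u ℙ.≈ ℤ.- (L ℤ.^ k)
  unit-power {u} cu = reduce (unit-ratio {u} {+ 1} cu (ℕ.sym (ℕ.1-coprimeTo (p ^ suc s))))
    where
    reduce : (∃ λ k → u ℙˢ.≈ + 1 ℤ.* L ℤ.^ k ⊎ u ℙˢ.≈ + 1 ℤ.* (ℤ.- (L ℤ.^ k))) → ∃ λ k →
        u ℙ.≈ L ℤ.^ k ⊎ u ℙ.≈ ℤ.- (L ℤ.^ k)
    reduce (k , inj₁ eq) = k , inj₁ (subst (u ℙ.≈_) (ℤ.*-identityˡ _) (ℙˢ.weaken p∣pˢ eq))
    reduce (k , inj₂ eq) = k , inj₂ (subst (u ℙ.≈_) (ℤ.*-identityˡ _) (ℙˢ.weaken p∣pˢ eq))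

  ∣-resp-≈ : ∀ {a b} → a ℙ.≈ b → p ∣ ℤ.∣ a ∣ → p ∣ ℤ.∣ b ∣
  ∣-resp-≈ {a} {b} (mod a≡b) p∣a = ℤ.∣⇒∣ᵤ {+ p} {b} (subst (+ p ∣ᶻ_)
    (solve 2 (λ a b → a :- (a :- b) := b) ≡.refl a b)
    (ℤ.∣m∣n⇒∣m-n {+ p} {a} {a ℤ.- b} (ℤ.∣ᵤ⇒∣ {+ p} {a} p∣a) a≡b))
    where open ℤSolver.+-*-Solver

  square-root-unit : ∀ {a x} → Unit a → x ℤ.^ 2 ℙ.≈ a → Unit x
  square-root-unit {a} {x} ca x²≈a = ∤⇒unit {x} λ p∣x → coprime⇒∤ s pp ca (∣-resp-≈ x²≈a
    (subst (p ∣_) (≡.sym (ℤ.abs-* x (x ℤ.^ 1))) (ℕ.∣m⇒∣m*n ℤ.∣ x ℤ.^ 1 ∣ p∣x)))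

  -- The root x is itself plus or minus a power of l, and squaring removes the sign.
  square≉-power : ∀ {a x} → Unit a → x ℤ.^ 2 ℙ.≈ a → ∀ k → ¬ a ℙ.≈ ℤ.- (L ℤ.^ k)
  square≉-power {a} {x} ca x²≈a k eq = impossible (unit-power {x} (square-root-unit {a} {x} ca x²≈a))
    where
    open ℙ.Reasoning
    impossible : ¬ ∃ λ r → x ℙ.≈ L ℤ.^ r ⊎ x ℙ.≈ ℤ.- (L ℤ.^ r)
    impossible (r , inj₁ e) = l^a≉-l^b (r ℕ.* 2) k (begin
      L ℤ.^ (r ℕ.* 2)         ≡⟨ ℤ.^-*-assoc L r 2 ⟨
      (L ℤ.^ r) ℤ.^ 2         ≈⟨ ℙ.^-cong e 2 ⟨
      x ℤ.^ 2                 ≈⟨ x²≈a ⟩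
      a                       ≈⟨ eq ⟩
      ℤ.- (L ℤ.^ k)           ∎)
    impossible (r , inj₂ e) = l^a≉-l^b (r ℕ.* 2) k (begin
      L ℤ.^ (r ℕ.* 2)         ≡⟨ ℤ.^-*-assoc L r 2 ⟨
      (L ℤ.^ r) ℤ.^ 2         ≡⟨ ^-even (L ℤ.^ r) 1 ⟨
      (ℤ.- (L ℤ.^ r)) ℤ.^ 2   ≈⟨ ℙ.^-cong e 2 ⟨
      x ℤ.^ 2                 ≈⟨ x²≈a ⟩
      a                       ≈⟨ eq ⟩
      ℤ.- (L ℤ.^ k)           ∎)

  residue⇒power : ∀ {a} → QuadraticResidue p a → ∃ λ k → a ℙ.≈ L ℤ.^ k
  residue⇒power {a} (p∤a , x , x²≡a) = positive (unit-power {a} ca)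
    where
    ca : Unit a
    ca = ∤⇒unit {a} (p∤a ∘ ℤ.∣ᵤ⇒∣)
    positive : (∃ λ k → a ℙ.≈ L ℤ.^ k ⊎ a ℙ.≈ ℤ.- (L ℤ.^ k)) → ∃ λ k → a ℙ.≈ L ℤ.^ k
    positive (k , inj₁ eq) = k , eq
    positive (k , inj₂ eq) = ⊥-elim (square≉-power {a} {x} ca (mod x²≡a) k eq)

  -- Every power of l is a square, so a nonsquare unit must carry the minus sign.
  nonresidue⇒-power : ∀ {a} → QuadraticNonresidue p a → ∃ λ k → a ℙ.≈ ℤ.- (L ℤ.^ k)
  nonresidue⇒-power {a} (p∤a , nonsquare) = negative (unit-power {a} (∤⇒unit {a} (p∤a ∘ ℤ.∣ᵤ⇒∣)))
    where
    negative : (∃ λ k → a ℙ.≈ L ℤ.^ k ⊎ a ℙ.≈ ℤ.- (L ℤ.^ k)) → ∃ λ k → a ℙ.≈ ℤ.- (L ℤ.^ k)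
    negative (k , inj₂ eq) = k , eq
    negative (k , inj₁ eq) = ⊥-elim (nonsquare
        (proj₁ (square-of-power k) , divisible (ℙ.≈-trans (proj₂ (square-of-power k)) (ℙ.≈-sym eq))))

  -- If g were a power of l, then gᵈ ≡ 1, too early for an element of order 2d.
  primitiveRoot⇒-power : ∀ {g} → PrimitiveRoot (p ^ suc s) g → ∃ λ k → g ℙ.≈ ℤ.- (L ℤ.^ k)
  primitiveRoot⇒-power {g} prim = negative (unit-ratio {g} {+ 1} (Order.coprime prim)
      (ℕ.sym (ℕ.1-coprimeTo (p ^ suc s))))
    where
    d<φ : d ℕ.< φ (p ^ suc s)
    d<φ = subst (d ℕ.<_) (≡.sym φ≡d*2) (ℕ.m<m*n d 2 {{d≢0}} ℕ.≤-refl)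
    open ℙˢ.Reasoning
    g^d≈1 : ∀ k → g ℙˢ.≈ + 1 ℤ.* L ℤ.^ k → g ℤ.^ d ℙˢ.≈ + 1
    g^d≈1 k eq = begin
      g ℤ.^ d                        ≈⟨ ℙˢ.^-cong eq d ⟩
      (+ 1 ℤ.* L ℤ.^ k) ℤ.^ d        ≡⟨ cong (ℤ._^ d) (ℤ.*-identityˡ (L ℤ.^ k)) ⟩
      (L ℤ.^ k) ℤ.^ d                ≡⟨ ≡.trans (ℤ.^-*-assoc L k d) (cong (L ℤ.^_) (ℕ.*-comm k d)) ⟩
      L ℤ.^ (d ℕ.* k)                ≈⟨ ^-multiple k ⟩
      + 1                            ∎
    negative : (∃ λ k → g ℙˢ.≈ + 1 ℤ.* L ℤ.^ k ⊎ g ℙˢ.≈ + 1 ℤ.* (ℤ.- (L ℤ.^ k))) → ∃ λ k → g ℙ.≈ ℤ.- (L ℤ.^ k)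
    negative (k , inj₂ eq) = k , subst (g ℙ.≈_) (ℤ.*-identityˡ _) (ℙˢ.weaken p∣pˢ eq)
    negative (k , inj₁ eq) = ⊥-elim (ℕ.<⇒≱ d<φ
        (HasOrder.least prim d (HasOrder.positive ord) (divisible (g^d≈1 k eq))))

-- Common exponents for coprime orders, and the classes at p.

∣-respˡ-≈ : ∀ {m e a b} → e ∣ m → Congruent m a b → + e ∣ᶻ b → + e ∣ᶻ a
∣-respˡ-≈ {m} {e} {a} {b} e∣m (mod p) e∣b = subst (+ e ∣ᶻ_) (solve 2 (λ a b → (a :- b) :+ b := a) ≡.refl a b)
  (ℤ.∣m∣n⇒∣m+n {+ e} {a ℤ.- b} {b} (ℤ.∣-trans (ℤ.∣ᵤ⇒∣ {+ e} {+ m} e∣m) p) e∣b)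
  where open ℤSolver.+-*-Solver

coprime-∣-* : ∀ {a b m} → ℕ.Coprime a b → a ∣ m → b ∣ m → a ℕ.* b ∣ m
coprime-∣-* {a} {b} cop (ℕ.divides k ≡.refl) b∣ka = subst (_∣ k ℕ.* a) (ℕ.*-comm b a)
  (ℕ.*-monoˡ-∣ a (ℕ.coprime-divisor (ℕ.sym cop) (subst (b ∣_) (ℕ.*-comm k a) b∣ka)))

common-exponent : ∀ {m n d d′ ρ} → HasOrder m ρ d → HasOrder n ρ d′ → ℕ.Coprime d′ d →
                  ∀ r₁ r₂ → ∃ λ r → Congruent m (ρ ℤ.^ r) (ρ ℤ.^ r₁) × Congruent n (ρ ℤ.^ r) (ρ ℤ.^ r₂)
common-exponent {m} {n} {d} {d′} {ρ} om on cop r₁ r₂ = solution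
    (coprime⇒minus-one {d′} {d} {{Order.d≢0 on}} cop)
  where
  e = d′ ℕ.∸ 1
  1+e≡d′ : suc e ≡ d′
  1+e≡d′ = ℕ.suc-pred d′ {{Order.d≢0 on}}
  solution : (∃ λ y → d′ ∣ 1 ℕ.+ y ℕ.* d) → ∃ λ r →
      Congruent m (ρ ℤ.^ r) (ρ ℤ.^ r₁) × Congruent n (ρ ℤ.^ r) (ρ ℤ.^ r₂)
  solution (y , ℕ.divides z eq) = r , Order.^-mod om r r₁ k ≡.refl ,
      Mod.≈-trans n (Mod.≈-sym n (Order.^-mod on (r ℕ.+ d′ ℕ.* r₂) r r₂ ≡.refl))
          (Order.^-mod on (r ℕ.+ d′ ℕ.* r₂) r₂ (z ℕ.* c) exponent)
    where
    open ≡-Reasoning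
    open ℕSolver.+-*-Solver
    -- Both e and y d are - 1 modulo d′, so c ≡ r₁ - r₂ and d k ≡ - c. Hence r ≡ r₂ modulo d′, while
    -- r ≡ r₁ modulo d by construction.
    c = r₁ ℕ.+ e ℕ.* r₂
    k = y ℕ.* c
    r = r₁ ℕ.+ d ℕ.* k
    exponent : r ℕ.+ d′ ℕ.* r₂ ≡ r₂ ℕ.+ d′ ℕ.* (z ℕ.* c)
    exponent = begin
      r₁ ℕ.+ d ℕ.* (y ℕ.* c) ℕ.+ d′ ℕ.* r₂
        ≡⟨ cong (λ x → r₁ ℕ.+ d ℕ.* (y ℕ.* c) ℕ.+ x ℕ.* r₂) 1+e≡d′ ⟨
      r₁ ℕ.+ d ℕ.* (y ℕ.* c) ℕ.+ (1 ℕ.+ e) ℕ.* r₂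
        ≡⟨ solve 5 (λ r₁ r₂ e d y → r₁ :+ d :* (y :* (r₁ :+ e :* r₂)) :+ (con 1 :+ e) :* r₂ := r₂
           :+ (con 1 :+ y :* d) :* (r₁ :+ e :* r₂)) ≡.refl r₁ r₂ e d y ⟩
      r₂ ℕ.+ (1 ℕ.+ y ℕ.* d) ℕ.* c                           ≡⟨ cong (λ x → r₂ ℕ.+ x ℕ.* c) eq ⟩
      r₂ ℕ.+ (z ℕ.* d′) ℕ.* c
        ≡⟨ solve 4 (λ r₂ z d c → r₂ :+ (z :* d) :* c := r₂ :+ d :* (z :* c)) ≡.refl r₂ z d′ c ⟩
      r₂ ℕ.+ d′ ℕ.* (z ℕ.* c)                                ∎

module Classes {p l d : ℕ} (s : ℕ) (pp : Prime p) (2<p : 2 ℕ.< p)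
  (ord : HasOrder (p ^ suc s) (+ l) d) (φ≡d*2 : φ (p ^ suc s) ≡ d ℕ.* 2) (d-odd : ¬ 2 ∣ d) where

  open HalfOrder s pp 2<p ord φ≡d*2 d-odd public
  private
    L = + l
    instance
      p≢0 : NonZero p
      p≢0 = prime⇒nonZero pp

  -- α / pⁱ ∈ w ⟨l⟩. The modulus pⁱ⁺¹ is enough since ⟨l⟩ contains every unit that is 1 modulo p.
  record Class (i : ℕ) (w : ℤ) (α : ℕ) : Set where
    constructor class
    field
      exponent  : ℕ
      congruent : Congruent (p ^ i ℕ.* p) (+ α) (+ (p ^ i) ℤ.* (w ℤ.* L ℤ.^ exponent))

  Class-ratio : ∀ i {w w′} → (∃ λ r → w ℙ.≈ w′ ℤ.* L ℤ.^ r) → ∀ {α} → Class i w α → Class i w′ α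
  Class-ratio i {w} {w′} (r , eq) {α} (class k eq′) = class (r ℕ.+ k)
      (M.≈-trans eq′ (Mod.scale p (p ^ i) (begin
    w ℤ.* L ℤ.^ k                        ≈⟨ ℙ.*-congʳ (L ℤ.^ k) eq ⟩
    w′ ℤ.* L ℤ.^ r ℤ.* L ℤ.^ k           ≡⟨ ℤ.*-assoc w′ _ _ ⟩
    w′ ℤ.* (L ℤ.^ r ℤ.* L ℤ.^ k)         ≡⟨ cong (w′ ℤ.*_) (ℤ.^-distribˡ-+-* L r k) ⟨
    w′ ℤ.* L ℤ.^ (r ℕ.+ k)               ∎)))
    where
    module M = Mod (p ^ i ℕ.* p)
    open ℙ.Reasoning

  Class-⇔ : ∀ i {w w′} → (∃ λ r → w ℙ.≈ w′ ℤ.* L ℤ.^ r) → ∀ α → Class i w α ⇔ Class i w′ α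
  Class-⇔ i {w} {w′} ratio@(r , eq) α = mk⇔ (Class-ratio i ratio) (Class-ratio i (ratio-sym {w} {w′} r eq))

  abstract
    -- Powers of l repeat with period d, so the search stops at exponents below d.
    Class? : ∀ i w → Decidable (Class i w)
    Class? i w α = map′ (λ (r , eq) → class (toℕ r) (mod eq)) reduce
      (Fin.any? {n = d} (λ r → + (p ^ i ℕ.* p) ℤ.∣? (+ α ℤ.- + (p ^ i) ℤ.* (w ℤ.* L ℤ.^ toℕ r))))
      where
      reduce : Class i w α → ∃ λ (r : Fin d) → + α ≡ + (p ^ i) ℤ.* (w ℤ.* L ℤ.^ toℕ r) [mod p ^ i ℕ.* p ]
      reduce (class k eq) = r , divisible (Mod.≈-trans _ eq
          (Mod.scale p (p ^ i) (ℙ.*-congˡ w (ℙˢ.weaken p∣pˢ (^-mod k (toℕ r) (_/_ k d {{d≢0}}) k≡)))))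
        where
        r : Fin d
        r = fromℕ< (ℕ.m%n<n k d {{d≢0}})
        k≡ : k ≡ toℕ r ℕ.+ d ℕ.* _/_ k d {{d≢0}}
        k≡ = ≡.trans (ℕ.m≡m%n+[m/n]*n k d {{d≢0}})
            (cong₂ ℕ._+_ (≡.sym (Fin.toℕ-fromℕ< _)) (ℕ.*-comm (_/_ k d {{d≢0}}) d))

  Class-∣ : ∀ {i w α} → Class i w α → p ^ i ∣ α
  Class-∣ {i} {w} {α} (class r eq) = ℤ.∣⇒∣ᵤ {+ (p ^ i)} {+ α}
      (∣-respˡ-≈ (ℕ.m∣m*n p) eq (ℤ.∣m⇒∣m*n {+ (p ^ i)} {+ (p ^ i)} (w ℤ.* L ℤ.^ r) ℤ.∣-refl))

  Class-shift : ∀ {i w β} → p ^ i ℕ.* p ∣ β → ∀ α → Class i w (α ℕ.+ β) ⇔ Class i w α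
  Class-shift {i} {w} {β} M∣β α = mk⇔
    (λ (class r eq) → class r (M.≈-trans (M.≈-sym α+β≈α) eq))
    (λ (class r eq) → class r (M.≈-trans α+β≈α eq))
    where
    module M = Mod (p ^ i ℕ.* p)
    open ℤSolver.+-*-Solver
    α+β≈α : + (α ℕ.+ β) M.≈ + α
    α+β≈α = mod (subst (+ (p ^ i ℕ.* p) ∣ᶻ_) (solve 2 (λ a b → b := (a :+ b) :- a) ≡.refl (+ α) (+ β))
        (ℤ.∣ᵤ⇒∣ {+ (p ^ i ℕ.* p)} {+ β} M∣β))

  Class-periodic : ∀ {i w} → i ℕ.≤ s → Periodic (p ^ suc s) (Class i w)
  Class-periodic {i} i≤s = Class-shift (subst (_∣ p ^ suc s) (ℕ.*-comm p (p ^ i)) (^-monoʳ-∣ p (ℕ.s≤s i≤s)))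

  -- Here i < i′ enters: β is a multiple of pⁱ′, hence of pⁱ⁺¹, the modulus that defines `Class i`.
  Class-invariant : ∀ {i i′ w w′} → i ℕ.< i′ → ∀ α β → Class i′ w′ β → Class i w (α ℕ.+ β) ⇔ Class i w α
  Class-invariant {i} {i′} i<i′ α β Cβ = Class-shift
      (ℕ.∣-trans (subst (_∣ p ^ i′) (ℕ.*-comm p (p ^ i)) (^-monoʳ-∣ p i<i′)) (Class-∣ Cβ)) α

  unit-* : ∀ {u w} → Unit u → Unit w → Unit (u ℤ.* w)
  unit-* {u} {w} = coprime-ℤ* u w

  unit-L^ : ∀ r → Unit (L ℤ.^ r)
  unit-L^ = coprime-^ L l-coprime

  unit-≈ : ∀ {u w} → u ℙ.≈ w → Unit w → Unit u
  unit-≈ {u} {w} eq cw = ∤⇒unit {u} λ p∣u → coprime⇒∤ s pp cw (∣-resp-≈ eq p∣u)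

  +[u*pⁱ] : ∀ u i → + (u ℕ.* p ^ i) ≡ + (p ^ i) ℤ.* + u
  +[u*pⁱ] u i = ≡.trans (ℤ.pos-* u (p ^ i)) (ℤ.*-comm (+ u) (+ (p ^ i)))

  Class⇔ratio : ∀ i {w} u → Class i w (u ℕ.* p ^ i) ⇔ (∃ λ r → + u ℙ.≈ w ℤ.* L ℤ.^ r)
  Class⇔ratio i {w} u = mk⇔
    (λ (class r eq) → r , Mod.unscale p (p ^ i) {{ℕ.m^n≢0 p i}}
        (subst (λ x → Congruent (p ^ i ℕ.* p) x (+ (p ^ i) ℤ.* (w ℤ.* L ℤ.^ r))) (+[u*pⁱ] u i) eq))
    (λ (r , eq) → class r (subst (λ x → Congruent (p ^ i ℕ.* p) x (+ (p ^ i) ℤ.* (w ℤ.* L ℤ.^ r)))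
        (≡.sym (+[u*pⁱ] u i)) (Mod.scale p (p ^ i) eq)))

  Class-∤ : ∀ {i w} u → Unit w → Class i w (u ℕ.* p ^ i) → ¬ p ∣ u
  Class-∤ {i} {w} u cw c = coprime⇒∤ s pp (unit-≈ {+ u} {w ℤ.* L ℤ.^ r} (proj₂ ratio)
      (unit-* {w} {L ℤ.^ r} cw (unit-L^ r)))
    where
    ratio = to (Class⇔ratio i {w} u) c
    r = proj₁ ratio

-- Cyclotomic cosets as classes at p with an exact power of q.

distinct-primes-∤ : ∀ {p q} → Prime p → Prime q → p ≢ q → ¬ p ∣ q
distinct-primes-∤ pp pq p≢q p∣q with prime⇒irreducible pq p∣q
... | inj₁ ≡.refl = Prime.¬prime[1] pp
... | inj₂ p≡q  = p≢q p≡q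

coprime-powers : ∀ {p q} → Prime p → Prime q → p ≢ q → ∀ a b → ℕ.Coprime (p ^ a) (q ^ b)
coprime-powers {p} {q} pp pq p≢q a b = powers b
  where
  powers : ∀ b → ℕ.Coprime (p ^ a) (q ^ b)
  powers zero    = ℕ.sym (ℕ.1-coprimeTo (p ^ a))
  powers (suc b) = coprime-* (prime⇒coprime-^ pp (distinct-primes-∤ pp pq p≢q) a) (powers b)

module Cosets {p q l d : ℕ} (s t : ℕ) (pp : Prime p) (pq : Prime q) (p≢q : p ≢ q) (2<p : 2 ℕ.< p)
  (ord : HasOrder (p ^ suc s) (+ l) d) (φ≡d*2 : φ (p ^ suc s) ≡ d ℕ.* 2) (d-odd : ¬ 2 ∣ d)
  (prim : PrimitiveRoot (q ^ suc t) (+ l)) (d⊥φ : ℕ.Coprime (φ (q ^ suc t)) d)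
  where

  open Classes s pp 2<p ord φ≡d*2 d-odd
  module ℚᵗ = Mod (q ^ suc t)
  private
    L = + l
    n = p ^ suc s ℕ.* q ^ suc t
    instance
      p≢0 : NonZero p
      p≢0 = prime⇒nonZero pp
      q≢0 : NonZero q
      q≢0 = prime⇒nonZero pq

  Unit′ : ℤ → Set
  Unit′ = Coprime (+ (q ^ suc t))

  qᵐ-unit : ∀ m → Unit (+ (q ^ m))
  qᵐ-unit m = coprime-powers pp pq p≢q (suc s) m

  pⁱ-unit′ : ∀ i → Unit′ (+ (p ^ i))
  pⁱ-unit′ i = coprime-powers pq pp (p≢q ∘ ≡.sym) (suc t) i

  generator : ∀ i m w r → (+ (p ^ i ℕ.* q ^ m) ℤ.* w) ℤ.* L ℤ.^ r ≡ + (p ^ i)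
      ℤ.* (+ (q ^ m) ℤ.* w ℤ.* L ℤ.^ r)
  generator i m w r = ≡.trans (cong (λ x → x ℤ.* w ℤ.* L ℤ.^ r) (ℤ.pos-* (p ^ i) (q ^ m)))
    (solve 4 (λ P Q w x → P :* Q :* w :* x := P :* (Q :* w :* x)) ≡.refl (+ (p ^ i)) (+ (q ^ m)) w (L ℤ.^ r))
    where open ℤSolver.+-*-Solver

  pᵢp∣n : ∀ {i} → i ℕ.≤ s → p ^ i ℕ.* p ∣ n
  pᵢp∣n {i} i≤s = ℕ.∣m⇒∣m*n (q ^ suc t) (subst (_∣ p ^ suc s) (ℕ.*-comm p (p ^ i)) (^-monoʳ-∣ p (ℕ.s≤s i≤s)))

  qᵐ∣n : ∀ {m} → m ℕ.≤ suc t → q ^ m ∣ n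
  qᵐ∣n m≤t = ℕ.∣n⇒∣m*n (p ^ suc s) (^-monoʳ-∣ q m≤t)

  coset⇒ : ∀ {i m w} → i ℕ.≤ s → m ℕ.≤ suc t → Unit′ w → ∀ α r →
           Congruent n (+ α) ((+ (p ^ i ℕ.* q ^ m) ℤ.* w) ℤ.* L ℤ.^ r) →
           Class i (+ (q ^ m) ℤ.* w) α × Exactly q (suc t) m α
  coset⇒ {i} {m} {w} i≤s m≤t cw α r eq =
      class r (Mod.weaken n (pᵢp∣n i≤s) eq′) ,
      ℤ.∣⇒∣ᵤ {+ (q ^ m)} {+ α} (∣-respˡ-≈ (qᵐ∣n m≤t) eq″ (ℤ.∣m⇒∣m*n {+ (q ^ m)} {+ (q ^ m)} v ℤ.∣-refl)) ,
      not-more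
    where
    v = + (p ^ i) ℤ.* (w ℤ.* L ℤ.^ r)
    cv : Unit′ v
    cv = coprime-ℤ* (+ (p ^ i)) (w ℤ.* L ℤ.^ r) (pⁱ-unit′ i)
        (coprime-ℤ* w (L ℤ.^ r) cw (coprime-^ L (Order.coprime prim) r))
    eq′ : Congruent n (+ α) (+ (p ^ i) ℤ.* (+ (q ^ m) ℤ.* w ℤ.* L ℤ.^ r))
    eq′ = subst (Congruent n (+ α)) (generator i m w r) eq
    eq″ : Congruent n (+ α) (+ (q ^ m) ℤ.* v)
    eq″ = subst (Congruent n (+ α)) (solve 4 (λ P Q w x → P :* (Q :* w :* x) := Q :* (P :* (w :* x))) ≡.refl
        (+ (p ^ i)) (+ (q ^ m)) w (L ℤ.^ r)) eq′
      where open ℤSolver.+-*-Solver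
    -- Below the top level qᵐ⁺¹ still divides n, so qᵐ⁺¹ ∣ α would force q ∣ v, although v is a unit
    -- at q.
    not-more : m ℕ.< suc t → ¬ q ^ suc m ∣ α
    not-more m<t qᵐ⁺¹∣α = coprime⇒∤ t pq cv (ℕ.*-cancelˡ-∣ (q ^ m) {{ℕ.m^n≢0 q m}}
        (subst₂ _∣_ (ℕ.*-comm q (q ^ m)) (ℤ.abs-* (+ (q ^ m)) v)
      (ℤ.∣⇒∣ᵤ {+ (q ^ suc m)} {+ (q ^ m) ℤ.* v}
          (∣-respˡ-≈ (qᵐ∣n m<t) (Mod.≈-sym n eq″) (ℤ.∣ᵤ⇒∣ {+ (q ^ suc m)} {+ α} qᵐ⁺¹∣α)))))

  -- The common factor qᵐ relaxes the congruence modulo qᵗ: when m = t it is void, otherwise it and the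
  -- one modulo pˢ are met by a common exponent because the orders of l are coprime.
  coset⇐ : ∀ {i m w} → m ℕ.≤ suc t → Unit w → Unit′ w → ∀ u →
           Class i (+ (q ^ m) ℤ.* w) (u ℕ.* q ^ m ℕ.* p ^ i) → (m ℕ.< suc t → ¬ q ∣ u) →
           ∃ λ r → Congruent n (+ (u ℕ.* q ^ m ℕ.* p ^ i)) ((+ (p ^ i ℕ.* q ^ m) ℤ.* w) ℤ.* L ℤ.^ r)
  coset⇐ {i} {m} {w} m≤t cw cw′ u c q∤u = lifted (lift-ratio {+ u} {w} {r₀} cu cw u≈)
    where
    ratio = to (Class⇔ratio i {+ (q ^ m) ℤ.* w} (u ℕ.* q ^ m)) c
    r₀ = proj₁ ratio
    u≈ : + u ℙ.≈ w ℤ.* L ℤ.^ r₀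
    u≈ = ℙ.cancelˡ {+ (q ^ m)} (ℙ-unit {+ (q ^ m)} (qᵐ-unit m))
        (subst₂ ℙ._≈_ (+[u*qᵐ]) (ℤ.*-assoc (+ (q ^ m)) w (L ℤ.^ r₀)) (proj₂ ratio))
      where
      +[u*qᵐ] : + (u ℕ.* q ^ m) ≡ + (q ^ m) ℤ.* + u
      +[u*qᵐ] = ≡.trans (ℤ.pos-* u (q ^ m)) (ℤ.*-comm (+ u) (+ (q ^ m)))
    cu : Unit (+ u)
    cu = unit-≈ {+ u} {w ℤ.* L ℤ.^ r₀} u≈ (unit-* {w} {L ℤ.^ r₀} cw (unit-L^ r₀))

    Goal = ∃ λ r → Congruent n (+ (u ℕ.* q ^ m ℕ.* p ^ i)) ((+ (p ^ i ℕ.* q ^ m) ℤ.* w) ℤ.* L ℤ.^ r)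

    rescale : ∀ r → Congruent n (+ (q ^ m) ℤ.* + u) (+ (q ^ m) ℤ.* (w ℤ.* L ℤ.^ r)) → Goal
    rescale r eq = r , subst₂ (Congruent n) left
        (≡.trans (cong (+ (p ^ i) ℤ.*_) (≡.sym (ℤ.*-assoc (+ (q ^ m)) w (L ℤ.^ r))))
        (≡.sym (generator i m w r)))
      (Mod.*-congˡ n (+ (p ^ i)) eq)
      where
      left : + (p ^ i) ℤ.* (+ (q ^ m) ℤ.* + u) ≡ + (u ℕ.* q ^ m ℕ.* p ^ i)
      left = ≡.trans (cong (+ (p ^ i) ℤ.*_) (≡.sym (ℤ.pos-* (q ^ m) u)))
          (≡.trans (≡.sym (ℤ.pos-* (p ^ i) (q ^ m ℕ.* u)))
        (cong +_ (solve 3 (λ P Q u → P :* (Q :* u) := u :* Q :* P) ≡.refl (p ^ i) (q ^ m) u)))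
        where open ℕSolver.+-*-Solver

    lifted : (∃ λ r → + u ℙˢ.≈ w ℤ.* L ℤ.^ r) → Goal
    lifted (r₁ , eq₁) = [ below , top ]′ (ℕ.m≤n⇒m<n∨m≡n m≤t)
      where
      top : m ≡ suc t → Goal
      top ≡.refl = rescale r₁ (subst (λ N → Congruent N (+ (q ^ m) ℤ.* + u) (+ (q ^ m) ℤ.* (w ℤ.* L ℤ.^ r₁)))
          (ℕ.*-comm (q ^ m) (p ^ suc s)) (ℙˢ.scale (q ^ m) eq₁))
      below : m ℕ.< suc t → Goal
      below m<t = combine (primitiveRoot-transitive (q ^ suc t) {{ℕ.m^n≢0 q (suc t)}} prim {+ u} {w}
          (prime⇒coprime-^ pq (q∤u m<t) (suc t)) cw′)
        where
        combine : (∃ λ r → + u ℚᵗ.≈ w ℤ.* L ℤ.^ r) → Goal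
        combine (r₂ , eq₂) = joint (common-exponent ord prim d⊥φ r₁ r₂)
          where
          joint : (∃ λ r → L ℤ.^ r ℙˢ.≈ L ℤ.^ r₁ × L ℤ.^ r ℚᵗ.≈ L ℤ.^ r₂) → Goal
          joint (r , e₁ , e₂) = rescale r (Mod.*-congˡ n (+ (q ^ m))
              (crt (coprime-powers pp pq p≢q (suc s) (suc t))
            (ℙˢ.≈-trans eq₁ (ℙˢ.*-congˡ w (ℙˢ.≈-sym e₁))) (ℚᵗ.≈-trans eq₂ (ℚᵗ.*-congˡ w (ℚᵗ.≈-sym e₂)))))

  coset⇔ : ∀ {i m w} → i ℕ.≤ s → m ℕ.≤ suc t → Unit w → Unit′ w → ∀ (α : Fin n) →
           InCoset n l (+ (p ^ i ℕ.* q ^ m) ℤ.* w)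
               α ⇔ (Class i (+ (q ^ m) ℤ.* w) (toℕ α) × Exactly q (suc t) m (toℕ α))
  coset⇔ {i} {m} {w} i≤s m≤t cw cw′ α = mk⇔ (λ (r , eq) → coset⇒ i≤s m≤t cw′ (toℕ α) r (mod eq)) converse
    where
    converse : Class i (+ (q ^ m) ℤ.* w) (toℕ α) × Exactly q (suc t) m (toℕ α) →
        InCoset n l (+ (p ^ i ℕ.* q ^ m) ℤ.* w) α
    converse (c , qᵐ∣α , exact) = factored (coprime-∣-* (coprime-powers pq pp (p≢q ∘ ≡.sym) m i) qᵐ∣α
        (Class-∣ c))
      where
      factored : q ^ m ℕ.* p ^ i ∣ toℕ α → InCoset n l (+ (p ^ i ℕ.* q ^ m) ℤ.* w) α
      factored (ℕ.divides u eq) = proj₁ solution , subst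
          (λ x → + x ≡ (+ (p ^ i ℕ.* q ^ m) ℤ.* w) ℤ.* L ℤ.^ proj₁ solution [mod n ]) (≡.sym α≡)
          (divisible (proj₂ solution))
        where
        α≡ : toℕ α ≡ u ℕ.* q ^ m ℕ.* p ^ i
        α≡ = ≡.trans eq (≡.sym (ℕ.*-assoc u (q ^ m) (p ^ i)))
        q∤u : m ℕ.< suc t → ¬ q ∣ u
        q∤u m<t q∣u = exact m<t (subst (q ^ suc m ∣_) (≡.sym α≡)
            (ℕ.∣m⇒∣m*n (p ^ i) (ℕ.*-monoˡ-∣ (q ^ m) q∣u)))
        solution = coset⇐ m≤t cw cw′ u (subst (Class i (+ (q ^ m) ℤ.* w)) α≡ c) q∤u


-- The number of multiples of the full power of q in a class.

module ClassCounts {p q l d : ℕ} (s t : ℕ) (pp : Prime p) (pq : Prime q) (p≢q : p ≢ q) (2<p : 2 ℕ.< p)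
  (ord : HasOrder (p ^ suc s) (+ l) d) (φ≡d*2 : φ (p ^ suc s) ≡ d ℕ.* 2) (d-odd : ¬ 2 ∣ d)
  where

  open RangeSums ℕ.+-*-commutativeSemiring
  open Classes s pp 2<p ord φ≡d*2 d-odd
  private
    L = + l
    n = p ^ suc s ℕ.* q ^ suc t
    Q = q ^ suc t
    instance
      p≢0 : NonZero p
      p≢0 = prime⇒nonZero pp
      q≢0 : NonZero q
      q≢0 = prime⇒nonZero pq

  multiple? : ∀ i w → Decidable (λ α → Class i w α × Q ∣ α)
  multiple? i w α = Class? i w α ×-dec Q ∣? α

  unit-neg : ∀ {w} → Unit w → Unit (ℤ.- w)
  unit-neg {w} cw = subst (ℕ.Coprime (p ^ suc s)) (≡.sym (ℤ.∣-i∣≡∣i∣ w)) cw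

  negate-class : ∀ {i w} → i ℕ.≤ s → ∀ {α} → α ℕ.≤ n → Class i w α → Class i (ℤ.- w) (n ℕ.∸ α)
  negate-class {i} {w} i≤s {α} α≤n (class r eq) = class r (begin
    + (n ℕ.∸ α)                                            ≈⟨ n-α≈-α ⟩
    ℤ.- (+ α)                                              ≈⟨ M.neg-cong eq ⟩
    ℤ.- (+ (p ^ i) ℤ.* (w ℤ.* L ℤ.^ r))
      ≡⟨ solve 3 (λ P w x → :- (P :* (w :* x)) := P :* (:- w :* x)) ≡.refl (+ (p ^ i)) w (L ℤ.^ r) ⟩
    + (p ^ i) ℤ.* (ℤ.- w ℤ.* L ℤ.^ r)                      ∎)
    where
    open ℤSolver.+-*-Solver
    module M = Mod (p ^ i ℕ.* p)
    open M.Reasoning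
    M∣n : p ^ i ℕ.* p ∣ n
    M∣n = ℕ.∣m⇒∣m*n Q (subst (_∣ p ^ suc s) (ℕ.*-comm p (p ^ i)) (^-monoʳ-∣ p (ℕ.s≤s i≤s)))
    n-α≈-α : + (n ℕ.∸ α) M.≈ ℤ.- (+ α)
    n-α≈-α = mod (subst (+ (p ^ i ℕ.* p) ∣ᶻ_)
        (≡.trans (cong +_ (≡.sym (ℕ.m∸n+n≡m α≤n))) (≡.trans (ℤ.pos-+ (n ℕ.∸ α) α)
      (solve 2 (λ x a → x :+ a := x :- (:- a)) ≡.refl (+ (n ℕ.∸ α)) (+ α))))
          (ℤ.∣ᵤ⇒∣ {+ (p ^ i ℕ.* p)} {+ n} M∣n))

  negate-multiple : ∀ {i w} → i ℕ.≤ s → ∀ {α} → α ℕ.≤ n → Class i w α × Q ∣ α →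
      Class i (ℤ.- w) (n ℕ.∸ α) × Q ∣ n ℕ.∸ α
  negate-multiple i≤s α≤n (c , Q∣α) = negate-class i≤s α≤n c , ℕ.∣m+n∣m⇒∣n
      (subst (Q ∣_) (≡.sym (ℕ.m+[n∸m]≡n α≤n)) (ℕ.n∣m*n (p ^ suc s))) Q∣α

  count-negate : ∀ {i w} → i ℕ.≤ s → ∑< n (λ α → [ multiple? i (ℤ.- w) α ]) ≡ ∑< n (λ α → [ multiple? i w α ])
  count-negate {i} {w} i≤s = ≡.trans
    (∑<-cong< n (λ α α<n → []-cong (multiple? i (ℤ.- w) α) (multiple? i w (n ℕ.∸ α)) (equiv (ℕ.<⇒≤ α<n))))
    (∑<-negate n (λ α → [ multiple? i w α ]) (λ α → []-cong (multiple? i w (α ℕ.+ n)) (multiple? i w α)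
      (×-⇔ (periodic-∣ {P = Class i w} (Class-periodic i≤s) (ℕ.m∣m*n Q) α) (∣-+-⇔ (ℕ.n∣m*n (p ^ suc s)) α))))
    where
    equiv : ∀ {α} → α ℕ.≤ n → (Class i (ℤ.- w) α × Q ∣ α) ⇔ (Class i w (n ℕ.∸ α) × Q ∣ n ℕ.∸ α)
    equiv {α} α≤n = mk⇔
      (λ c → subst (λ v → Class i v (n ℕ.∸ α) × Q ∣ n ℕ.∸ α) (ℤ.neg-involutive w) (negate-multiple i≤s α≤n c))
      (λ c → subst (λ β → Class i (ℤ.- w) β × Q ∣ β) (ℕ.m∸[m∸n]≡n α≤n) (negate-multiple i≤s (ℕ.m∸n≤m n α) c))

  -- Members of the class are multiples of pⁱ, so those divisible by Q are of the form α = u Q pⁱ,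
  -- and α < n bounds u by p^(s + 1 - i).
  count-multiples : ∀ {i w} → i ℕ.≤ s → ∑< n (λ α → [ multiple? i w α ]) ≡ ∑< (p ^ (suc s ℕ.∸ i)) (λ u →
      [ Class? i w (u ℕ.* Q ℕ.* p ^ i) ])
  count-multiples {i} {w} i≤s = begin
    ∑< n (λ α → [ multiple? i w α ])
      ≡⟨ ∑<-cong n (λ α → ≡.trans ([]-cong (multiple? i w α) (D ∣? α ×-dec Class? i w α) (both α))
         ([]-× (D ∣? α) (Class? i w α))) ⟩
    ∑< n (λ α → [ D ∣? α ] ℕ.* [ Class? i w α ])
      ≡⟨ cong (λ N → ∑< N (λ α → [ D ∣? α ] ℕ.* [ Class? i w α ])) n≡ ⟩
    ∑< (M ℕ.* D) (λ α → [ D ∣? α ] ℕ.* [ Class? i w α ])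
      ≡⟨ ∑<-multiples D {{D≢0}} M (λ α → [ Class? i w α ]) ⟩
    ∑< M (λ u → [ Class? i w (u ℕ.* D) ])
      ≡⟨ ∑<-cong M (λ u → cong (λ α → [ Class? i w α ]) (≡.sym (ℕ.*-assoc u Q (p ^ i)))) ⟩
    ∑< M (λ u → [ Class? i w (u ℕ.* Q ℕ.* p ^ i) ])                 ∎
    where
    open ≡-Reasoning
    D = Q ℕ.* p ^ i
    M = p ^ (suc s ℕ.∸ i)
    D≢0 : NonZero D
    D≢0 = ℕ.m*n≢0 Q (p ^ i) {{ℕ.m^n≢0 q (suc t)}} {{ℕ.m^n≢0 p i}}
    n≡ : n ≡ M ℕ.* D
    n≡ = begin
      p ^ suc s ℕ.* Q
        ≡⟨ cong (λ k → p ^ k ℕ.* Q) (ℕ.m∸n+n≡m {suc s} {i} (ℕ.m≤n⇒m≤1+n i≤s)) ⟨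
      p ^ (suc s ℕ.∸ i ℕ.+ i) ℕ.* Q            ≡⟨ cong (ℕ._* Q) (ℕ.^-distribˡ-+-* p (suc s ℕ.∸ i) i) ⟩
      M ℕ.* p ^ i ℕ.* Q
        ≡⟨ ≡.trans (ℕ.*-assoc M (p ^ i) Q) (cong (M ℕ.*_) (ℕ.*-comm (p ^ i) Q)) ⟩
      M ℕ.* D                                  ∎
    both : ∀ α → (Class i w α × Q ∣ α) ⇔ (D ∣ α × Class i w α)
    both α = mk⇔ (λ (c , Q∣α) → coprime-∣-* (coprime-powers pq pp (p≢q ∘ ≡.sym) (suc t) i) Q∣α (Class-∣ c) , c)
                 (λ (D∣α , c) → c , ℕ.∣-trans (ℕ.m∣m*n (p ^ i)) D∣α)

  exclusive : ∀ {i w} v → Unit w → Class i w (v ℕ.* p ^ i) → ¬ Class i (ℤ.- w) (v ℕ.* p ^ i)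
  exclusive {i} {w} v cw c c⁻ = l^a≉-l^b (proj₁ r) (proj₁ r⁻) (ℙ.cancelˡ {w} (ℙ-unit {w} cw)
    (ℙ.≈-trans (ℙ.≈-sym (proj₂ r)) (subst (+ v ℙ.≈_)
        (solve 2 (λ w x → :- w :* x := w :* :- x) ≡.refl w (L ℤ.^ proj₁ r⁻)) (proj₂ r⁻))))
    where
    open ℤSolver.+-*-Solver
    r  = to (Class⇔ratio i {w} v) c
    r⁻ = to (Class⇔ratio i {ℤ.- w} v) c⁻

  exhaustive : ∀ i {w} v → Unit w → ¬ p ∣ v → Class i w (v ℕ.* p ^ i) ⊎ Class i (ℤ.- w) (v ℕ.* p ^ i)
  exhaustive i {w} v cw p∤v = signed (unit-ratio {+ v} {w} (∤⇒unit {+ v} p∤v) cw)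
    where
    open ℤSolver.+-*-Solver
    signed : (∃ λ k → + v ℙˢ.≈ w ℤ.* L ℤ.^ k ⊎ + v ℙˢ.≈ w ℤ.* (ℤ.- (L ℤ.^ k))) →
        Class i w (v ℕ.* p ^ i) ⊎ Class i (ℤ.- w) (v ℕ.* p ^ i)
    signed (k , inj₁ eq) = inj₁ (from (Class⇔ratio i {w} v) (k , ℙˢ.weaken p∣pˢ eq))
    signed (k , inj₂ eq) = inj₂ (from (Class⇔ratio i {ℤ.- w} v)
        (k , subst (+ v ℙ.≈_) (solve 2 (λ w x → w :* :- x := :- w :* x) ≡.refl w (L ℤ.^ k))
        (ℙˢ.weaken p∣pˢ eq)))

  -- Q is prime to p, so u Q is a unit at p just when p does not divide u. The units split into the
  -- disjoint classes of w and - w, and neither contains a multiple of p.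
  class-partition : ∀ i {w} u → Unit w → [ Class? i w (u ℕ.* Q ℕ.* p ^ i) ] ℕ.+ [ Class? i (ℤ.- w)
      (u ℕ.* Q ℕ.* p ^ i) ] ≡ [ ¬? (p ∣? u) ]
  class-partition i {w} u cw = by-cases (p ∣? u)
    where
    v = u ℕ.* Q
    p∤v : ¬ p ∣ u → ¬ p ∣ v
    p∤v p∤u p∣v = [ p∤u , coprime⇒∤ 0 pp (coprime-powers pp pq p≢q 1 (suc t)) ]′ (euclidsLemma u Q pp p∣v)
    C = Class? i w (v ℕ.* p ^ i)
    C⁻ = Class? i (ℤ.- w) (v ℕ.* p ^ i)
    one : Class i w (v ℕ.* p ^ i) ⊎ Class i (ℤ.- w) (v ℕ.* p ^ i) → [ C ] ℕ.+ [ C⁻ ] ≡ 1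
    one (inj₁ c) = cong₂ ℕ._+_ ([]-yes C c) ([]-no C⁻ (exclusive {i} {w} v cw c))
    one (inj₂ c) = cong₂ ℕ._+_ ([]-no C (λ c⁺ → exclusive {i} {w} v cw c⁺ c)) ([]-yes C⁻ c)
    by-cases : (p∣u? : Dec (p ∣ u)) → [ C ] ℕ.+ [ C⁻ ] ≡ [ ¬? p∣u? ]
    by-cases (yes p∣u) = cong₂ ℕ._+_
      ([]-no C λ c → Class-∤ {i} {w} v cw c (ℕ.∣m⇒∣m*n Q p∣u))
      ([]-no C⁻ λ c → Class-∤ {i} {ℤ.- w} v (unit-neg {w} cw) c (ℕ.∣m⇒∣m*n Q p∣u))
    by-cases (no p∤u) = one (exhaustive i {w} v cw (p∤v p∤u))

  -- α ↦ n - α exchanges the classes of w and - w, so each contains half of the α exactly divisible by pⁱ.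
  count-class : ∀ {i w} → i ℕ.≤ s → Unit w → ∑< n (λ α → [ multiple? i w α ]) ≡ φ (p ^ (suc s ℕ.∸ i)) / 2
  count-class {i} {w} i≤s cw = ≡.trans (≡.sym (ℕ.m*n/n≡m N 2)) (cong (_/ 2) (begin
    N ℕ.* 2                                              ≡⟨ ℕ.*-comm N 2 ⟩
    N ℕ.+ (N ℕ.+ 0)                                      ≡⟨ cong (N ℕ.+_) (ℕ.+-identityʳ N) ⟩
    N ℕ.+ N                                              ≡⟨ cong (N ℕ.+_) (count-negate {i} {w} i≤s) ⟨
    N ℕ.+ ∑< n (λ α → [ multiple? i (ℤ.- w) α ])
      ≡⟨ cong₂ ℕ._+_ (count-multiples {i} {w} i≤s) (count-multiples {i} {ℤ.- w} i≤s) ⟩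
    ∑< M (λ u → [ Class? i w (u ℕ.* Q ℕ.* p ^ i) ]) ℕ.+ ∑< M (λ u → [ Class? i (ℤ.- w) (u ℕ.* Q ℕ.* p ^ i) ])
      ≡⟨ ∑-distrib-+ {M} _ _ ⟨
    ∑< M (λ u → [ Class? i w (u ℕ.* Q ℕ.* p ^ i) ] ℕ.+ [ Class? i (ℤ.- w) (u ℕ.* Q ℕ.* p ^ i) ])
      ≡⟨ ∑<-cong M (λ u → class-partition i {w} u cw) ⟩
    ∑< M (λ u → [ ¬? (p ∣? u) ])
      ≡⟨ cong (λ k → ∑< (p ^ k) (λ u → [ ¬? (p ∣? u) ])) (ℕ.+-∸-assoc 1 i≤s) ⟩
    ∑< (p ^ suc (s ℕ.∸ i)) (λ u → [ ¬? (p ∣? u) ])       ≡⟨ φ-prime-power pp (s ℕ.∸ i) ⟨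
    φ (p ^ suc (s ℕ.∸ i))                                ≡⟨ cong (λ k → φ (p ^ k)) (ℕ.+-∸-assoc 1 i≤s) ⟨
    φ (p ^ (suc s ℕ.∸ i))                                ∎))
    where
    open ≡-Reasoning
    N = ∑< n (λ α → [ multiple? i w α ])
    M = p ^ (suc s ℕ.∸ i)

-- Products of coset sums.

pos-^ : ∀ q k → + (q ^ k) ≡ (+ q) ℤ.^ k
pos-^ q zero    = ≡.refl
pos-^ q (suc k) = ≡.trans (ℤ.pos-* q (q ^ k)) (cong (+ q ℤ.*_) (pos-^ q k))

module CosetProducts {p q l d : ℕ} (s t : ℕ) (pp : Prime p) (pq : Prime q) (p≢q : p ≢ q) (2<p : 2 ℕ.< p)
  (ord : HasOrder (p ^ suc s) (+ l) d) (φ≡d*2 : φ (p ^ suc s) ≡ d ℕ.* 2) (d-odd : ¬ 2 ∣ d)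
  (prim : PrimitiveRoot (q ^ suc t) (+ l)) (d⊥φ : ℕ.Coprime (φ (q ^ suc t)) d)
  {g : ℤ} (g-primᵖ : PrimitiveRoot (p ^ suc s) g) (g-primᑫ : PrimitiveRoot (q ^ suc t) g)
  {c ℓ : Level} (R : CommutativeRing c ℓ) (e : ℕ → CommutativeRing.Carrier R)
  (e-+ : ∀ α β → CommutativeRing._≈_ R (e (α ℕ.+ β)) (CommutativeRing._*_ R (e α) (e β)))
  (e-n : CommutativeRing._≈_ R (e (p ^ suc s ℕ.* q ^ suc t)) (CommutativeRing.1# R))
  where

  open Classes s pp 2<p ord φ≡d*2 d-odd
  open Cosets s t pp pq p≢q 2<p ord φ≡d*2 d-odd prim d⊥φ using (qᵐ-unit; Unit′; coset⇔)
  private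
    L = + l
    M = p ^ suc s
    t′ = suc t
    n = M ℕ.* q ^ t′
    instance
      q≢0 : NonZero q
      q≢0 = prime⇒nonZero pq
    q⊥M : ℕ.Coprime q M
    q⊥M = ℕ.sym {M} {q} (prime⇒coprime-^ pp (distinct-primes-∤ pp pq p≢q) (suc s))

  open CommutativeRing R
  open ListSums commutativeSemiring
  open LayerProducts R n e e-+ e-n M q t′ ≡.refl q⊥M
  open SetoidReasoning setoid
  open SemiringMult semiring using (×-congʳ; ×-congˡ) renaming (_×_ to _·_)

  cosetSum : ℤ → Carrier
  cosetSum γ = ∑ᴸ (filter (inCoset? n l γ) (allFin n)) (e ∘ toℕ)

  χ : ℕ → ℕ → Carrier
  χ i m = cosetSum (+ (p ^ i ℕ.* q ^ m))

  χ* : ℕ → ℕ → Carrier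
  χ* i m = cosetSum (+ (p ^ i ℕ.* q ^ m) ℤ.* g)

  χ⟨_⟩ : ℤ → ℕ → ℕ → Carrier
  χ⟨ w ⟩ i m = cosetSum (+ (p ^ i ℕ.* q ^ m) ℤ.* w)

  χ≈χ⟨1⟩ : ∀ i m → χ i m ≈ χ⟨ + 1 ⟩ i m
  χ≈χ⟨1⟩ i m = reflexive (cong cosetSum (≡.sym (ℤ.*-identityʳ _)))

  -- The class of pⁱqʲw stays fixed while the level m varies. A coset at level m carries qᵐ instead
  -- of qʲ, so the two must be compared modulo powers of l.
  A? : ∀ i j w → Decidable (Class i (+ (q ^ j) ℤ.* w))
  A? i j w = Class? i (+ (q ^ j) ℤ.* w)

  χ⟨⟩≈S : ∀ {i m j w w′} → i ℕ.≤ s → m ℕ.≤ t′ → Unit w → Unit′ w →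
          (∃ λ r → + (q ^ m) ℤ.* w ℙ.≈ + (q ^ j) ℤ.* w′ ℤ.* L ℤ.^ r) → χ⟨ w ⟩ i m ≈ S (exactly? (A? i j w′) m)
  χ⟨⟩≈S {i} {m} {j} {w} {w′} i≤s m≤t cw cw′ ratio = cosetSum≈S (inCoset? n l (+ (p ^ i ℕ.* q ^ m) ℤ.* w))
      (exactly? (A? i j w′) m)
    (λ α → ⇔.trans (coset⇔ {i} {m} {w} i≤s m≤t cw cw′ α)
        (×-⇔ (Class-⇔ i {+ (q ^ m) ℤ.* w} {+ (q ^ j) ℤ.* w′} ratio (toℕ α)) (mk⇔ id id)))

  unit-1 : Unit (+ 1)
  unit-1 = ℕ.sym (ℕ.1-coprimeTo M)

  unit′-1 : Unit′ (+ 1)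
  unit′-1 = ℕ.sym (ℕ.1-coprimeTo (q ^ t′))

  trivial-ratio : ∀ u → ∃ λ r → u ℙ.≈ u ℤ.* L ℤ.^ r
  trivial-ratio u = 0 , subst (u ℙ.≈_) (≡.sym (ℤ.*-identityʳ u)) ℙ.≈-refl

  product-formula : ∀ {i i′ j} → i ℕ.< i′ → i′ ℕ.≤ s → j ℕ.≤ t →
    let k = φ (p ^ (suc s ℕ.∸ i′)) / 2 in
    χ i j * χ* i′ j ≈
      (k ℕ.* (q ℕ.∸ 2) ℕ.* q ^ (t′ ℕ.∸ j ℕ.∸ 1)) · χ i j +
      (k ℕ.* φ (q ^ (t′ ℕ.∸ j))) · T (A? i j (+ 1)) (suc j)
  product-formula {i} {i′} {j} i<i′ i′≤s j≤t = begin
    χ i j * χ* i′ j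
      ≈⟨ *-cong χ≈ (χ⟨⟩≈S {i′} {j} {j} {g} {g} i′≤s j≤t′ (Order.coprime g-primᵖ) (Order.coprime g-primᑫ)
          (trivial-ratio _)) ⟩
    S (exactly? A j) * S (exactly? B j)
      ≈⟨ product A B (Class-periodic i≤s) (Class-periodic i′≤s) (Class-invariant i<i′) (ℕ.s≤s j≤t) r q≡2+r N
          count ⟩
    (N ℕ.* r) · S (exactly? A j) + (N ℕ.* suc r) · T A (suc j)
      ≈⟨ +-cong (trans (×-congʳ (N ℕ.* r) (sym χ≈)) (×-congˡ N*r≡)) (×-congˡ N*1+r≡) ⟩
    (k ℕ.* (q ℕ.∸ 2) ℕ.* q ^ (t′ ℕ.∸ j ℕ.∸ 1)) · χ i j + (k ℕ.* φ (q ^ (t′ ℕ.∸ j))) · T A (suc j) ∎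
    where
    A = A? i j (+ 1)
    B = A? i′ j g
    i≤s = ℕ.≤-trans (ℕ.<⇒≤ i<i′) i′≤s
    j≤t′ = ℕ.m≤n⇒m≤1+n j≤t
    k = φ (p ^ (suc s ℕ.∸ i′)) / 2
    r = q ℕ.∸ 2
    -- This is the size of level j + 1: there are t - j steps up to the top level t + 1, each
    -- dividing the size by q, and the top level has k elements.
    N = q ^ (t ℕ.∸ j) ℕ.* k
    q≡2+r : q ≡ 2 ℕ.+ r
    q≡2+r = ≡.sym (ℕ.m+[n∸m]≡n (ℕ.nonTrivial⇒n>1 q {{prime⇒nonTrivial pq}}))
    χ≈ : χ i j ≈ S (exactly? A j)
    χ≈ = trans (χ≈χ⟨1⟩ i j) (χ⟨⟩≈S {i} {j} {j} {+ 1} {+ 1} i≤s j≤t′ unit-1 unit′-1 (trivial-ratio _))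
    module # = LayerCounts n M q t′ ≡.refl q⊥M
    count : #.# (#.level? B (suc j)) ≡ N
    count = ≡.trans (#.#-level B (Class-periodic i′≤s) (t ℕ.∸ j) (suc j)
        (≡.trans (ℕ.+-suc (t ℕ.∸ j) j) (cong suc (ℕ.m∸n+n≡m j≤t))))
      (cong (q ^ (t ℕ.∸ j) ℕ.*_) (ClassCounts.count-class s t pp pq p≢q 2<p ord φ≡d*2 d-odd {i′}
          {+ (q ^ j) ℤ.* g} i′≤s
        (unit-* {+ (q ^ j)} {g} (qᵐ-unit j) (Order.coprime g-primᵖ))))
    t′∸j≡ : t′ ℕ.∸ j ≡ suc (t ℕ.∸ j)
    t′∸j≡ = ℕ.+-∸-assoc 1 j≤t
    open ℕSolver.+-*-Solver
    N*r≡ : N ℕ.* r ≡ k ℕ.* r ℕ.* q ^ (t′ ℕ.∸ j ℕ.∸ 1)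
    N*r≡ = ≡.trans (solve 3 (λ x k r → x :* k :* r := k :* r :* x) ≡.refl (q ^ (t ℕ.∸ j)) k r)
      (cong (λ m → k ℕ.* r ℕ.* q ^ (m ℕ.∸ 1)) (≡.sym t′∸j≡))
    N*1+r≡ : N ℕ.* suc r ≡ k ℕ.* φ (q ^ (t′ ℕ.∸ j))
    N*1+r≡ = ≡.trans (solve 3 (λ x k r → x :* k :* r := k :* (x :* r)) ≡.refl (q ^ (t ℕ.∸ j)) k (suc r))
      (cong (k ℕ.*_) (≡.trans (cong (λ m → q ^ (t ℕ.∸ j) ℕ.* (m ℕ.∸ 1)) (≡.sym q≡2+r))
        (≡.trans (≡.sym (φ[p^1+e] pq (t ℕ.∸ j))) (cong (λ m → φ (q ^ m)) (≡.sym t′∸j≡)))))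

  -- Taking qʲ out of qᵐ leaves q^(m - j), whose sign relative to ⟨l⟩ decides between `χ` and `χ*`.
  shifted-ratio : ∀ {j m w} → j ℕ.≤ m → (∃ λ r → (+ q) ℤ.^ (m ℕ.∸ j) ℤ.* w ℙ.≈ L ℤ.^ r) →
                  ∃ λ r → + (q ^ m) ℤ.* w ℙ.≈ + (q ^ j) ℤ.* + 1 ℤ.* L ℤ.^ r
  shifted-ratio {j} {m} {w} j≤m (r , eq) = r , subst₂ ℙ._≈_ left
      (cong (ℤ._* L ℤ.^ r) (≡.sym (ℤ.*-identityʳ (+ (q ^ j))))) (ℙ.*-congˡ (+ (q ^ j)) eq)
    where
    left : + (q ^ j) ℤ.* ((+ q) ℤ.^ (m ℕ.∸ j) ℤ.* w) ≡ + (q ^ m) ℤ.* w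
    left = ≡.trans (≡.sym (ℤ.*-assoc (+ (q ^ j)) ((+ q) ℤ.^ (m ℕ.∸ j)) w)) (cong (ℤ._* w)
      (≡.trans (cong (ℤ._* (+ q) ℤ.^ (m ℕ.∸ j)) (pos-^ q j))
          (≡.trans (≡.sym (ℤ.^-distribˡ-+-* (+ q) j (m ℕ.∸ j)))
        (≡.trans (cong ((+ q) ℤ.^_) (ℕ.m+[n∸m]≡n j≤m)) (≡.sym (pos-^ q m))))))

  χ-layer : ∀ {i j m} → i ℕ.≤ s → j ℕ.< m → m ℕ.≤ t′ → (∃ λ r → (+ q) ℤ.^ (m ℕ.∸ j) ℙ.≈ L ℤ.^ r) →
      χ i m ≈ S (exactly? (A? i j (+ 1)) m)
  χ-layer {i} {j} {m} i≤s j<m m≤t (r , eq) = trans (χ≈χ⟨1⟩ i m)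
      (χ⟨⟩≈S {i} {m} {j} {+ 1} {+ 1} i≤s m≤t unit-1 unit′-1
    (shifted-ratio {w = + 1} (ℕ.<⇒≤ j<m) (r , subst (ℙ._≈ L ℤ.^ r) (≡.sym (ℤ.*-identityʳ _)) eq)))

  χ*-layer : ∀ {i j m} → i ℕ.≤ s → j ℕ.< m → m ℕ.≤ t′ → (∃ λ r → (+ q) ℤ.^ (m ℕ.∸ j) ℤ.* g ℙ.≈ L ℤ.^ r) →
      χ* i m ≈ S (exactly? (A? i j (+ 1)) m)
  χ*-layer {i} {j} {m} i≤s j<m m≤t ratio = χ⟨⟩≈S {i} {m} {j} {g} {+ 1} i≤s m≤t (Order.coprime g-primᵖ)
      (Order.coprime g-primᑫ)
    (shifted-ratio {w = g} (ℕ.<⇒≤ j<m) ratio)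

  -- As q is a power of l modulo p, the class at p is the same on every level.
  residue-sum : QuadraticResidue p (+ q) → ∀ {i j} → i ℕ.≤ s → j ℕ.≤ t →
      ∑ᴸ ⦅ j , t′ ⦆ (χ i) ≈ T (A? i j (+ 1)) (suc j)
  residue-sum qr {i} {j} i≤s j≤t = trans
    (∑ᴸ-cong-All (All.map (λ {m} (j<m , m≤t) → χ-layer i≤s j<m m≤t (power (m ℕ.∸ j))) (⦅⦆-bounds j t′)))
    (∑-layers (A? i j (+ 1)) (ℕ.s≤s j≤t))
    where
    power : ∀ k → ∃ λ r → (+ q) ℤ.^ k ℙ.≈ L ℤ.^ r
    power k = proj₁ q≈ ℕ.* k , subst ((+ q) ℤ.^ k ℙ.≈_) (ℤ.^-*-assoc L (proj₁ q≈) k) (ℙ.^-cong (proj₂ q≈) k)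
      where q≈ = residue⇒power {+ q} qr

  -- Both q and g are negatives of powers of l modulo p. An even power of q loses the sign; an odd
  -- one keeps it, and the factor g cancels it.
  nonresidue-sum : QuadraticNonresidue p (+ q) → ∀ {i j} → i ℕ.≤ s → j ℕ.≤ t →
    ∑ᴸ (filter (λ m → ¬? (2 ∣? (m ℕ.∸ j))) ⦅ j , t′ ⦆) (χ* i) +
    ∑ᴸ (filter (λ m → 2 ∣? (m ℕ.∸ j)) ⦅ j , t′ ⦆) (χ i) ≈ T (A? i j (+ 1)) (suc j)
  nonresidue-sum qnr {i} {j} i≤s j≤t = trans (+-cong
      (∑ᴸ-cong-All (All.map (λ {m} (odd , j<m , m≤t) → χ*-layer i≤s j<m m≤t (odd-power odd))
          (bounds (λ m → ¬? (2 ∣? (m ℕ.∸ j))))))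
      (∑ᴸ-cong-All (All.map (λ {m} (even , j<m , m≤t) → χ-layer i≤s j<m m≤t (even-power even))
          (bounds (λ m → 2 ∣? (m ℕ.∸ j))))))
    (trans (∑ᴸ-split (λ m → 2 ∣? (m ℕ.∸ j)) ⦅ j , t′ ⦆ (λ m → S (exactly? (A? i j (+ 1)) m)))
      (∑-layers (A? i j (+ 1)) (ℕ.s≤s j≤t)))
    where
    bounds : ∀ {P : Pred ℕ _} (P? : Decidable P) → All (λ m → P m × j ℕ.< m × m ℕ.≤ t′) (filter P? ⦅ j , t′ ⦆)
    bounds P? = All.zip (All.all-filter P? ⦅ j , t′ ⦆ , All.filter⁺ P? (⦅⦆-bounds j t′))
    a = proj₁ (nonresidue⇒-power {+ q} qnr)
    q≈ = proj₂ (nonresidue⇒-power {+ q} qnr)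
    b = proj₁ (primitiveRoot⇒-power g-primᵖ)
    g≈ = proj₂ (primitiveRoot⇒-power g-primᵖ)
    even-power : ∀ {k} → 2 ∣ k → ∃ λ r → (+ q) ℤ.^ k ℙ.≈ L ℤ.^ r
    even-power (ℕ.divides h ≡.refl) = a ℕ.* (h ℕ.* 2) ,
      subst ((+ q) ℤ.^ (h ℕ.* 2) ℙ.≈_) (≡.trans (^-even (L ℤ.^ a) h) (ℤ.^-*-assoc L a (h ℕ.* 2)))
          (ℙ.^-cong q≈ (h ℕ.* 2))
    odd-power : ∀ {k} → ¬ 2 ∣ k → ∃ λ r → (+ q) ℤ.^ k ℤ.* g ℙ.≈ L ℤ.^ r
    odd-power {k} odd = a ℕ.* k ℕ.+ b , subst ((+ q) ℤ.^ k ℤ.* g ℙ.≈_) signs (ℙ.*-cong (ℙ.^-cong q≈ k) g≈)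
      where
      open ℤSolver.+-*-Solver
      signs : (ℤ.- (L ℤ.^ a)) ℤ.^ k ℤ.* ℤ.- (L ℤ.^ b) ≡ L ℤ.^ (a ℕ.* k ℕ.+ b)
      signs = ≡.trans (cong (ℤ._* ℤ.- (L ℤ.^ b)) (neg-^ (L ℤ.^ a) odd))
        (≡.trans (solve 2 (λ x y → :- x :* :- y := x :* y) ≡.refl ((L ℤ.^ a) ℤ.^ k) (L ℤ.^ b))
          (≡.trans (cong (ℤ._* L ℤ.^ b) (ℤ.^-*-assoc L a k)) (≡.sym (ℤ.^-distribˡ-+-* L (a ℕ.* k) b))))

-- Powers of x and integer scalars in the quotient ring.

module PowersModulo {c ℓ : Level} (A : CommutativeRing c ℓ) (x : CommutativeRing.Carrier A) (n : ℕ) where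

  open CommutativeRing A
  open SemiringExp semiring using (^-homo-*) renaming (_^_ to _↑_)
  open Quotient A (x ↑ n - 1#)
  open RawMagmaDefinitions *-rawMagma using (_,_)

  power-+ : ∀ α β → x ↑ (α ℕ.+ β) ∼ x ↑ α * x ↑ β
  power-+ α β = ∼-of-≈ (^-homo-* x α β)

  power-n : x ↑ n ∼ 1#
  power-n = mod (1# , *-identityˡ (x ↑ n - 1#))

module Scalars (s t p q l : ℕ) (g : ℤ) where

  open CosetSums s t p q l g using (𝔽[x]; ring; ⟦_⟧)
  open CommutativeRing ring
  open SemiringMult semiring renaming (_×_ to _·_)
  open SetoidReasoning setoid
  open Polynomial (𝔽 l) using (coeffwise)

  -- The left side is a list with the single coefficient 0, the right side the empty list; only
  -- their coefficients agree.
  ⟦0⟧ : ⟦ 0 ⟧ ≈ 0#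
  ⟦0⟧ = Quotient.∼-of-≈ 𝔽[x] _ (coeffwise λ
    { zero    → CommutativeRing.refl (𝔽 l)
    ; (suc k) → CommutativeRing.refl (𝔽 l)
    })

  ⟦⟧-scalar : ∀ k x → ⟦ k ⟧ * x ≈ k · x
  ⟦⟧-scalar zero    x = trans (*-congʳ {x} ⟦0⟧) (zeroˡ x)
  ⟦⟧-scalar (suc k) x = begin
    -- Lists with one coefficient add by computation, so `1# + ⟦ k ⟧` evaluates to `⟦ suc k ⟧`.
    ⟦ suc k ⟧ * x            ≡⟨⟩
    (1# + ⟦ k ⟧) * x         ≈⟨ distribʳ x 1# ⟦ k ⟧ ⟩
    1# * x + ⟦ k ⟧ * x       ≈⟨ +-cong (*-identityˡ x) (⟦⟧-scalar k x) ⟩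
    suc k · x                ∎

  rescale : ∀ a b {x y y′ z} → z ≈ a · x + b · y → y′ ≈ y → z ≈ ⟦ a ⟧ * x + ⟦ b ⟧ * y′
  rescale a b {x} {y} {y′} {z} z≈ y′≈y = begin
    z                          ≈⟨ z≈ ⟩
    a · x + b · y              ≈⟨ +-cong (⟦⟧-scalar a x) (⟦⟧-scalar b y) ⟨
    ⟦ a ⟧ * x + ⟦ b ⟧ * y      ≈⟨ +-congˡ {⟦ a ⟧ * x} (*-congˡ {⟦ b ⟧} y′≈y) ⟨
    ⟦ a ⟧ * x + ⟦ b ⟧ * y′     ∎

open import Data.Nat using (ℕ; _*_; _∸_; _^_; _/_; _%_; _≤_; _<_)
open import Data.Nat.Divisibility using (_∣_; _∣?_)
open import Data.Nat.GCD using (gcd)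
open import Data.Nat.Primality using (Prime)
open import Data.Integer using (ℤ; +_)
open import Data.List using (filter)
open import Data.Product using (_×_)
open import Relation.Binary.PropositionalEquality using (_≡_; _≢_)
open import Relation.Nullary using (¬_)
open import Relation.Nullary.Decidable using (¬?)
open import Defs

theorem4p15 :
  (s t p q l : ℕ) → 1 ≤ s → 1 ≤ t →
  Prime p → Prime q → Prime l → p ≢ q → p ≢ l → q ≢ l →
  ¬ (2 ∣ p) → ¬ (2 ∣ q) → p % 4 ≡ 3 →
  HasOrder (p ^ s) (+ l) (φ (p ^ s) / 2) →
  HasOrder (q ^ t) (+ l) (φ (q ^ t)) →
  gcd (φ (p ^ s)) (φ (q ^ t)) ≡ 2 →
  (g : ℤ) → PrimitiveRoot (p ^ s) g → PrimitiveRoot (q ^ t) g →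
  (i i′ j : ℕ) → i < i′ → i′ ≤ s ∸ 1 → j ≤ t ∸ 1 →
  let open CosetSums s t p q l g
      a = φ (p ^ (s ∸ i′)) / 2 * (q ∸ 2) * q ^ (t ∸ j ∸ 1)
      b = φ (p ^ (s ∸ i′)) / 2 * φ (q ^ (t ∸ j))
  in
  (QuadraticResidue p (+ q) →
    χ i j ⊗ χ* i′ j ≈ ⟦ a ⟧ ⊗ χ i j ⊕ ⟦ b ⟧ ⊗ ∑ ⦅ j , t ⦆ (χ i))
  ×
  (QuadraticNonresidue p (+ q) →
    χ i j ⊗ χ* i′ j ≈
      ⟦ a ⟧ ⊗ χ i j ⊕
      ⟦ b ⟧ ⊗ (∑ (filter (λ m → ¬? (2 ∣? (m ∸ j))) ⦅ j , t ⦆) (χ* i) ⊕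
               ∑ (filter (λ m → 2 ∣? (m ∸ j)) ⦅ j , t ⦆) (χ i)))
theorem4p15 (suc s) (suc t) p q l (s≤s _) (s≤s _) pp pq _ p≢q _ _ _ _ p%4≡3 ordᵖ ordᑫ gcd≡2
  g gᵖ gᑫ i i′ j i<i′ i′≤s j≤t =
    (λ qr → rescale a b product (P.residue-sum qr {i} {j} i≤s j≤t))
  , (λ qnr → rescale a b product (P.nonresidue-sum qnr {i} {j} i≤s j≤t))
  where
  open HalfTotient pp p%4≡3
  open CosetSums (suc s) (suc t) p q l g using (n; ring; 𝔽[x])
  open PowersModulo 𝔽[x] (Polynomial.X (𝔽 l)) n
  open Scalars (suc s) (suc t) p q l g using (rescale)

  d : ℕ
  d = φ (p ^ suc s) / 2

  i≤s : i ≤ s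
  i≤s = ℕ.≤-trans (ℕ.<⇒≤ i<i′) i′≤s

  -- A common divisor of d and φ(qᵗ⁺¹) divides gcd(2d, φ(qᵗ⁺¹)) = 2, and it is not 2 because d is
  -- odd.
  d⊥φ : ℕ.Coprime (φ (q ^ suc t)) d
  d⊥φ {k} (k∣φ , k∣d) with prime⇒irreducible prime[2]
    (subst (k ∣_) gcd≡2 (ℕ.gcd-greatest (subst (k ∣_) (≡.sym (φ≡φ/2*2 s)) (ℕ.∣m⇒∣m*n 2 k∣d)) k∣φ))
  ... | inj₁ k≡1 = k≡1
  ... | inj₂ k≡2 = contradiction (subst (_∣ d) k≡2 k∣d) (φ/2-odd s)

  module P = CosetProducts s t pp pq p≢q 2<p ordᵖ (φ≡φ/2*2 s) (φ/2-odd s) ordᑫ d⊥φ gᵖ gᑫ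
    ring (λ α → CosetSums.𝔽[x]._^_ (suc s) (suc t) p q l g (Polynomial.X (𝔽 l)) α) power-+ power-n

  a b : ℕ
  a = φ (p ^ (suc s ∸ i′)) / 2 * (q ∸ 2) * q ^ (suc t ∸ j ∸ 1)
  b = φ (p ^ (suc s ∸ i′)) / 2 * φ (q ^ (suc t ∸ j))

  product = P.product-formula {i} {i′} {j} i<i′ i′≤s j≤t
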